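{- Let $(G,X,H,f)$ be a constructible configuration. For every block $B$ of $G$ let $X^B$ be the restriction of $X$ to $V(B)$ and let $H^B=H[\bigcup_{v\in V(B)}X_v]$. Let $\mathcal{B}(G)$ be the set of blocks of $G$ and $\mathcal{B}_v(G)$ the set of blocks of $G$ containing $v$. Then for every $B\in\mathcal{B}(G)$ there is a unique function $f^B:V(H^B)\to\mathbb{N}_0$ such that (these functions together satisfying) $(B,X^B,H^B,f^B)$ is an M-, K- or C-configuration for every $B\in\mathcal{B}(G)$, and, for all $v\in V(G)$ and $x\in X_v$, $$f(x)=\sum_{B\in\mathcal{B}_v(G)}f^B(x).$$
   Context: $\mathbb{N}=\{1,2,\dots\}$, $\mathbb{N}_0=\mathbb{N}\cup\{0\}$. Graphs are finite, undirected, may have multiple edges, no loops; connected graphs are non-empty. $\mu_G(u,v)$ is the number of edges joining $u,v$; $d_G(v)$ is the number of edges incident with $v$. $tG$ has vertex set $V(G)$ and $\mu_{tG}=t\mu_G$. $K_n$, $C_n$ ($n\ge3$), $K_{s,s}$ are the simple complete graph, cycle, complete bipartite graph. A block of a graph is a maximal connected subgraph $B$ that has no separating vertex (vertex whose deletion from $B$ leaves at least two components); $G$ is a block if it is its own only block. Covers. A cover of $G$ is a pair $(X,H)$, $H$ a graph, $X$ assigning to each $v\in V(G)$ a set $X_v\subseteq V(H)$, such that the $X_v$ are pairwise disjoint with union $V(H)$, each $X_v$ is independent in $H$, and for distinct $u,v\in V(G)$ the set of edges of $H$ between $X_u$ and $X_v$ is the union of $\mu_G(u,v)$ (possibly empty)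 matchings. For $U\subseteq V(H)$ put $X_v(U)=X_v\cap U$; $(X,H)/U$ is the cover $(X',H[U])$ of $G[\{v: X_v(U)\ne\varnothing\}]$ with $X'_v=X_v(U)$. Configurations. A configuration is a tuple $(G,X,H,f)$ with $(X,H)$ a cover of the graph $G$ and $f:V(H)\to\mathbb{N}_0$. It is uniform if for some $r\ge1$ all $|X_v|=r$. Special covers (all up to renaming vertices of the cover graph). A $G$-cover is a cover with $X_v=\{x_v\}$ for all $v$ and $\mu_H(x_u,x_v)=\mu_G(u,v)$ for all distinct $u,v$. For $G=tC_n$ with $C_n=(v_1,\dots,v_n,v_1)$, a double $G$-cover is a cover with $X_{v_i}=\{x_i,x_{n+i}\}$ ($1\le i\le n$), $\mu_H(x_i,x_j)=t$ if $i-j\equiv\pm1 \pmod{2n}$ and $\mu_H(x_i,x_j)=0$ otherwise. If $s\in\mathbb{N}$ divides all multiplicities $\mu_H(x,y)$, the $s$-inflation of $(X,H)$ is the cover $(\tilde X,\tilde H)$ of $G$ obtained by replacing every $x\in V(H)$ by a set $U_x$ of $s$ new vertices, with $\tilde X_v=\bigcup_{x\in X_v}U_x$, and for distinct $x,y\in V(H)$ placing a copy of $mK_{s,s}$ with parts $U_x,U_y$, where $m=\mu_H(x,y)/s$. An inflation is an $s$-inflation for some $s\in\mathbb{N}$. Constructible configurations. The family of constructible configurations is defined recursively: a uniform configuration $(G,X,H,f)$ is constructible if one of the following holds. (K1) M-configuration: $G$ is a block and there is $U\subseteq V(H)$ such that $(X,H)/U$ is an inflation of a $G$-cover, and for $v\in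 V(G)$, $x\in X_v$: $f(x)=d_G(v)/|X_v(U)|$ if $x\in U$, else $f(x)=0$. (K2) K-configuration: $G=tK_n$ with $t,n\in\mathbb{N}$ and there are $p\ge1$, $n_1,\dots,n_p\in\mathbb{N}$ with $n_1+\dots+n_p=n-1$ and pairwise disjoint $U_1,\dots,U_p\subseteq V(H)$ such that each $(X,H)/U_i$ is an inflation of a $G$-cover, and for $v\in V(G)$, $x\in X_v$: $f(x)=tn_i/|X_v(U_i)|$ if $x\in U_i$ for some $i$, else $f(x)=0$. (K3) Odd C-configuration: $G=tC_n$ with $t\in\mathbb{N}$, $n\ge3$ odd, and there are disjoint $U_1,U_2\subseteq V(H)$ such that each $(X,H)/U_i$ is an inflation of a $G$-cover, and for $v\in V(G)$, $x\in X_v$: $f(x)=t/|X_v(U_i)|$ if $x\in U_i$ for $i\in\{1,2\}$, else $f(x)=0$. (K4) Even C-configuration: $G=tC_n$ with $t\in\mathbb{N}$, $n\ge4$ even, and there is $U\subseteq V(H)$ such that $(X,H)/U$ is an inflation of a double $G$-cover, and for $v\in V(G)$, $x\in X_v$: $f(x)=2t/|X_v(U)|$ if $x\in U$, else $f(x)=0$. (K5) There are two disjoint constructible configurations $(G^1,X^1,H^1,f^1)$, $(G^2,X^2,H^2,f^2)$ such that $G$ is obtained from the disjoint graphs $G^1,G^2$ by identifying a vertex $v^1\in V(G^1)$ and a vertex $v^2\in V(G^2)$ to a new vertex $v^*$; $H$ is obtained from the disjoint graphs $H^1,H^2$ by choosing a bijection $\pi:X^1_{v^1}\to X^2_{v^2}$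 and identifying each $x\in X^1_{v^1}$ with $\pi(x)$ to a vertex $x^*$ (so $X_{v^*}$ is the set of these $x^*$, and $X_v=X^i_v$ for other $v\in V(G^i)$); and $f(y)=f^i(y)$ for $y\in V(H^i)\setminus X^i_{v^i}$, $f(x^*)=f^1(x)+f^2(\pi(x))$ for $x\in X^1_{v^1}$. A C-configuration is an odd or an even C-configuration. -}

module Defs where

import Algebra.Properties.CommutativeMonoid.Sum
open import Data.Bool using (Bool; true; false; if_then_else_; _∧_)
open import Data.Bool.Properties using (∧-comm; ∨-comm)
open import Data.Empty using (⊥-elim)
open import Data.Fin using (Fin; zero; suc; toℕ; _↑ˡ_; _↑ʳ_)
open import Data.Fin.Properties using (any?; all?; toℕ<n; toℕ-injective) renaming (_≟_ to _≟ᶠ_)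
open import Data.Fin.Subset using (Subset; inside; outside; _∈_; _∉_; _⊆_; _∩_; _∪_; _-_; ⊤; ⁅_⁆; ∣_∣; Nonempty)
open import Data.Fin.Subset.Properties using (_∈?_; _⊆?_; anySubset?; nonempty?; ∈⊤; x∈p∩q⁺; p∩q⊆p; p∩q⊆q; ⊆-antisym)
open import Data.List using (List; []; _∷_; _++_; map; filter; length; lookup)
open import Data.List.Membership.Propositional using () renaming (_∈_ to _∈ˡ_)
open import Data.List.Membership.Propositional.Properties using (∈-map⁺; ∈-map⁻; ∈-++⁺ˡ; ∈-++⁺ʳ; ∈-filter⁺; ∈-filter⁻; ∈-lookup)
open import Data.List.Relation.Unary.All using () renaming (lookup to lookupᴬ)
import Data.List.Relation.Unary.AllPairs as AllPairs
open import Data.List.Relation.Unary.Any using (here; index)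
open import Data.List.Relation.Unary.Any.Properties using (lookup-index)
open import Data.List.Relation.Unary.Unique.Propositional using (Unique)
import Data.List.Relation.Unary.Unique.Propositional.Properties as Uniqueₚ
open import Data.Nat using (ℕ; zero; suc; _+_; _*_; _≤_; _<_; z≤n; s≤s)
open import Data.Nat.Divisibility using (_∣_; _∤_; quotient)
open import Data.Nat.Properties using (≤-refl; ≤-trans; ≤-reflexive; ≤-antisym; <-≤-trans; m<1+n⇒m<n∨m≡n; n≤1+n; *-zeroʳ; +-0-commutativeMonoid; _<?_; _≟_)
open import Data.Product using (Σ; ∃; ∃-syntax; _×_; _,_; proj₁; proj₂)
open import Data.Sum using (_⊎_; inj₁; inj₂)
open import Data.Vec using (tabulate; []; _∷_) renaming (lookup to lookupᵛ)
open import Data.Vec.Properties using (∷-injectiveʳ; []=⇒lookup; lookup⇒[]=)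
open import Function using (_⇔_)
open import Relation.Binary.Construct.Closure.ReflexiveTransitive using (Star; ε; _◅_; _◅◅_) renaming (map to mapStar)
open import Relation.Binary.PropositionalEquality using (_≡_; _≢_; refl; sym; trans; cong; subst)
open import Relation.Nullary using (Dec; yes; no; does; ¬_; ¬?; _×-dec_; _⊎-dec_; _→-dec_)
open import Relation.Nullary.Decidable using (map′; decidable-stable; dec-true; dec-false)

open Algebra.Properties.CommutativeMonoid.Sum +-0-commutativeMonoid public using (sum)

private
  variable
    n n₁ n₂ m m₁ m₂ m′ : ℕ

------------------------------------------------------------------------
-- Graphs

-- A finite loopless multigraph, given by its multiplicities.  The vertex set
-- is a subset of an ambient Fin n, so that a subgraph is again a Graph n.
record Graph (n : ℕ) : Set where
  field
    V      : Subset n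
    μ      : Fin n → Fin n → ℕ
    μ-sym  : ∀ u v → μ u v ≡ μ v u
    μ-loop : ∀ v → μ v v ≡ 0
    μ-supp : ∀ u v → 0 < μ u v → u ∈ V

open Graph public

deg : Graph n → Fin n → ℕ
deg G v = sum (μ G v)

infix 4 _≈_ _⊑_ _≅_

_≈_ : Graph n → Graph n → Set
K ≈ G = V K ≡ V G × (∀ u v → μ K u v ≡ μ G u v)

-- K is a subgraph of G (parallel edges are not distinguished).
_⊑_ : Graph n → Graph n → Set
K ⊑ G = V K ⊆ V G × (∀ u v → μ K u v ≤ μ G u v)

mask : Subset n → (Fin n → Fin n → ℕ) → Fin n → Fin n → ℕ
mask S μ₀ u v = if lookupᵛ S u ∧ lookupᵛ S v then μ₀ u v else 0

infix 8 _[_] _∖_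

-- The subgraph induced by V G ∩ S.
_[_] : Graph n → Subset n → Graph n
_[_] {n} G S = record
  { V      = V G ∩ S
  ; μ      = mask S (μ G)
  ; μ-sym  = symm
  ; μ-loop = loop
  ; μ-supp = supp
  }
  where
  symm : ∀ u v → mask S (μ G) u v ≡ mask S (μ G) v u
  symm u v rewrite ∧-comm (lookupᵛ S u) (lookupᵛ S v) | μ-sym G u v = refl

  loop : ∀ v → mask S (μ G) v v ≡ 0
  loop v with lookupᵛ S v
  ... | true  = μ-loop G v
  ... | false = refl

  supp : ∀ u v → 0 < mask S (μ G) u v → u ∈ V G ∩ S
  supp u v p with lookupᵛ S u in eq | lookupᵛ S v
  ... | true  | true  = x∈p∩q⁺ (μ-supp G u v p , lookup⇒[]= u S eq)
  supp u v () | true  | false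
  supp u v () | false | _

_∖_ : Graph n → Fin n → Graph n
G ∖ v = G [ V G - v ]

Adjacent : Graph n → Fin n → Fin n → Set
Adjacent G u v = 0 < μ G u v

Walk : Graph n → Fin n → Fin n → Set
Walk G = Star (Adjacent G)

Connected : Graph n → Set
Connected G = Nonempty (V G) × (∀ u v → u ∈ V G → v ∈ V G → Walk G u v)

-- G ∖ v has two vertices in different components.
Separating : Graph n → Fin n → Set
Separating G v =
  v ∈ V G × (∃[ u ] ∃[ w ] (u ∈ V (G ∖ v) × w ∈ V (G ∖ v) × ¬ Walk (G ∖ v) u w))

Nonseparable : Graph n → Set
Nonseparable G = Connected G × (∀ v → ¬ Separating G v)

record _IsBlockOf_ (B G : Graph n) : Set where
  field
    sub     : B ⊑ G
    nonsep  : Nonseparable B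
    maximal : ∀ B′ → B′ ⊑ G → Nonseparable B′ → B ⊑ B′ → B′ ⊑ B

IsBlock : Graph n → Set
IsBlock G = G IsBlockOf G × (∀ B → B IsBlockOf G → B ≈ G)

------------------------------------------------------------------------
-- The finite set of blocks

record BlockEnumeration (G : Graph n) : Set where
  field
    size     : ℕ
    block    : Fin size → Graph n
    isBlock  : ∀ i → block i IsBlockOf G
    complete : ∀ B → B IsBlockOf G → ∃[ i ] B ≈ block i
    distinct : ∀ i j → block i ≈ block j → i ≡ j

-- Decidability of Walk: Reach k u v says that there is a walk from u to v all
-- of whose inner vertices are among the first k.
module Reachability (G : Graph n) where

  Reach : ℕ → Fin n → Fin n → Set
  Reach zero    u v = u ≡ v ⊎ Adjacent G u v
  Reach (suc k) u v =
    Reach k u v ⊎ (∃[ w ] (toℕ w ≡ k × Reach k u w × Reach k w v))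

  reach? : ∀ k u v → Dec (Reach k u v)
  reach? zero    u v = (u ≟ᶠ v) ⊎-dec (0 <? μ G u v)
  reach? (suc k) u v =
    reach? k u v ⊎-dec any? λ w → (toℕ w ≟ k) ×-dec (reach? k u w ×-dec reach? k w v)

  sound : ∀ k {u v} → Reach k u v → Walk G u v
  sound zero    (inj₁ refl)              = ε
  sound zero    (inj₂ a)                 = a ◅ ε
  sound (suc k) (inj₁ r)                 = sound k r
  sound (suc k) (inj₂ (w , _ , r₁ , r₂)) = sound k r₁ ◅◅ sound k r₂

  lift : ∀ k {u v} → Reach 0 u v → Reach k u v
  lift zero    r = r
  lift (suc k) r = inj₁ (lift k r)

  into : ∀ k {u w} → toℕ w ≡ k → Reach (suc k) u w → Reach k u w
  into k e (inj₁ r) = r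
  into k e (inj₂ (w′ , e′ , r , _))
    rewrite toℕ-injective (trans e′ (sym e)) = r

  outOf : ∀ k {w v} → toℕ w ≡ k → Reach (suc k) w v → Reach k w v
  outOf k e (inj₁ r) = r
  outOf k e (inj₂ (w′ , e′ , _ , r))
    rewrite toℕ-injective (trans e′ (sym e)) = r

  join : ∀ k {u v} w → toℕ w < k → Reach k u w → Reach k w v → Reach k u v
  join (suc k) w w< r s with m<1+n⇒m<n∨m≡n w<
  ... | inj₂ e = inj₂ (w , e , into k e r , outOf k e s)
  ... | inj₁ l with r | s
  ...   | inj₁ r′ | inj₁ s′ = inj₁ (join k w l r′ s′)
  ...   | inj₁ r′ | inj₂ (z , e , s₁ , s₂) = inj₂ (z , e , join k w l r′ s₁ , s₂)
  ...   | inj₂ (z , e , r₁ , r₂) | inj₁ s′ = inj₂ (z , e , r₁ , join k w l r₂ s′)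
  ...   | inj₂ (z , e , r₁ , r₂) | inj₂ (z′ , e′ , s₁ , s₂) =
    inj₂ (z , e , r₁ , subst (λ y → Reach k y _) (toℕ-injective (trans e′ (sym e))) s₂)

  total : ∀ {u v} → Walk G u v → Reach n u v
  total ε                     = lift n (inj₁ refl)
  total {u} (_◅_ {j = w} a p) = join n w (toℕ<n w) (lift n (inj₂ a)) (total p)

  walk? : ∀ u v → Dec (Walk G u v)
  walk? u v = map′ (sound n) total (reach? n u v)

open Reachability public using (walk?)

connected? : (G : Graph n) → Dec (Connected G)
connected? G =
  nonempty? (V G) ×-dec
  all? λ u → all? λ v → (u ∈? V G) →-dec ((v ∈? V G) →-dec walk? G u v)

separating? : (G : Graph n) → ∀ v → Dec (Separating G v)
separating? G v =
  (v ∈? V G) ×-dec any? λ u → any? λ w →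
    (u ∈? V (G ∖ v)) ×-dec ((w ∈? V (G ∖ v)) ×-dec ¬? (walk? (G ∖ v) u w))

nonseparable? : (G : Graph n) → Dec (Nonseparable G)
nonseparable? G = connected? G ×-dec all? λ v → ¬? (separating? G v)

mask-mono : ∀ (S : Subset n) {μ₁ μ₂ : Fin n → Fin n → ℕ} →
            (∀ u v → μ₁ u v ≤ μ₂ u v) → ∀ u v → mask S μ₁ u v ≤ mask S μ₂ u v
mask-mono S le u v with lookupᵛ S u ∧ lookupᵛ S v
... | true  = le u v
... | false = z≤n

mask-≤ : ∀ (S : Subset n) μ₀ u v → mask S μ₀ u v ≤ μ₀ u v
mask-≤ S μ₀ u v with lookupᵛ S u ∧ lookupᵛ S v
... | true  = ≤-refl
... | false = z≤n

mask-inside : ∀ (S : Subset n) μ₀ {u v} → u ∈ S → v ∈ S → mask S μ₀ u v ≡ μ₀ u v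
mask-inside S μ₀ u∈ v∈ rewrite []=⇒lookup u∈ | []=⇒lookup v∈ = refl

⊑⇒⊑induced : {K G : Graph n} → K ⊑ G → K ⊑ G [ V K ]
⊑⇒⊑induced {K = K} {G} (V⊆ , μ≤) = (λ x∈ → x∈p∩q⁺ (V⊆ x∈ , x∈)) , le
  where
  le : ∀ u v → μ K u v ≤ mask (V K) (μ G) u v
  le u v with μ K u v in eq
  ... | zero  = z≤n
  ... | suc k = ≤-trans (≤-reflexive (sym eq)) (≤-trans (μ≤ u v) (≤-reflexive (sym
                  (mask-inside (V K) (μ G)
                    (μ-supp K u v (subst (0 <_) (sym eq) (s≤s z≤n)))
                    (μ-supp K v u (subst (0 <_) (trans (sym eq) (μ-sym K u v)) (s≤s z≤n)))))))

induced⊑ : (G : Graph n) (S : Subset n) → G [ S ] ⊑ G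
induced⊑ G S = p∩q⊆p (V G) S , mask-≤ S (μ G)

-- Adding edges to a nonseparable graph keeps it nonseparable.
nonseparable-mono : {K L : Graph n} → K ⊑ L → V L ≡ V K → Nonseparable K → Nonseparable L
nonseparable-mono {K = K} {record { V = .(V K) ; μ = ν ; μ-sym = s ; μ-loop = l ; μ-supp = p }}
                  (_ , μ≤) refl ((ne , conn) , nosep) =
  (ne , λ u v u∈ v∈ → mapStar (λ {x} {y} a → <-≤-trans a (μ≤ x y)) (conn u v u∈ v∈)) ,
  λ v (v∈ , u , w , u∈ , w∈ , ¬walk) → nosep v (v∈ , u , w , u∈ , w∈ , λ walk →
    ¬walk (mapStar (λ {x} {y} a → <-≤-trans a (mask-mono (V K - v) μ≤ x y)) walk))

module Enumerate (G : Graph n) where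

  Candidate : Subset n → Set
  Candidate S = S ⊆ V G × Nonseparable (G [ S ]) ×
    ¬ (∃[ T ] ((T ⊆ V G × S ⊆ T) × (Nonseparable (G [ T ]) × ¬ (T ⊆ S))))

  candidate? : ∀ S → Dec (Candidate S)
  candidate? S = (S ⊆? V G) ×-dec (nonseparable? (G [ S ]) ×-dec ¬? (anySubset? λ T →
    ((T ⊆? V G) ×-dec (S ⊆? T)) ×-dec (nonseparable? (G [ T ]) ×-dec ¬? (T ⊆? S))))

  V-induced : ∀ {S} → S ⊆ V G → V (G [ S ]) ≡ S
  V-induced {S} S⊆ = ⊆-antisym (p∩q⊆q (V G) S) (λ x∈ → x∈p∩q⁺ (S⊆ x∈ , x∈))

  full : (K : Graph n) → K ⊑ G → Nonseparable K → Nonseparable (G [ V K ])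
  full K K⊑G = nonseparable-mono {K = K} {G [ V K ]} (⊑⇒⊑induced {K = K} {G} K⊑G) (V-induced (proj₁ K⊑G))

  candidate⇒block : ∀ {S} → Candidate S → (G [ S ]) IsBlockOf G
  candidate⇒block {S} (S⊆ , ns , max) = record
    { sub = induced⊑ G S ; nonsep = ns ; maximal = maxi }
    where
    maxi : ∀ B → B ⊑ G → Nonseparable B → G [ S ] ⊑ B → B ⊑ G [ S ]
    maxi B B⊑G nsB (V⊆ , μ≤) =
      (λ x∈ → x∈p∩q⁺ (proj₁ B⊑G x∈ , VB⊆S x∈)) ,
      λ u v → ≤-trans (proj₂ (⊑⇒⊑induced {K = B} {G} B⊑G) u v)
                      (≤-reflexive (cong (λ T → mask T (μ G) u v) VB≡S))
      where
      S⊆VB : S ⊆ V B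
      S⊆VB x∈ = V⊆ (x∈p∩q⁺ (S⊆ x∈ , x∈))
      VB⊆S : V B ⊆ S
      VB⊆S = decidable-stable (V B ⊆? S) λ ⊈ →
        max (V B , (proj₁ B⊑G , S⊆VB) , full B B⊑G nsB , ⊈)
      VB≡S : V B ≡ S
      VB≡S = ⊆-antisym VB⊆S S⊆VB

  block⇒candidate : ∀ B → B IsBlockOf G → Candidate (V B)
  block⇒candidate B isB = proj₁ sub , full B sub nonsep , λ (T , (T⊆ , B⊆T) , ns , ⊈) →
    ⊈ λ x∈ →
      proj₁ (maximal (G [ T ]) (induced⊑ G T) ns (below T T⊆ B⊆T))
            (x∈p∩q⁺ (T⊆ x∈ , x∈))
    where
    open _IsBlockOf_ isB
    below : ∀ T → T ⊆ V G → V B ⊆ T → B ⊑ G [ T ]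
    below T T⊆ B⊆T = (λ x∈ → x∈p∩q⁺ (proj₁ sub x∈ , B⊆T x∈)) , le
      where
      le : ∀ u v → μ B u v ≤ mask T (μ G) u v
      le u v with μ B u v in eq
      ... | zero  = z≤n
      ... | suc k = ≤-trans (≤-reflexive (sym eq)) (≤-trans (proj₂ sub u v) (≤-reflexive (sym
                      (mask-inside T (μ G)
                        (B⊆T (μ-supp B u v (subst (0 <_) (sym eq) (s≤s z≤n))))
                        (B⊆T (μ-supp B v u (subst (0 <_) (trans (sym eq) (μ-sym B u v)) (s≤s z≤n))))))))

  block≈ : ∀ B → B IsBlockOf G → B ≈ G [ V B ]
  block≈ B isB = sym (V-induced (proj₁ sub)) , λ u v →
    ≤-antisym (proj₂ B⊑ u v) (proj₂ (maximal (G [ V B ]) (induced⊑ G (V B)) (full B sub nonsep) B⊑) u v)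
    where
    open _IsBlockOf_ isB
    B⊑ : B ⊑ G [ V B ]
    B⊑ = ⊑⇒⊑induced {K = B} {G} sub

subsets : ∀ n → List (Subset n)
subsets zero    = [] ∷ []
subsets (suc n) = map (inside ∷_) (subsets n) ++ map (outside ∷_) (subsets n)

∈-subsets : (S : Subset n) → S ∈ˡ subsets n
∈-subsets []                    = here refl
∈-subsets (true ∷ S)            = ∈-++⁺ˡ (∈-map⁺ (inside ∷_) (∈-subsets S))
∈-subsets {suc n} (false ∷ S)   = ∈-++⁺ʳ (map (inside ∷_) (subsets n)) (∈-map⁺ (outside ∷_) (∈-subsets S))

subsets-unique : ∀ n → Unique (subsets n)
subsets-unique zero    = Data.List.Relation.Unary.All.[] AllPairs.∷ AllPairs.[]
subsets-unique (suc n) =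
  Uniqueₚ.++⁺ (Uniqueₚ.map⁺ ∷-injectiveʳ (subsets-unique n))
              (Uniqueₚ.map⁺ ∷-injectiveʳ (subsets-unique n)) disjoint
  where
  disjoint : ∀ {S} → ¬ (S ∈ˡ map (inside ∷_) (subsets n) × S ∈ˡ map (outside ∷_) (subsets n))
  disjoint (p , q) with ∈-map⁻ (inside ∷_) p | ∈-map⁻ (outside ∷_) q
  ... | _ , _ , refl | _ , _ , ()

lookup-injective : ∀ {A : Set} {xs : List A} → Unique xs →
                   ∀ i j → lookup xs i ≡ lookup xs j → i ≡ j
lookup-injective (_ AllPairs.∷ _)  zero    zero    _ = refl
lookup-injective (p AllPairs.∷ _)  zero    (suc j) e = ⊥-elim (lookupᴬ p (∈-lookup j) e)
lookup-injective (p AllPairs.∷ _)  (suc i) zero    e = ⊥-elim (lookupᴬ p (∈-lookup i) (sym e))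
lookup-injective (_ AllPairs.∷ us) (suc i) (suc j) e = cong suc (lookup-injective us i j e)

abstract
  blocks : (G : Graph n) → BlockEnumeration G
  blocks {n} G = record
    { size     = length cs
    ; block    = λ i → G [ lookup cs i ]
    ; isBlock  = λ i → candidate⇒block (cand i)
    ; complete = λ B isB →
        let B∈ = ∈-filter⁺ candidate? (∈-subsets (V B)) (block⇒candidate B isB)
            V≡ = lookup-index B∈
            B≈ = block≈ B isB
        in index B∈ ,
           trans (proj₁ B≈) (cong (V G ∩_) V≡) ,
           λ u v → trans (proj₂ B≈ u v) (cong (λ T → mask T (μ G) u v) V≡)
    ; distinct = λ i j e → lookup-injective (Uniqueₚ.filter⁺ candidate? (subsets-unique n)) i j
        (trans (sym (V-induced (proj₁ (cand i)))) (trans (proj₁ e) (V-induced (proj₁ (cand j)))))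
    }
    where
    open Enumerate G
    cs : List (Subset n)
    cs = filter candidate? (subsets n)
    cand : ∀ i → Candidate (lookup cs i)
    cand i = proj₂ (∈-filter⁻ candidate? {xs = subsets n} (∈-lookup i))

------------------------------------------------------------------------
-- Multiples, complete graphs and cycles

record _≅_ (G : Graph n) (G′ : Graph m) : Set where
  field
    to         : Fin n → Fin m
    to-V       : ∀ {v} → v ∈ V G → to v ∈ V G′
    injective  : ∀ {u v} → u ∈ V G → v ∈ V G → to u ≡ to v → u ≡ v
    surjective : ∀ {w} → w ∈ V G′ → ∃[ v ] (v ∈ V G × to v ≡ w)
    to-μ       : ∀ {u v} → u ∈ V G → v ∈ V G → μ G′ (to u) (to v) ≡ μ G u v

infixr 9 _·_

_·_ : ℕ → Graph n → Graph n
t · G = record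
  { V      = V G
  ; μ      = λ u v → t * μ G u v
  ; μ-sym  = λ u v → cong (t *_) (μ-sym G u v)
  ; μ-loop = λ v → trans (cong (t *_) (μ-loop G v)) (*-zeroʳ t)
  ; μ-supp = supp
  }
  where
  supp : ∀ u v → 0 < t * μ G u v → u ∈ V G
  supp u v p with μ G u v in eq
  ... | zero  with () ← subst (0 <_) (*-zeroʳ t) p
  ... | suc _ = μ-supp G u v (subst (0 <_) (sym eq) (s≤s z≤n))

completeGraph : ∀ n → Graph n
completeGraph n = record
  { V      = ⊤
  ; μ      = λ i j → if does (i ≟ᶠ j) then 0 else 1
  ; μ-sym  = symm
  ; μ-loop = λ i → cong (if_then 0 else 1) (dec-true (i ≟ᶠ i) refl)
  ; μ-supp = λ _ _ _ → ∈⊤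
  }
  where
  symm : (i j : Fin n) → (if does (i ≟ᶠ j) then 0 else 1) ≡ (if does (j ≟ᶠ i) then 0 else 1)
  symm i j with i ≟ᶠ j | j ≟ᶠ i
  ... | yes _ | yes _ = refl
  ... | no _  | no _  = refl
  ... | yes p | no q  = ⊥-elim (q (sym p))
  ... | no p  | yes q = ⊥-elim (p (sym q))

-- j ≡ i + 1 (mod n)
Next : Fin n → Fin n → Set
Next {n} i j = toℕ j ≡ suc (toℕ i) ⊎ (suc (toℕ i) ≡ n × toℕ j ≡ 0)

next? : (i j : Fin n) → Dec (Next i j)
next? {n} i j = (toℕ j ≟ suc (toℕ i)) ⊎-dec ((suc (toℕ i) ≟ n) ×-dec (toℕ j ≟ 0))

-- i - j ≡ ±1 (mod n)
consecutive? : (i j : Fin n) → Dec (Next i j ⊎ Next j i)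
consecutive? i j = next? i j ⊎-dec next? j i

cycleμ : Fin n → Fin n → ℕ
cycleμ i j = if does (consecutive? i j) then 1 else 0

cycle : ∀ n → 3 ≤ n → Graph n
cycle n 3≤n = record
  { V      = ⊤
  ; μ      = cycleμ
  ; μ-sym  = λ i j → cong (if_then 1 else 0) (∨-comm (does (next? i j)) (does (next? j i)))
  ; μ-loop = λ i → cong (if_then 1 else 0) (dec-false (consecutive? i i) (irrefl i))
  ; μ-supp = λ _ _ _ → ∈⊤
  }
  where
  suc≢ : ∀ {k} → ¬ (k ≡ suc k)
  suc≢ ()
  notNext : (i : Fin n) → ¬ Next i i
  notNext i (inj₁ e)        = suc≢ e
  notNext i (inj₂ (e , e₀)) with subst (3 ≤_) (trans (sym e) (cong suc e₀)) 3≤n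
  ... | s≤s ()
  irrefl : (i : Fin n) → ¬ (Next i i ⊎ Next i i)
  irrefl i (inj₁ p) = notNext i p
  irrefl i (inj₂ p) = notNext i p

------------------------------------------------------------------------
-- Covers

-- The edges of H between A and B form a union of k matchings.  In terms of
-- multiplicities: M j x y says that the j-th matching contains an edge joining
-- x and y, and every edge is counted in exactly one matching.
UnionOfMatchings : ℕ → Graph m → Subset m → Subset m → Set
UnionOfMatchings {m} k H A B =
  Σ (Fin k → Fin m → Fin m → Bool) λ M →
    (∀ j → IsMatching (M j)) ×
    (∀ {x y} → x ∈ A → y ∈ B → μ H x y ≡ sum (λ j → if M j x y then 1 else 0))
  where
  IsMatching : (Fin m → Fin m → Bool) → Set
  IsMatching M =
    (∀ {x y y′} → x ∈ A → y ∈ B → y′ ∈ B → M x y ≡ true → M x y′ ≡ true → y ≡ y′) ×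
    (∀ {x x′ y} → x ∈ A → x′ ∈ A → y ∈ B → M x y ≡ true → M x′ y ≡ true → x ≡ x′)

-- X is a total function on the ambient Fin n; only its values on V G matter.
record IsCover (G : Graph n) (X : Fin n → Subset m) (H : Graph m) : Set where
  field
    disjoint    : ∀ {u v} → u ∈ V G → v ∈ V G → u ≢ v → ∀ {x} → x ∈ X u → x ∉ X v
    union       : ∀ x → x ∈ V H ⇔ (∃[ v ] (v ∈ V G × x ∈ X v))
    independent : ∀ {v} → v ∈ V G → ∀ {x y} → x ∈ X v → y ∈ X v → μ H x y ≡ 0
    matchings   : ∀ {u v} → u ∈ V G → v ∈ V G → u ≢ v →
                  UnionOfMatchings (μ G u v) H (X u) (X v)

-- A G-cover.
record IsGraphCover (G : Graph n) (X : Fin n → Subset m) (H : Graph m) : Set where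
  field
    cover : IsCover G X H
    x     : Fin n → Fin m
    X≡    : ∀ {v} → v ∈ V G → X v ≡ ⁅ x v ⁆
    μ≡    : ∀ {u v} → u ∈ V G → v ∈ V G → u ≢ v → μ H (x u) (x v) ≡ μ G u v

-- The vertices of the cycle are v i for i : Fin k; the cover vertices x_i and
-- x_{k+i} are x (i ↑ˡ k) and x (k ↑ʳ i).
record IsDoubleCover (t k : ℕ) (3≤k : 3 ≤ k) (G : Graph n) (tC≅G : t · cycle k 3≤k ≅ G)
                     (X : Fin n → Subset m) (H : Graph m) : Set where
  open _≅_ tC≅G using () renaming (to to v)
  field
    cover     : IsCover G X H
    x         : Fin (k + k) → Fin m
    injective : ∀ {i j} → x i ≡ x j → i ≡ j
    X≡        : ∀ i → X (v i) ≡ ⁅ x (i ↑ˡ k) ⁆ ∪ ⁅ x (k ↑ʳ i) ⁆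
    μ≡        : ∀ i j → μ H (x i) (x j) ≡ t * cycleμ i j

-- (X̃ , H̃) is the s-inflation of the cover (X , H) of G, up to renaming.
record IsInflation (s : ℕ) (G : Graph n) (X : Fin n → Subset m) (H : Graph m)
                   (X̃ : Fin n → Subset m′) (H̃ : Graph m′) : Set where
  field
    s≥1      : 1 ≤ s
    s∣μ      : ∀ x y → s ∣ μ H x y
    U        : Fin m → Subset m′
    ∣U∣≡s    : ∀ {x} → x ∈ V H → ∣ U x ∣ ≡ s
    disjoint : ∀ {x y} → x ∈ V H → y ∈ V H → x ≢ y → ∀ {z} → z ∈ U x → z ∉ U y
    union    : ∀ z → z ∈ V H̃ ⇔ (∃[ x ] (x ∈ V H × z ∈ U x))
    X̃≡       : ∀ {v} → v ∈ V G → ∀ z → z ∈ X̃ v ⇔ (∃[ x ] (x ∈ X v × z ∈ U x))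
    between  : ∀ {x y} → x ∈ V H → y ∈ V H → x ≢ y → ∀ {z w} → z ∈ U x → w ∈ U y →
               μ H̃ z w ≡ quotient (s∣μ x y)
    within   : ∀ {x} → x ∈ V H → ∀ {z w} → z ∈ U x → w ∈ U x → μ H̃ z w ≡ 0

------------------------------------------------------------------------
-- Configurations

-- f is a total function on the ambient Fin m; only its values on V H matter.
record Tuple (n m : ℕ) : Set where
  field
    G : Graph n
    X : Fin n → Subset m
    H : Graph m
    f : Fin m → ℕ

  -- {v : X_v(U) ≠ ∅}
  trace : Subset m → Subset n
  trace U = tabulate λ v → does (nonempty? (X v ∩ U))

  -- (X , H)/U is an inflation of a cover of G with property P; in particular
  -- the graph G [ trace U ] that it covers is G itself.
  QuotientInflates : (∀ {m′} → (Fin n → Subset m′) → Graph m′ → Set) → Subset m → Set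
  QuotientInflates P U =
    U ⊆ V H ×
    G [ trace U ] ≈ G ×
    ∃[ m′ ] Σ (Fin n → Subset m′) λ Y → Σ (Graph m′) λ K →
      P Y K × ∃[ s ] IsInflation s G Y K (λ v → X v ∩ U) (H [ U ])

  IsUniformConfiguration : Set
  IsUniformConfiguration =
    IsCover G X H × ∃[ r ] (1 ≤ r × (∀ {v} → v ∈ V G → ∣ X v ∣ ≡ r))

-- Below, f(x) = a / |X_v(U)| is written f x * ∣ X v ∩ U ∣ ≡ a; the cardinality
-- is positive since x ∈ X v ∩ U.

record IsMConfiguration (T : Tuple n m) : Set where
  open Tuple T
  field
    uniform : IsUniformConfiguration
    isBlock : IsBlock G
    U       : Subset m
    inflate : QuotientInflates (IsGraphCover G) U
    f-in    : ∀ {v x} → v ∈ V G → x ∈ X v → x ∈ U → f x * ∣ X v ∩ U ∣ ≡ deg G v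
    f-out   : ∀ {v x} → v ∈ V G → x ∈ X v → x ∉ U → f x ≡ 0

record IsKConfiguration (T : Tuple n m) : Set where
  open Tuple T
  field
    uniform  : IsUniformConfiguration
    t k      : ℕ
    t≥1      : 1 ≤ t
    k≥1      : 1 ≤ k
    tK≅G     : t · completeGraph k ≅ G
    p        : ℕ
    p≥1      : 1 ≤ p
    kᵢ       : Fin p → ℕ
    kᵢ≥1     : ∀ i → 1 ≤ kᵢ i
    sum≡     : sum kᵢ + 1 ≡ k
    U        : Fin p → Subset m
    disjoint : ∀ {i j} → i ≢ j → ∀ {x} → x ∈ U i → x ∉ U j
    inflate  : ∀ i → QuotientInflates (IsGraphCover G) (U i)
    f-in     : ∀ {v x} → v ∈ V G → x ∈ X v → ∀ i → x ∈ U i → f x * ∣ X v ∩ U i ∣ ≡ t * kᵢ i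
    f-out    : ∀ {v x} → v ∈ V G → x ∈ X v → (∀ i → x ∉ U i) → f x ≡ 0

record IsOddCConfiguration (T : Tuple n m) : Set where
  open Tuple T
  field
    uniform  : IsUniformConfiguration
    t k      : ℕ
    t≥1      : 1 ≤ t
    k≥3      : 3 ≤ k
    odd      : 2 ∤ k
    tC≅G     : t · cycle k k≥3 ≅ G
    U        : Fin 2 → Subset m
    disjoint : ∀ {i j} → i ≢ j → ∀ {x} → x ∈ U i → x ∉ U j
    inflate  : ∀ i → QuotientInflates (IsGraphCover G) (U i)
    f-in     : ∀ {v x} → v ∈ V G → x ∈ X v → ∀ i → x ∈ U i → f x * ∣ X v ∩ U i ∣ ≡ t
    f-out    : ∀ {v x} → v ∈ V G → x ∈ X v → (∀ i → x ∉ U i) → f x ≡ 0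

record IsEvenCConfiguration (T : Tuple n m) : Set where
  open Tuple T
  field
    uniform : IsUniformConfiguration
    t k     : ℕ
    t≥1     : 1 ≤ t
    k≥4     : 4 ≤ k
    even    : 2 ∣ k

  k≥3 : 3 ≤ k
  k≥3 = ≤-trans (n≤1+n 3) k≥4

  field
    tC≅G    : t · cycle k k≥3 ≅ G
    U       : Subset m
    inflate : QuotientInflates (IsDoubleCover t k k≥3 G tC≅G) U
    f-in    : ∀ {v x} → v ∈ V G → x ∈ X v → x ∈ U → f x * ∣ X v ∩ U ∣ ≡ 2 * t
    f-out   : ∀ {v x} → v ∈ V G → x ∈ X v → x ∉ U → f x ≡ 0

IsCConfiguration : Tuple n m → Set
IsCConfiguration T = IsOddCConfiguration T ⊎ IsEvenCConfiguration T

-- G is obtained, up to renaming, from disjoint copies of G₁ and G₂ by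
-- identifying a₁ with a₂ whenever a₁ ~ a₂.  This is only used when the
-- identified vertices form independent sets of G₁ and G₂, so multiplicities
-- never add up.
record IsAmalgam (G₁ : Graph n₁) (G₂ : Graph n₂) (_~_ : Fin n₁ → Fin n₂ → Set)
                 (G : Graph n) : Set where
  field
    ι₁       : Fin n₁ → Fin n
    ι₂       : Fin n₂ → Fin n
    ι₁-inj   : ∀ {a b} → a ∈ V G₁ → b ∈ V G₁ → ι₁ a ≡ ι₁ b → a ≡ b
    ι₂-inj   : ∀ {a b} → a ∈ V G₂ → b ∈ V G₂ → ι₂ a ≡ ι₂ b → a ≡ b
    vertices : ∀ c → c ∈ V G ⇔
               ((∃[ a ] (a ∈ V G₁ × ι₁ a ≡ c)) ⊎ (∃[ b ] (b ∈ V G₂ × ι₂ b ≡ c)))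
    identify : ∀ {a b} → a ∈ V G₁ → b ∈ V G₂ → ι₁ a ≡ ι₂ b ⇔ a ~ b
    μ₁       : ∀ {a b} → a ∈ V G₁ → b ∈ V G₁ → μ G (ι₁ a) (ι₁ b) ≡ μ G₁ a b
    μ₂       : ∀ {a b} → a ∈ V G₂ → b ∈ V G₂ → μ G (ι₂ a) (ι₂ b) ≡ μ G₂ a b
    μ₁₂      : ∀ {a b} → a ∈ V G₁ → b ∈ V G₂ → (∀ b′ → b′ ∈ V G₂ → ¬ a ~ b′) →
               (∀ a′ → a′ ∈ V G₁ → ¬ a′ ~ b) → μ G (ι₁ a) (ι₂ b) ≡ 0

record IsGluing (T₁ : Tuple n₁ m₁) (T₂ : Tuple n₂ m₂) (T : Tuple n m) : Set where
  open Tuple T₁ using () renaming (G to G₁; X to X₁; H to H₁; f to f₁)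
  open Tuple T₂ using () renaming (G to G₂; X to X₂; H to H₂; f to f₂)
  open Tuple T
  field
    v₁     : Fin n₁
    v₂     : Fin n₂
    v₁∈    : v₁ ∈ V G₁
    v₂∈    : v₂ ∈ V G₂
    glueG  : IsAmalgam G₁ G₂ (λ a b → a ≡ v₁ × b ≡ v₂) G
    π      : Fin m₁ → Fin m₂
    π-into : ∀ {x} → x ∈ X₁ v₁ → π x ∈ X₂ v₂
    π-inj  : ∀ {x y} → x ∈ X₁ v₁ → y ∈ X₁ v₁ → π x ≡ π y → x ≡ y
    π-surj : ∀ {y} → y ∈ X₂ v₂ → ∃[ x ] (x ∈ X₁ v₁ × π x ≡ y)
    glueH  : IsAmalgam H₁ H₂ (λ x y → x ∈ X₁ v₁ × y ≡ π x) H
  open IsAmalgam glueG using () renaming (ι₁ to φ₁; ι₂ to φ₂)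
  open IsAmalgam glueH using () renaming (ι₁ to ψ₁; ι₂ to ψ₂)
  field
    glueX₁ : ∀ {v} → v ∈ V G₁ → ∀ z → z ∈ X (φ₁ v) ⇔ (∃[ x ] (x ∈ X₁ v × ψ₁ x ≡ z))
    glueX₂ : ∀ {v} → v ∈ V G₂ → ∀ z → z ∈ X (φ₂ v) ⇔ (∃[ x ] (x ∈ X₂ v × ψ₂ x ≡ z))
    f₁-off : ∀ {y} → y ∈ V H₁ → y ∉ X₁ v₁ → f (ψ₁ y) ≡ f₁ y
    f₂-off : ∀ {y} → y ∈ V H₂ → y ∉ X₂ v₂ → f (ψ₂ y) ≡ f₂ y
    f-at   : ∀ {x} → x ∈ X₁ v₁ → f (ψ₁ x) ≡ f₁ x + f₂ (π x)

data Constructible : ∀ {n m} → Tuple n m → Set where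
  mConf    : {T : Tuple n m} → IsMConfiguration T → Constructible T
  kConf    : {T : Tuple n m} → IsKConfiguration T → Constructible T
  oddConf  : {T : Tuple n m} → IsOddCConfiguration T → Constructible T
  evenConf : {T : Tuple n m} → IsEvenCConfiguration T → Constructible T
  glue     : {T₁ : Tuple n₁ m₁} {T₂ : Tuple n₂ m₂} {T : Tuple n m} →
             Constructible T₁ → Constructible T₂ →
             Tuple.IsUniformConfiguration T → IsGluing T₁ T₂ T → Constructible T

-- ⋃ { X_v : v ∈ S }
⋃[_]_ : Subset n → (Fin n → Subset m) → Subset m
⋃[ S ] X = tabulate λ x → does (any? λ v → (v ∈? S) ×-dec (x ∈? X v))

coverGraph : Tuple n m → Graph n → Graph m
coverGraph T B = H [ ⋃[ V B ] X ]
  where open Tuple T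

-- (B , X^B , H^B , g), where H^B is coverGraph T B.  The restriction X^B needs
-- no change to X, as a tuple only uses X on the vertices of its graph.
restrict : Tuple n m → Graph n → (Fin m → ℕ) → Tuple n m
restrict T B g = record { G = B ; X = Tuple.X T ; H = coverGraph T B ; f = g }

{-# OPTIONS --safe #-}
module Submission where

-- Existence.  Unfolding the construction displays G as a tree of nonseparable pieces,
-- consecutive ones sharing one vertex, and f as the sum of the functions of the pieces.
-- A single-vertex piece carries f = 0 and is dropped as soon as it is glued to anything;
-- the remaining pieces are exactly the blocks of G, since a nonseparable subgraph cannot
-- lie on both sides of a cut vertex.
--
-- Uniqueness.  In an M-, K- or C-configuration a vertex y ∈ X u of the support sends all
-- the μ(u,v) edges that the matchings allow into the support over v.  So along an edge uv
-- the values over u determine those over v: f(x) d(u) = f(y) d(v) if x ∈ X v has a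
-- neighbour y ∈ X u in the support, and f(x) = 0 otherwise.  Hence a block function is
-- determined by its values away from any one vertex, and two families with equal sums
-- away from a root agree, by induction on the tree.

import Algebra.Properties.CommutativeMonoid.Sum
open import Data.Bool using (Bool; true; false; if_then_else_; _∧_)
open import Data.Empty using (⊥-elim) renaming (⊥ to Empty)
open import Data.Fin using (Fin; zero; suc; toℕ; fromℕ<; _↑ˡ_; _↑ʳ_; splitAt)
open import Data.Fin.Properties using (any?; toℕ<n; toℕ-injective; toℕ-fromℕ<; toℕ-↑ˡ; toℕ-↑ʳ; splitAt-↑ˡ; splitAt-↑ʳ; splitAt⁻¹-↑ˡ; splitAt⁻¹-↑ʳ) renaming (_≟_ to _≟ᶠ_; suc-injective to sucᶠ-injective)
open import Data.Fin.Subset using (Subset; Nonempty; _∈_; _∉_; _⊆_; _∩_; _∪_; _─_; _-_; ⊤; ⁅_⁆; ∣_∣)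
open import Data.Fin.Subset.Properties using (_∈?_; _⊆?_; nonempty?; ∈⊤; x∈⁅x⁆; x∈⁅y⁆⇒x≡y; x∈p∩q⁺; x∈p∩q⁻; x∈p∪q⁺; x∈p∪q⁻; p∩q⊆p; p∩q⊆q; p─q⊆p; x∈p∧x≢y⇒x∈p-y; ⊆-antisym; Empty-unique; ∣⊥∣≡0; ∣⁅x⁆∣≡1; p⊆q⇒∣p∣≤∣q∣)
open import Data.Nat using (ℕ; zero; suc; _+_; _*_; _∸_; _≤_; _<_; z≤n; s≤s; >-nonZero)
open import Data.Nat.Divisibility using (_∣_; quotient; module _∣_)
open import Data.Nat.Properties using (≤-refl; ≤-trans; ≤-reflexive; ≤-antisym; <-≤-trans; <-trans; <-irrefl; <-cmp; 1+n≰n; n≮0; n<1+n; n≤1+n; n≤0⇒n≡0; n≢0⇒n>0; 0≢1+n; suc-injective; m≤n⇒m<n∨m≡n; m≤m+n; m+[n∸m]≡n; m*n≡0⇒m≡0∨n≡0; +-mono-≤; +-monoˡ-≤; +-identityʳ; +-assoc; +-comm; +-suc; +-cancelˡ-≡; +-cancelʳ-≡; *-assoc; *-comm; *-zeroʳ; *-identityʳ; *-mono-≤; *-cancelˡ-≡; *-cancelʳ-≡; +-0-commutativeMonoid; _<?_; module ≤-Reasoning)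
open import Data.Product using (Σ-syntax; ∃-syntax; ∃!; _×_; _,_; proj₁; proj₂)
open import Data.Sum using (_⊎_; inj₁; inj₂; [_,_]′)
open import Data.Unit using (tt) renaming (⊤ to Unit)
open import Data.Vec using (tabulate; []; _∷_; here; there) renaming (lookup to lookupᵛ)
open import Data.Vec.Properties using (lookup∘tabulate; []=⇒lookup; lookup⇒[]=)
open import Function using (_∘_; id; mk⇔; Equivalence)
open import Relation.Binary.Construct.Closure.ReflexiveTransitive using (ε; _◅_; _◅◅_; gmap; reverse)
open import Relation.Binary.Definitions using (tri<; tri≈; tri>)
open import Relation.Binary.PropositionalEquality using (_≡_; _≢_; refl; sym; trans; cong; cong₂; subst; subst₂; module ≡-Reasoning)
open import Relation.Nullary using (Dec; yes; no; does; ¬_; ¬?; _×-dec_)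
open import Relation.Nullary.Decidable using (dec-true; dec-false; decidable-stable)
open import Defs

open Algebra.Properties.CommutativeMonoid.Sum +-0-commutativeMonoid using (sum-cong-≗; ∑-distrib-+; ∑-comm)

-- Three obstacles shape the proof. A block can satisfy several of the defining conditions at once:
-- for p = 1 a K-configuration on tK_n has f(x) = d(v)/|X_v(U)|, the formula of an M-configuration.
-- Two candidate functions on one block may thus come with different kinds and different sets `U`,
-- so uniqueness cannot compare witnesses. It rests on `Propagates`, a consequence that speaks only
-- of f, the multiplicities of H and the degrees. The degrees let one formula serve all kinds: an
-- M-configuration puts total weight d(v) over v, while K- and C-configurations put constant weights
-- on each `U i` over regular graphs. At a cut vertex only the sum of several block functions is
-- known. Hence a block function has to be recovered from its values elsewhere, which is why
-- uniqueness is stated relative to an excluded root. Gluing is defined up to renaming, so the parts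
-- live in other ambient sets. A `Decomposition` is therefore taken relative to an embedding into
-- one fixed tuple `T*`, where all pieces and functions are placed; only the leaves are carried over
-- by an isomorphism.

private
  variable
    n n₁ n₂ m m₁ m₂ m′ : ℕ

-- Finite sums

-- Unfolds to the conditional in the theorem's sum over the blocks containing v.
when : ∀ {P : Set} → Dec P → ℕ → ℕ
when p? a = if does p? then a else 0

when-yes : ∀ {P : Set} (p? : Dec P) {a} → P → when p? a ≡ a
when-yes p? p rewrite dec-true p? p = refl

when-no : ∀ {P : Set} (p? : Dec P) {a} → ¬ P → when p? a ≡ 0
when-no p? ¬p rewrite dec-false p? ¬p = refl

when-cong : ∀ {P Q : Set} (p? : Dec P) (q? : Dec Q) → (P → Q) → (Q → P) →
            ∀ {a b} → (P → a ≡ b) → when p? a ≡ when q? b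
when-cong (yes p) q? to from e = trans (e p) (sym (when-yes q? (to p)))
when-cong (no ¬p) q? to from e = sym (when-no q? (¬p ∘ from))

sum-zero : (h : Fin n → ℕ) → (∀ i → h i ≡ 0) → sum h ≡ 0
sum-zero {zero}  h z = refl
sum-zero {suc n} h z = cong₂ _+_ (z zero) (sum-zero (h ∘ suc) (z ∘ suc))

sum-single : (h : Fin n → ℕ) (i : Fin n) → (∀ j → j ≢ i → h j ≡ 0) → sum h ≡ h i
sum-single h zero    z =
  trans (cong (h zero +_) (sum-zero (h ∘ suc) (λ j → z (suc j) λ ()))) (+-identityʳ _)
sum-single h (suc i) z =
  cong₂ _+_ (z zero λ ()) (sum-single (h ∘ suc) i λ j j≢i → z (suc j) (j≢i ∘ sucᶠ-injective))

sum-≤ : (h₁ h₂ : Fin n → ℕ) → (∀ i → h₁ i ≤ h₂ i) → sum h₁ ≤ sum h₂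
sum-≤ {zero}  h₁ h₂ le = z≤n
sum-≤ {suc n} h₁ h₂ le = +-mono-≤ (le zero) (sum-≤ (h₁ ∘ suc) (h₂ ∘ suc) (le ∘ suc))

term≤sum : (h : Fin n → ℕ) (i : Fin n) → h i ≤ sum h
term≤sum h i = ≤-trans (≤-reflexive (trans (sym (when-yes (i ≟ᶠ i) refl)) (sym only))) (sum-≤ _ h below)
  where
  only : sum (λ j → when (j ≟ᶠ i) (h j)) ≡ when (i ≟ᶠ i) (h i)
  only = sum-single _ i λ j → when-no (j ≟ᶠ i)
  below : ∀ j → when (j ≟ᶠ i) (h j) ≤ h j
  below j with j ≟ᶠ i
  ... | yes _ = ≤-refl
  ... | no _  = z≤n

sum-one : ∀ n → sum {n} (λ _ → 1) ≡ n
sum-one zero    = refl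
sum-one (suc n) = cong suc (sum-one n)

sum-split : ∀ a b (h : Fin (a + b) → ℕ) →
            sum h ≡ sum (λ i → h (i ↑ˡ b)) + sum (λ j → h (a ↑ʳ j))
sum-split zero    b h = refl
sum-split (suc a) b h = trans (cong (h zero +_) (sum-split a b (h ∘ suc))) (sym (+-assoc (h zero) _ _))

↑-elim : ∀ a {b} {P : Fin (a + b) → Set} →
         (∀ i → P (i ↑ˡ b)) → (∀ j → P (a ↑ʳ j)) → ∀ i → P i
↑-elim a {P = P} l r i with splitAt a i in eq
... | inj₁ j = subst P (splitAt⁻¹-↑ˡ eq) (l j)
... | inj₂ j = subst P (splitAt⁻¹-↑ʳ eq) (r j)

sum-two : (h : Fin n → ℕ) {i j : Fin n} → i ≢ j →
          (∀ l → l ≢ i → l ≢ j → h l ≡ 0) → sum h ≡ h i + h j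
sum-two h {i} {j} i≢j z = begin
  sum h                                                        ≡⟨ sum-cong-≗ split ⟩
  sum (λ l → when (l ≟ᶠ i) (h l) + when (l ≟ᶠ j) (h l))       ≡⟨ ∑-distrib-+ (λ l → when (l ≟ᶠ i) (h l)) _ ⟩
  sum (λ l → when (l ≟ᶠ i) (h l)) + sum (λ l → when (l ≟ᶠ j) (h l))
    ≡⟨ cong₂ _+_ (at i) (at j) ⟩
  h i + h j                                                    ∎
  where
  open ≡-Reasoning
  at : ∀ i → sum (λ l → when (l ≟ᶠ i) (h l)) ≡ h i
  at i = trans (sum-single _ i λ l → when-no (l ≟ᶠ i)) (when-yes (i ≟ᶠ i) refl)
  split : ∀ l → h l ≡ when (l ≟ᶠ i) (h l) + when (l ≟ᶠ j) (h l)
  split l with l ≟ᶠ i | l ≟ᶠ j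
  ... | yes refl | yes refl = ⊥-elim (i≢j refl)
  ... | yes _    | no _     = sym (+-identityʳ _)
  ... | no _     | yes _    = refl
  ... | no p     | no q     = z l p q

sum-atMostOne : (c : Fin n → Bool) → (∀ {i j} → c i ≡ true → c j ≡ true → i ≡ j) →
                sum (λ i → if c i then 1 else 0) ≤ 1
sum-atMostOne {zero}  c u = z≤n
sum-atMostOne {suc n} c u with c zero in eq
... | false = sum-atMostOne (c ∘ suc) (λ p q → sucᶠ-injective (u p q))
... | true  = s≤s (≤-reflexive (sum-zero _ off))
  where
  off : ∀ i → (if c (suc i) then 1 else 0) ≡ 0
  off i with c (suc i) in eq′
  ... | false = refl
  ... | true  with () ← u eq eq′

-- Double counting in the matrix with entry `h₁ a` at (a, `to a`) and 0 elsewhere: its row sums are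
-- `h₁`, its column sums are `h₂`. The map is a bijection only between `A₁` and `A₂`; off these sets
-- the functions vanish, so the ambient sets may differ in size.
sum-reindex : (A₁ : Subset n₁) (A₂ : Subset n₂) (h₁ : Fin n₁ → ℕ) (h₂ : Fin n₂ → ℕ)
  (to : Fin n₁ → Fin n₂) →
  (∀ {a} → a ∈ A₁ → to a ∈ A₂) →
  (∀ {a b} → a ∈ A₁ → b ∈ A₁ → to a ≡ to b → a ≡ b) →
  (∀ {c} → c ∈ A₂ → ∃[ a ] (a ∈ A₁ × to a ≡ c)) →
  (∀ {a} → a ∈ A₁ → h₂ (to a) ≡ h₁ a) →
  (∀ {a} → a ∉ A₁ → h₁ a ≡ 0) → (∀ {c} → c ∉ A₂ → h₂ c ≡ 0) →
  sum h₁ ≡ sum h₂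
sum-reindex {n₁} {n₂} A₁ A₂ h₁ h₂ to into inj surj h≡ z₁ z₂ = begin
  sum h₁                                ≡⟨ sum-cong-≗ (λ a → row a (a ∈? A₁)) ⟩
  sum (λ a → sum (λ c → entry a c))     ≡⟨ ∑-comm entry ⟩
  sum (λ c → sum (λ a → entry a c))     ≡⟨ sum-cong-≗ (λ c → column c (c ∈? A₂)) ⟨
  sum h₂                                ∎
  where
  open ≡-Reasoning
  linked? : ∀ a c → Dec (a ∈ A₁ × to a ≡ c)
  linked? a c = (a ∈? A₁) ×-dec (to a ≟ᶠ c)
  entry : Fin n₁ → Fin n₂ → ℕ
  entry a c = when (linked? a c) (h₁ a)
  row : ∀ a → Dec (a ∈ A₁) → h₁ a ≡ sum (entry a)
  row a (yes a∈) = sym (trans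
        (sum-single (entry a) (to a) λ c c≢ → when-no (linked? a c) λ (_ , e) → c≢ (sym e))
        (when-yes (linked? a (to a)) (a∈ , refl)))
  row a (no a∉) = trans (z₁ a∉) (sym (sum-zero (entry a) λ c → when-no (linked? a c) λ (a∈ , _) → a∉ a∈))
  column : ∀ c → Dec (c ∈ A₂) → h₂ c ≡ sum (λ a → entry a c)
  column c (no c∉) = trans (z₂ c∉) (sym (sum-zero (λ a → entry a c) λ a →
        when-no (linked? a c) λ { (a∈ , refl) → c∉ (into a∈) }))
  column c (yes c∈) with surj c∈
  ... | a , a∈ , refl = sym (trans
          (sum-single (λ b → entry b c) a λ b b≢a → when-no (linked? b c) λ (b∈ , e) → b≢a (inj b∈ a∈ e))
          (trans (when-yes (linked? a c) (a∈ , refl)) (sym (h≡ a∈))))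

-- Subsets of Fin n

∈-tabulate⁺ : ∀ {P : Fin n → Set} (p? : ∀ x → Dec (P x)) {x} → P x → x ∈ tabulate (λ x → does (p? x))
∈-tabulate⁺ p? {x} p = lookup⇒[]= x _ (trans (lookup∘tabulate _ x) (dec-true (p? x) p))

∈-tabulate⁻ : ∀ {P : Fin n → Set} (p? : ∀ x → Dec (P x)) {x} → x ∈ tabulate (λ x → does (p? x)) → P x
∈-tabulate⁻ p? {x} x∈ with p? x | trans (sym (lookup∘tabulate (λ x → does (p? x)) x)) ([]=⇒lookup x∈)
... | yes p | _ = p

card-sum : (S : Subset n) → ∣ S ∣ ≡ sum (λ x → when (x ∈? S) 1)
card-sum []          = refl
card-sum (true ∷ S)  = cong suc (card-sum S)
card-sum (false ∷ S) = card-sum S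

sum-const-on : (S : Subset n) (q : ℕ) → sum (λ x → when (x ∈? S) q) ≡ ∣ S ∣ * q
sum-const-on []          q = refl
sum-const-on (true ∷ S)  q = cong (q +_) (sum-const-on S q)
sum-const-on (false ∷ S) q = sum-const-on S q

card-bijection : (A₁ : Subset n₁) (A₂ : Subset n₂) (to : Fin n₁ → Fin n₂) →
  (∀ {a} → a ∈ A₁ → to a ∈ A₂) →
  (∀ {a b} → a ∈ A₁ → b ∈ A₁ → to a ≡ to b → a ≡ b) →
  (∀ {c} → c ∈ A₂ → ∃[ a ] (a ∈ A₁ × to a ≡ c)) →
  ∣ A₁ ∣ ≡ ∣ A₂ ∣
card-bijection A₁ A₂ to into inj surj = trans (card-sum A₁) (trans
  (sum-reindex A₁ A₂ _ _ to into inj surj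
    (λ a∈ → trans (when-yes (_ ∈? A₂) (into a∈)) (sym (when-yes (_ ∈? A₁) a∈)))
    (when-no (_ ∈? A₁)) (when-no (_ ∈? A₂)))
  (sym (card-sum A₂)))

card-∪ : (A B : Subset n) → (∀ {x} → x ∈ A → x ∉ B) → ∣ A ∪ B ∣ ≡ ∣ A ∣ + ∣ B ∣
card-∪ A B disj = trans (card-sum (A ∪ B)) (trans (sum-cong-≗ λ x → split x (x ∈? A) (x ∈? B))
  (trans (∑-distrib-+ (λ x → when (x ∈? A) 1) _) (sym (cong₂ _+_ (card-sum A) (card-sum B)))))
  where
  split : ∀ x (a? : Dec (x ∈ A)) (b? : Dec (x ∈ B)) → when (x ∈? (A ∪ B)) 1 ≡ when a? 1 + when b? 1
  split x (yes a) (yes b) = ⊥-elim (disj a b)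
  split x (yes a) (no _)  = when-yes (x ∈? (A ∪ B)) (x∈p∪q⁺ (inj₁ a))
  split x (no _)  (yes b) = when-yes (x ∈? (A ∪ B)) (x∈p∪q⁺ (inj₂ b))
  split x (no ¬a) (no ¬b) = when-no (x ∈? (A ∪ B)) ([ ¬a , ¬b ]′ ∘ x∈p∪q⁻ A B)

-- Nonseparable graphs

x∈p─q⇒x∉q : ∀ {x} (p q : Subset n) → x ∈ p ─ q → x ∉ q
x∈p─q⇒x∉q (_ ∷ p) (true ∷ q)  ()        here
x∈p─q⇒x∉q (_ ∷ p) (_ ∷ q)     (there a) (there b) = x∈p─q⇒x∉q p q a b

x∈p-y⁻ : ∀ {x y} {p : Subset n} → x ∈ p - y → x ∈ p × x ≢ y
x∈p-y⁻ {y = y} {p} x∈ = p─q⊆p p _ x∈ , λ { refl → x∈p─q⇒x∉q p _ x∈ (x∈⁅x⁆ y) }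

mask-positive : ∀ (S : Subset n) ν {u v} → 0 < mask S ν u v → u ∈ S × v ∈ S × 0 < ν u v
mask-positive S ν {u} {v} p with lookupᵛ S u in eq | lookupᵛ S v in eq′
... | true | true = lookup⇒[]= u S eq , lookup⇒[]= v S eq′ , p

μ-supp₂ : (G : Graph n) → ∀ {u v} → Adjacent G u v → v ∈ V G
μ-supp₂ G {u} {v} a = μ-supp G v u (subst (0 <_) (μ-sym G u v) a)

adjacent-sym : (G : Graph n) → ∀ {u v} → Adjacent G u v → Adjacent G v u
adjacent-sym G {u} {v} = subst (0 <_) (μ-sym G u v)

adjacent⇒≢ : (G : Graph n) → ∀ {u v} → Adjacent G u v → u ≢ v
adjacent⇒≢ G {u} a refl with () ← subst (0 <_) (μ-loop G u) a

∈∖⁺ : (G : Graph n) → ∀ {u v} → u ∈ V G → u ≢ v → u ∈ V (G ∖ v)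
∈∖⁺ G u∈ u≢v = x∈p∩q⁺ (u∈ , x∈p∧x≢y⇒x∈p-y u∈ u≢v)

∈∖⁻ : (G : Graph n) → ∀ {u v} → u ∈ V (G ∖ v) → u ∈ V G × u ≢ v
∈∖⁻ G {v = v} u∈ = x∈p-y⁻ (proj₂ (x∈p∩q⁻ (V G) (V G - v) u∈))

adjacent∖⁺ : (G : Graph n) → ∀ {u v w} → u ≢ w → v ≢ w → Adjacent G u v → Adjacent (G ∖ w) u v
adjacent∖⁺ G u≢ v≢ a = subst (0 <_) (sym (mask-inside _ (μ G)
  (x∈p∧x≢y⇒x∈p-y (μ-supp G _ _ a) u≢) (x∈p∧x≢y⇒x∈p-y (μ-supp₂ G a) v≢))) a

adjacent∖⁻ : (G : Graph n) → ∀ {u v w} → Adjacent (G ∖ w) u v → u ≢ w × v ≢ w × Adjacent G u v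
adjacent∖⁻ G {w = w} a with mask-positive (V G - w) (μ G) a
... | u∈ , v∈ , b = proj₂ (x∈p-y⁻ u∈) , proj₂ (x∈p-y⁻ v∈) , b

walk-sym : (G : Graph n) → ∀ {u v} → Walk G u v → Walk G v u
walk-sym G = reverse (adjacent-sym G)

⊑-antisym : {K G : Graph n} → K ⊑ G → G ⊑ K → K ≈ G
⊑-antisym (s , le) (s′ , le′) = ⊆-antisym s s′ , λ u v → ≤-antisym (le u v) (le′ u v)

-- The whole graph contains every subgraph, so maximality is immediate, and any block must reach up
-- to it.
nonseparable⇒isBlock : {G : Graph n} → Nonseparable G → IsBlock G
nonseparable⇒isBlock {G = G} ns =
  record { sub = G⊑G ; nonsep = ns ; maximal = λ _ B⊑G _ _ → B⊑G } ,
  λ B isB → let open _IsBlockOf_ isB in ⊑-antisym {K = B} {G} sub (maximal G G⊑G ns sub)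
  where
  G⊑G : G ⊑ G
  G⊑G = (λ x∈ → x∈) , λ _ _ → ≤-refl

≅-trans : {G₁ : Graph n₁} {G₂ : Graph n₂} {G₃ : Graph m} → G₁ ≅ G₂ → G₂ ≅ G₃ → G₁ ≅ G₃
≅-trans {G₁ = G₁} {G₂} {G₃} f g = record
  { to         = G.to ∘ F.to
  ; to-V       = G.to-V ∘ F.to-V
  ; injective  = λ u∈ v∈ e → F.injective u∈ v∈ (G.injective (F.to-V u∈) (F.to-V v∈) e)
  ; surjective = surj
  ; to-μ       = λ u∈ v∈ → trans (G.to-μ (F.to-V u∈) (F.to-V v∈)) (F.to-μ u∈ v∈)
  }
  where
  module F = _≅_ f
  module G = _≅_ g
  surj : ∀ {w} → w ∈ V G₃ → ∃[ v ] (v ∈ V G₁ × G.to (F.to v) ≡ w)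
  surj w∈ with G.surjective w∈
  ... | u , u∈ , refl with F.surjective u∈
  ...   | v , v∈ , refl = v , v∈ , refl

module _ {G₁ : Graph n₁} {G₂ : Graph n₂} (iso : G₁ ≅ G₂) where
  open _≅_ iso

  adjacent-≅ : ∀ {u v} → Adjacent G₁ u v → Adjacent G₂ (to u) (to v)
  adjacent-≅ a = subst (0 <_) (sym (to-μ (μ-supp G₁ _ _ a) (μ-supp₂ G₁ a))) a

  -- A separation is pulled back to `G₁`: injectivity keeps the image of a walk avoiding `a` away
  -- from `to a`.
  nonseparable-≅ : Nonseparable G₁ → Nonseparable G₂
  nonseparable-≅ (((r , r∈) , conn) , nosep) = ((to r , to-V r∈) , conn₂) , nosep₂
    where
    conn₂ : ∀ u v → u ∈ V G₂ → v ∈ V G₂ → Walk G₂ u v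
    conn₂ u v u∈ v∈ with surjective u∈ | surjective v∈
    ... | a , a∈ , refl | b , b∈ , refl = gmap to adjacent-≅ (conn a b a∈ b∈)
    nosep₂ : ∀ v → ¬ Separating G₂ v
    nosep₂ v (v∈ , u , w , u∈ , w∈ , ¬walk)
      with surjective v∈ | surjective (proj₁ (∈∖⁻ G₂ u∈)) | surjective (proj₁ (∈∖⁻ G₂ w∈))
    ... | a , a∈ , refl | b , b∈ , refl | c , c∈ , refl =
      nosep a (a∈ , b , c , ∈∖⁺ G₁ b∈ (proj₂ (∈∖⁻ G₂ u∈) ∘ cong to) ,
        ∈∖⁺ G₁ c∈ (proj₂ (∈∖⁻ G₂ w∈) ∘ cong to) , λ walk → ¬walk (gmap to step walk))
      where
      step : ∀ {x y} → Adjacent (G₁ ∖ a) x y → Adjacent (G₂ ∖ to a) (to x) (to y)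
      step adj with adjacent∖⁻ G₁ adj
      ... | x≢ , y≢ , adj′ = adjacent∖⁺ G₂
        (x≢ ∘ injective (μ-supp G₁ _ _ adj′) a∈) (y≢ ∘ injective (μ-supp₂ G₁ adj′) a∈) (adjacent-≅ adj′)

  deg-≅ : ∀ {v} → v ∈ V G₁ → deg G₂ (to v) ≡ deg G₁ v
  deg-≅ {v} v∈ = sym (sum-reindex (V G₁) (V G₂) _ _ to to-V injective surjective (to-μ v∈)
    (λ ∉ → off G₁ ∉) (λ ∉ → off G₂ ∉))
    where
    off : ∀ {n} (G : Graph n) {u w} → w ∉ V G → μ G u w ≡ 0
    off G {u} {w} w∉ with μ G u w in eq
    ... | zero  = refl
    ... | suc _ = ⊥-elim (w∉ (μ-supp₂ G (subst (0 <_) (sym eq) (s≤s z≤n))))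

support-≤ : ∀ {a b} → (0 < a → a ≤ b) → a ≤ b
support-≤ {zero}  _ = z≤n
support-≤ {suc _} h = h (s≤s z≤n)

0<* : ∀ {a b} → 0 < a → 0 < b → 0 < a * b
0<* = *-mono-≤ {1} {_} {1}

-- Complete graphs

module _ {t k : ℕ} (t≥1 : 1 ≤ t) where

  private
    K : Graph k
    K = t · completeGraph k

  complete-adjacent : ∀ {i j} → i ≢ j → Adjacent K i j
  complete-adjacent {i} {j} i≢j =
    0<* t≥1 (≤-reflexive (sym (cong (if_then 0 else 1) (dec-false (i ≟ᶠ j) i≢j))))

  complete-nonseparable : Fin k → Nonseparable K
  complete-nonseparable r = ((r , ∈⊤) , λ u v _ _ → walk u v) , λ v (_ , u , w , u∈ , w∈ , ¬walk) →
    ¬walk (walk∖ v u w (proj₂ (∈∖⁻ K u∈)) (proj₂ (∈∖⁻ K w∈)))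
    where
    walk : ∀ u v → Walk K u v
    walk u v with u ≟ᶠ v
    ... | yes refl = ε
    ... | no u≢v   = complete-adjacent u≢v ◅ ε
    walk∖ : ∀ v u w → u ≢ v → w ≢ v → Walk (K ∖ v) u w
    walk∖ v u w u≢ w≢ with u ≟ᶠ w
    ... | yes refl = ε
    ... | no u≢w   = adjacent∖⁺ K u≢ w≢ (complete-adjacent u≢w) ◅ ε

-- Adding the missing t on the diagonal makes row i of the multiplicities constantly t, with a sum
-- not depending on i; the common t is then cancelled.
complete-regular : ∀ t {k} (i j : Fin k) → deg (t · completeGraph k) i ≡ deg (t · completeGraph k) j
complete-regular t {k} i j = +-cancelʳ-≡ t _ _ (trans (total i) (sym (total j)))
  where
  total : ∀ i → deg (t · completeGraph k) i + t ≡ sum {k} (λ _ → t)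
  total i = begin
    deg (t · completeGraph k) i + t
      ≡⟨ cong (deg (t · completeGraph k) i +_) (trans (sum-single _ i λ l l≢i → when-no (i ≟ᶠ l) (l≢i ∘ sym)) (when-yes (i ≟ᶠ i) refl)) ⟨
    deg (t · completeGraph k) i + sum (λ l → when (i ≟ᶠ l) t)
      ≡⟨ ∑-distrib-+ (μ (t · completeGraph k) i) _ ⟨
    sum (λ l → μ (t · completeGraph k) i l + when (i ≟ᶠ l) t)
      ≡⟨ sum-cong-≗ (λ l → term l (i ≟ᶠ l)) ⟩
    sum {k} (λ _ → t) ∎
    where
    open ≡-Reasoning
    term : ∀ l (d : Dec (i ≡ l)) → t * (if does d then 0 else 1) + when d t ≡ t
    term l (yes _) rewrite *-zeroʳ t = refl
    term l (no _)  rewrite *-identityʳ t = +-identityʳ t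

-- Cycles

module _ {k : ℕ} (k≥3 : 3 ≤ k) where

  next-exists : (i : Fin k) → ∃[ j ] Next i j
  next-exists i with m≤n⇒m<n∨m≡n (toℕ<n i)
  ... | inj₁ lt = fromℕ< lt , inj₁ (toℕ-fromℕ< lt)
  ... | inj₂ e  = fromℕ< {0} (≤-trans (s≤s z≤n) k≥3) , inj₂ (e , toℕ-fromℕ< _)

  previous-exists : (i : Fin k) → ∃[ j ] Next j i
  previous-exists i with toℕ i in eq
  ... | suc a = fromℕ< (<-trans (n<1+n a) a+1<k) , inj₁ (cong suc (sym (toℕ-fromℕ< _)))
    where
    a+1<k : suc a < k
    a+1<k = subst (_< k) eq (toℕ<n i)
  ... | zero  = fromℕ< pred< , inj₂ (trans (cong suc (toℕ-fromℕ< pred<)) 1+pred , refl)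
    where
    1+pred : suc (k ∸ 1) ≡ k
    1+pred = m+[n∸m]≡n (≤-trans (s≤s z≤n) k≥3)
    pred< : k ∸ 1 < k
    pred< = ≤-reflexive 1+pred

  next-unique : {i j l : Fin k} → Next i j → Next i l → j ≡ l
  next-unique (inj₁ p)       (inj₁ q)       = toℕ-injective (trans p (sym q))
  next-unique (inj₂ (_ , p)) (inj₂ (_ , q)) = toℕ-injective (trans p (sym q))
  next-unique {j = j} (inj₁ p) (inj₂ (e , _)) = ⊥-elim (<-irrefl (trans p e) (toℕ<n j))
  next-unique {l = l} (inj₂ (e , _)) (inj₁ q) = ⊥-elim (<-irrefl (trans q e) (toℕ<n l))

  previous-unique : {i j l : Fin k} → Next j i → Next l i → j ≡ l
  previous-unique (inj₁ p)       (inj₁ q)       = toℕ-injective (suc-injective (trans (sym p) q))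
  previous-unique (inj₂ (p , _)) (inj₂ (q , _)) = toℕ-injective (suc-injective (trans p (sym q)))
  previous-unique (inj₁ p) (inj₂ (_ , q)) with () ← trans (sym p) q
  previous-unique (inj₂ (_ , q)) (inj₁ p) with () ← trans (sym p) q

  -- A mutual step would close the cycle after at most two vertices; this is where length at least 3
  -- enters.
  next-asym : {i j : Fin k} → Next i j → ¬ Next j i
  next-asym {i} {j} (inj₁ p) (inj₁ q) = 1+n≰n (≤-trans (≤-trans (n≤1+n (suc (toℕ i))) (≤-reflexive (cong suc (sym p)))) (≤-reflexive (sym q)))
  next-asym (inj₁ p) (inj₂ (e , q)) = <-irrefl (trans (cong suc (sym (trans p (cong suc q)))) e) k≥3
  next-asym (inj₂ (e , q)) (inj₁ p) = <-irrefl (trans (cong suc (sym (trans p (cong suc q)))) e) k≥3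
  next-asym (inj₂ (e , _)) (inj₂ (_ , q)) = <-irrefl (trans (cong suc (sym q)) e) (≤-trans (n≤1+n 2) k≥3)

cycleμ-adjacent : {i j : Fin m} → Next i j ⊎ Next j i → cycleμ i j ≡ 1
cycleμ-adjacent {i = i} {j} p = cong (if_then 1 else 0) (dec-true (consecutive? i j) p)

cycleμ-positive : {i j : Fin m} → 0 < cycleμ i j → Next i j ⊎ Next j i
cycleμ-positive {i = i} {j} = go (consecutive? i j)
  where
  go : (d : Dec (Next i j ⊎ Next j i)) → 0 < when d 1 → Next i j ⊎ Next j i
  go (yes p) _ = p

cycle-deg : ∀ t {k} (k≥3 : 3 ≤ k) (i : Fin k) → deg (t · cycle k k≥3) i ≡ t * 1 + t * 1
cycle-deg t {k} k≥3 i with next-exists k≥3 i | previous-exists k≥3 i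
... | a , na | b , nb = trans
  (sum-two (μ (t · cycle k k≥3) i) (λ { refl → next-asym k≥3 na nb }) off)
  (cong₂ _+_ (cong (t *_) (cycleμ-adjacent (inj₁ na))) (cong (t *_) (cycleμ-adjacent (inj₂ nb))))
  where
  off : ∀ l → l ≢ a → l ≢ b → t * cycleμ i l ≡ 0
  off l l≢a l≢b = trans (cong (t *_) (when-no (consecutive? i l) λ
    { (inj₁ p) → l≢a (next-unique k≥3 p na) ; (inj₂ p) → l≢b (previous-unique k≥3 p nb) })) (*-zeroʳ t)

cycle-regular : ∀ t {k} (k≥3 : 3 ≤ k) (i j : Fin k) → deg (t · cycle k k≥3) i ≡ deg (t · cycle k k≥3) j
cycle-regular t k≥3 i j = trans (cycle-deg t k≥3 i) (sym (cycle-deg t k≥3 j))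

module _ {t k : ℕ} (t≥1 : 1 ≤ t) (k≥3 : 3 ≤ k) where

  private
    C : Graph k
    C = t · cycle k k≥3

  cycle-adjacent : ∀ {i j} → Next i j ⊎ Next j i → Adjacent C i j
  cycle-adjacent p = 0<* t≥1 (≤-reflexive (sym (cycleμ-adjacent p)))

  -- `L` and `Ok` are abstract so that the same walks serve in the cycle itself and, with `Ok`
  -- saying "different from v", in the cycle with v deleted.
  module _ (L : Graph k) (Ok : Fin k → Set)
           (step : ∀ {i j} → Ok i → Ok j → toℕ j ≡ suc (toℕ i) → Adjacent L j i) where

    descend : ∀ a {i z} → toℕ i ≡ a → toℕ z ≡ 0 → (∀ l → toℕ l ≤ a → Ok l) → Walk L i z
    descend zero    e e₀ ok rewrite toℕ-injective (trans e (sym e₀)) = ε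
    descend (suc a) {i} e e₀ ok =
      step (ok _ (≤-trans (≤-reflexive e′) (n≤1+n a))) (ok i (≤-reflexive e)) (trans e (cong suc (sym e′)))
      ◅ descend a e′ e₀ (λ l l≤ → ok l (≤-trans l≤ (n≤1+n a)))
      where
      a<k : a < k
      a<k = <-trans (n<1+n a) (subst (_< k) e (toℕ<n i))
      e′ : toℕ (fromℕ< a<k) ≡ a
      e′ = toℕ-fromℕ< a<k

    -- Here `a` counts the steps left to the last index k - 1, so that the recursion is structural
    -- although the index grows.
    ascend : ∀ a {i z} → suc (toℕ i + a) ≡ k → suc (toℕ z) ≡ k → (∀ l → toℕ i ≤ toℕ l → Ok l) → Walk L i z
    ascend zero {i} {z} e e₁ ok
      rewrite toℕ-injective {i = i} {z} (suc-injective (trans (cong suc (sym (+-identityʳ (toℕ i)))) (trans e (sym e₁)))) = ε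
    ascend (suc a) {i} e e₁ ok =
      adjacent-sym L (step (ok i ≤-refl) (ok _ i≤) e′)
      ◅ ascend a (trans (cong (λ b → suc (b + a)) e′) (trans (cong suc (sym (+-suc (toℕ i) a))) e)) e₁
          (λ l l≥ → ok l (≤-trans i≤ l≥))
      where
      i+1<k : suc (toℕ i) < k
      i+1<k = subst (suc (suc (toℕ i)) ≤_) e (s≤s (≤-trans (s≤s (m≤m+n (toℕ i) a)) (≤-reflexive (sym (+-suc (toℕ i) a)))))
      e′ : toℕ (fromℕ< i+1<k) ≡ suc (toℕ i)
      e′ = toℕ-fromℕ< i+1<k
      i≤ : toℕ i ≤ toℕ (fromℕ< i+1<k)
      i≤ = ≤-trans (n≤1+n _) (≤-reflexive (sym e′))

  -- Deleting v leaves a path: indices below v walk down to 0, those above v walk up to k - 1, and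
  -- the closing edge of the cycle joins these two ends.
  cycle-nonseparable : Nonseparable C
  cycle-nonseparable =
    ((first , ∈⊤) , λ u v _ _ → toFirst u ◅◅ walk-sym C (toFirst v)) , λ v (_ , u , w , u∈ , w∈ , ¬walk) →
    ¬walk (walk∖ v u w (proj₂ (∈∖⁻ C u∈)) (proj₂ (∈∖⁻ C w∈)))
    where
    first : Fin k
    first = fromℕ< {0} (≤-trans (s≤s z≤n) k≥3)
    first≡0 : toℕ first ≡ 0
    first≡0 = toℕ-fromℕ< _
    last : Fin k
    last = proj₁ (previous-exists k≥3 first)
    last≡ : suc (toℕ last) ≡ k
    last≡ with proj₂ (previous-exists k≥3 first)
    ... | inj₁ e with () ← trans (sym e) first≡0
    ... | inj₂ (e , _) = e
    toFirst : ∀ u → Walk C u first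
    toFirst u = descend C (λ _ → Unit) (λ _ _ e → cycle-adjacent (inj₂ (inj₁ e)))
      (toℕ u) refl first≡0 (λ _ _ → tt)
    module _ (v : Fin k) where
      step∖ : ∀ {i j} → i ≢ v → j ≢ v → toℕ j ≡ suc (toℕ i) → Adjacent (C ∖ v) j i
      step∖ i≢ j≢ e = adjacent∖⁺ C j≢ i≢ (cycle-adjacent (inj₂ (inj₁ e)))
      below : ∀ u → toℕ u < toℕ v → Walk (C ∖ v) u first
      below u u<v = descend (C ∖ v) (_≢ v) step∖ (toℕ u) refl first≡0
        λ { l l≤ refl → <-irrefl refl (<-≤-trans u<v l≤) }
      above : ∀ u → toℕ v < toℕ u → Walk (C ∖ v) u last
      above u v<u = ascend (C ∖ v) (_≢ v) step∖ (k ∸ suc (toℕ u)) (m+[n∸m]≡n (toℕ<n u)) last≡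
        λ { l l≥ refl → <-irrefl refl (<-≤-trans v<u l≥) }
      around : ∀ {u w} → toℕ u < toℕ v → toℕ v < toℕ w → Walk (C ∖ v) u w
      -- The closing edge survives the deletion: v is not index 0 since u lies below it, and not
      -- index k - 1 since w lies above it.
      around {u} {w} u<v v<w = below u u<v ◅◅ (adjacent∖⁺ C
          (λ { refl → n≮0 (subst (toℕ u <_) first≡0 u<v) })
          (λ { refl → <-irrefl last≡ (<-≤-trans (s≤s v<w) (toℕ<n w)) })
          (cycle-adjacent (inj₂ (inj₂ (last≡ , first≡0)))) ◅ walk-sym (C ∖ v) (above w v<w))
      walk∖ : ∀ u w → u ≢ v → w ≢ v → Walk (C ∖ v) u w
      walk∖ u w u≢ w≢ with <-cmp (toℕ u) (toℕ v) | <-cmp (toℕ w) (toℕ v)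
      ... | tri≈ _ e _  | _           = ⊥-elim (u≢ (toℕ-injective e))
      ... | _           | tri≈ _ e _  = ⊥-elim (w≢ (toℕ-injective e))
      ... | tri< p _ _  | tri< q _ _  = below u p ◅◅ walk-sym (C ∖ v) (below w q)
      ... | tri> _ _ p  | tri> _ _ q  = above u p ◅◅ walk-sym (C ∖ v) (above w q)
      ... | tri< p _ _  | tri> _ _ q  = around p q
      ... | tri> _ _ p  | tri< q _ _  = walk-sym (C ∖ v) (around q p)

open Equivalence using (to; from)

-- Isomorphisms of configurations

IsBlockConfiguration : Tuple n m → Set
IsBlockConfiguration T = IsMConfiguration T ⊎ IsKConfiguration T ⊎ IsCConfiguration T

module _ (T : Tuple n m) where
  open Tuple T

  ∈-trace⁻ : ∀ U {v} → G [ trace U ] ≈ G → v ∈ V G → Nonempty (X v ∩ U)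
  ∈-trace⁻ U (V≡ , _) v∈ =
    ∈-tabulate⁻ (λ v → nonempty? (X v ∩ U)) (p∩q⊆q (V G) (trace U) (subst (_ ∈_) (sym V≡) v∈))

  trace-full : ∀ U → (∀ {v} → v ∈ V G → Nonempty (X v ∩ U)) → G [ trace U ] ≈ G
  trace-full U occ = ⊑-antisym {K = G [ trace U ]} {G} (induced⊑ G (trace U))
    ((λ v∈ → x∈p∩q⁺ (v∈ , V⊆ v∈)) , below)
    where
    V⊆ : V G ⊆ trace U
    V⊆ v∈ = ∈-tabulate⁺ (λ v → nonempty? (X v ∩ U)) (occ v∈)
    below : ∀ u v → μ G u v ≤ mask (trace U) (μ G) u v
    below u v = support-≤ λ adj → ≤-reflexive
      (sym (mask-inside (trace U) (μ G) (V⊆ (μ-supp G u v adj)) (V⊆ (μ-supp₂ G adj))))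

∈X⇒∈V : {G : Graph n} {X : Fin n → Subset m} {H : Graph m} → IsCover G X H →
        ∀ {v x} → v ∈ V G → x ∈ X v → x ∈ V H
∈X⇒∈V cover v∈ x∈ = from (IsCover.union cover _) (_ , v∈ , x∈)

-- Inverses are carried as data, with their laws only on the vertex sets: the ambient sets may
-- differ, and the maps mean nothing outside the vertices.
record Iso (T₁ : Tuple n₁ m₁) (T₂ : Tuple n₂ m₂) : Set where
  open Tuple T₁ using () renaming (G to G₁; X to X₁; H to H₁; f to f₁)
  open Tuple T₂ using () renaming (G to G₂; X to X₂; H to H₂; f to f₂)
  field
    φ    : Fin n₁ → Fin n₂
    φ⁻   : Fin n₂ → Fin n₁
    ψ    : Fin m₁ → Fin m₂
    ψ⁻   : Fin m₂ → Fin m₁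
    φ-V  : ∀ {v} → v ∈ V G₁ → φ v ∈ V G₂
    φ⁻-V : ∀ {w} → w ∈ V G₂ → φ⁻ w ∈ V G₁
    φφ⁻  : ∀ {w} → w ∈ V G₂ → φ (φ⁻ w) ≡ w
    φ⁻φ  : ∀ {v} → v ∈ V G₁ → φ⁻ (φ v) ≡ v
    ψ-V  : ∀ {x} → x ∈ V H₁ → ψ x ∈ V H₂
    ψ⁻-V : ∀ {z} → z ∈ V H₂ → ψ⁻ z ∈ V H₁
    ψψ⁻  : ∀ {z} → z ∈ V H₂ → ψ (ψ⁻ z) ≡ z
    ψ⁻ψ  : ∀ {x} → x ∈ V H₁ → ψ⁻ (ψ x) ≡ x
    φ-μ  : ∀ {u v} → u ∈ V G₁ → v ∈ V G₁ → μ G₂ (φ u) (φ v) ≡ μ G₁ u v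
    ψ-μ  : ∀ {x y} → x ∈ V H₁ → y ∈ V H₁ → μ H₂ (ψ x) (ψ y) ≡ μ H₁ x y
    ψ-X  : ∀ {v x} → v ∈ V G₁ → x ∈ X₁ v → ψ x ∈ X₂ (φ v)
    ψ⁻-X : ∀ {w z} → w ∈ V G₂ → z ∈ X₂ w → ψ⁻ z ∈ X₁ (φ⁻ w)
    ψ-f  : ∀ {x} → x ∈ V H₁ → f₂ (ψ x) ≡ f₁ x

-- Uniformity of the target is supplied separately, because the targets used are restrictions of a
-- uniform configuration and inherit it from there.
module Transport {T₁ : Tuple n₁ m₁} {T₂ : Tuple n₂ m₂} (iso : Iso T₁ T₂)
                 (uniform₁ : Tuple.IsUniformConfiguration T₁)
                 (uniform₂ : Tuple.IsUniformConfiguration T₂) where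
  open Tuple T₁ using () renaming (G to G₁; X to X₁; H to H₁; f to f₁; QuotientInflates to QuotientInflates₁)
  open Tuple T₂ using () renaming (G to G₂; X to X₂; H to H₂; f to f₂; QuotientInflates to QuotientInflates₂)
  open Iso iso

  X⊆V₁ : ∀ {v x} → v ∈ V G₁ → x ∈ X₁ v → x ∈ V H₁
  X⊆V₁ v∈ x∈ = ∈X⇒∈V (proj₁ uniform₁) v∈ x∈

  X⊆V₂ : ∀ {v x} → v ∈ V G₂ → x ∈ X₂ v → x ∈ V H₂
  X⊆V₂ v∈ x∈ = ∈X⇒∈V (proj₁ uniform₂) v∈ x∈

  G₁≅G₂ : G₁ ≅ G₂
  G₁≅G₂ = record
    { to         = φ
    ; to-V       = φ-V
    ; injective  = λ u∈ v∈ e → trans (sym (φ⁻φ u∈)) (trans (cong φ⁻ e) (φ⁻φ v∈))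
    ; surjective = λ w∈ → _ , φ⁻-V w∈ , φφ⁻ w∈
    ; to-μ       = φ-μ
    }

  φ⁻-μ : ∀ {u v} → u ∈ V G₂ → v ∈ V G₂ → μ G₁ (φ⁻ u) (φ⁻ v) ≡ μ G₂ u v
  φ⁻-μ u∈ v∈ = trans (sym (φ-μ (φ⁻-V u∈) (φ⁻-V v∈))) (cong₂ (μ G₂) (φφ⁻ u∈) (φφ⁻ v∈))

  ψ⁻-μ : ∀ {x y} → x ∈ V H₂ → y ∈ V H₂ → μ H₁ (ψ⁻ x) (ψ⁻ y) ≡ μ H₂ x y
  ψ⁻-μ x∈ y∈ = trans (sym (ψ-μ (ψ⁻-V x∈) (ψ⁻-V y∈))) (cong₂ (μ H₂) (ψψ⁻ x∈) (ψψ⁻ y∈))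

  ψ⁻-f : ∀ {z} → z ∈ V H₂ → f₂ z ≡ f₁ (ψ⁻ z)
  ψ⁻-f z∈ = trans (cong f₂ (sym (ψψ⁻ z∈))) (ψ-f (ψ⁻-V z∈))

  deg-φ⁻ : ∀ {w} → w ∈ V G₂ → deg G₂ w ≡ deg G₁ (φ⁻ w)
  deg-φ⁻ w∈ = trans (cong (deg G₂) (sym (φφ⁻ w∈))) (deg-≅ G₁≅G₂ (φ⁻-V w∈))

  image? : ∀ (A : Subset m₁) z → Dec (z ∈ V H₂ × ψ⁻ z ∈ A)
  image? A z = (z ∈? V H₂) ×-dec (ψ⁻ z ∈? A)

  -- Described as a preimage under `ψ⁻` within `V H₂`, so that membership needs no existential
  -- witness; for sets inside `V H₁` this is the image under `ψ`.
  image : Subset m₁ → Subset m₂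
  image A = tabulate λ z → does (image? A z)

  ∈image⁺ : ∀ {A z} → z ∈ V H₂ → ψ⁻ z ∈ A → z ∈ image A
  ∈image⁺ {A} z∈ a∈ = ∈-tabulate⁺ (image? A) (z∈ , a∈)

  ∈image⁻ : ∀ {A z} → z ∈ image A → z ∈ V H₂ × ψ⁻ z ∈ A
  ∈image⁻ {A} = ∈-tabulate⁻ (image? A)

  ψ∈image : ∀ {A x} → x ∈ V H₁ → x ∈ A → ψ x ∈ image A
  ψ∈image x∈V x∈ = ∈image⁺ (ψ-V x∈V) (subst (_∈ _) (sym (ψ⁻ψ x∈V)) x∈)

  ψ-injective : ∀ {x y} → x ∈ V H₁ → y ∈ V H₁ → ψ x ≡ ψ y → x ≡ y
  ψ-injective x∈ y∈ e = trans (sym (ψ⁻ψ x∈)) (trans (cong ψ⁻ e) (ψ⁻ψ y∈))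

  ∣image∣ : ∀ {A} → A ⊆ V H₁ → ∣ image A ∣ ≡ ∣ A ∣
  ∣image∣ {A} A⊆ = sym (card-bijection A (image A) ψ
    (λ x∈ → ψ∈image (A⊆ x∈) x∈) (λ x∈ y∈ → ψ-injective (A⊆ x∈) (A⊆ y∈))
    λ z∈ → let z∈V , a∈ = ∈image⁻ z∈ in _ , a∈ , ψψ⁻ z∈V)

  ∣X∩image∣ : ∀ {w} U → w ∈ V G₂ → ∣ X₂ w ∩ image U ∣ ≡ ∣ X₁ (φ⁻ w) ∩ U ∣
  ∣X∩image∣ {w} U w∈ = trans (cong ∣_∣ (⊆-antisym ⊆₁ ⊆₂)) (∣image∣ λ x∈ → X⊆V₁ (φ⁻-V w∈) (p∩q⊆p _ _ x∈))
    where
    ⊆₁ : X₂ w ∩ image U ⊆ image (X₁ (φ⁻ w) ∩ U)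
    ⊆₁ z∈ with x∈p∩q⁻ (X₂ w) (image U) z∈
    ... | z∈X , z∈U = ∈image⁺ (X⊆V₂ w∈ z∈X) (x∈p∩q⁺ (ψ⁻-X w∈ z∈X , proj₂ (∈image⁻ z∈U)))
    ⊆₂ : image (X₁ (φ⁻ w) ∩ U) ⊆ X₂ w ∩ image U
    ⊆₂ z∈ with ∈image⁻ z∈
    ... | z∈V , a∈ with x∈p∩q⁻ (X₁ (φ⁻ w)) U a∈
    ...   | a∈X , a∈U = x∈p∩q⁺
      (subst₂ (λ a b → a ∈ X₂ b) (ψψ⁻ z∈V) (φφ⁻ w∈) (ψ-X (φ⁻-V w∈) a∈X) , ∈image⁺ z∈V a∈U)

  -- The cover graph `K` from which an inflation starts is unrelated to `H₁` and `H₂`; it stays as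
  -- it is and only the indexing of its fibres is composed with `φ⁻`.
  cover-reindex : ∀ {Y : Fin n₁ → Subset m′} {K} → IsCover G₁ Y K → IsCover G₂ (Y ∘ φ⁻) K
  cover-reindex {Y = Y} {K} c = record
    { disjoint    = λ u∈ v∈ u≢v → disjoint (φ⁻-V u∈) (φ⁻-V v∈) (apart u∈ v∈ u≢v)
    ; union       = λ x → mk⇔
        (λ x∈ → let v , v∈ , x∈Y = to (union x) x∈
                in φ v , φ-V v∈ , subst (λ a → x ∈ Y a) (sym (φ⁻φ v∈)) x∈Y)
        (λ (w , w∈ , x∈Y) → from (union x) (φ⁻ w , φ⁻-V w∈ , x∈Y))
    ; independent = λ v∈ → independent (φ⁻-V v∈)
    ; matchings   = λ {u} {v} u∈ v∈ u≢v → subst (λ k → UnionOfMatchings k K (Y (φ⁻ u)) (Y (φ⁻ v)))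
        (φ⁻-μ u∈ v∈) (matchings (φ⁻-V u∈) (φ⁻-V v∈) (apart u∈ v∈ u≢v))
    }
    where
    open IsCover c
    apart : ∀ {u v} → u ∈ V G₂ → v ∈ V G₂ → u ≢ v → φ⁻ u ≢ φ⁻ v
    apart u∈ v∈ u≢v e = u≢v (trans (sym (φφ⁻ u∈)) (trans (cong φ e) (φφ⁻ v∈)))

  graphCover-reindex : ∀ {m′} {Y : Fin n₁ → Subset m′} {K} → IsGraphCover G₁ Y K → IsGraphCover G₂ (Y ∘ φ⁻) K
  graphCover-reindex c = record
    { cover = cover-reindex cover
    ; x     = x ∘ φ⁻
    ; X≡    = λ v∈ → X≡ (φ⁻-V v∈)
    ; μ≡    = λ u∈ v∈ u≢v → trans
        (μ≡ (φ⁻-V u∈) (φ⁻-V v∈) λ e → u≢v (trans (sym (φφ⁻ u∈)) (trans (cong φ e) (φφ⁻ v∈))))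
        (φ⁻-μ u∈ v∈)
    }
    where open IsGraphCover c

  -- A double cover refers to a chosen numbering of the cycle, so the numbering is composed with
  -- `φ`; the fibre over the i-th vertex is then unchanged because `φ⁻` undoes `φ`.
  doubleCover-reindex : ∀ {t k k≥3} (tC≅G₁ : t · cycle k k≥3 ≅ G₁) {m′} {Y : Fin n₁ → Subset m′} {K} →
    IsDoubleCover t k k≥3 G₁ tC≅G₁ Y K → IsDoubleCover t k k≥3 G₂ (≅-trans tC≅G₁ G₁≅G₂) (Y ∘ φ⁻) K
  doubleCover-reindex {k = k} tC≅G₁ {Y = Y} c = record
    { cover     = cover-reindex cover
    ; x         = x
    ; injective = injective
    ; X≡        = λ i → trans (cong Y (φ⁻φ (_≅_.to-V tC≅G₁ ∈⊤))) (X≡ i)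
    ; μ≡        = μ≡
    }
    where
    open IsDoubleCover c

  -- The same `K` and the same s witness the new inflation: the classes are replaced by their
  -- images, and multiplicities between them are read back through `ψ⁻`.
  quotientInflates-image :
    {P₁ : ∀ {m′} → (Fin n₁ → Subset m′) → Graph m′ → Set} {P₂ : ∀ {m′} → (Fin n₂ → Subset m′) → Graph m′ → Set} →
    (∀ {m′} {Y : Fin n₁ → Subset m′} {K} → P₁ Y K → P₂ (Y ∘ φ⁻) K) →
    ∀ {U} → QuotientInflates₁ P₁ U → QuotientInflates₂ P₂ (image U)
  quotientInflates-image reindex {U} (U⊆ , tr , m′ , Y , K , p , s , inf) =
    (proj₁ ∘ ∈image⁻) , trace-full T₂ (image U) occupied , m′ , Y ∘ φ⁻ , K , reindex p , s , record
      { s≥1      = s≥1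
      ; s∣μ      = s∣μ
      ; U        = image ∘ W
      ; ∣U∣≡s    = λ x∈ → trans (∣image∣ λ a∈ → U⊆ (W⊆U x∈ a∈)) (∣U∣≡s x∈)
      ; disjoint = λ x∈ y∈ x≢y z∈ z∈′ → disjoint x∈ y∈ x≢y (proj₂ (∈image⁻ z∈)) (proj₂ (∈image⁻ z∈′))
      ; union    = λ z → mk⇔
          (λ z∈ → let z∈V , a∈ = ∈image⁻ (p∩q⊆q (V H₂) (image U) z∈)
                      x , x∈ , a∈W = to (union (ψ⁻ z)) (x∈p∩q⁺ (ψ⁻-V z∈V , a∈))
                  in x , x∈ , ∈image⁺ z∈V a∈W)
          (λ (x , x∈ , z∈) → let z∈V , a∈ = ∈image⁻ z∈
                             in x∈p∩q⁺ (z∈V , ∈image⁺ z∈V (W⊆U x∈ a∈)))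
      ; X̃≡       = λ {w} w∈ z → mk⇔
          (λ z∈ → let z∈X , z∈U = x∈p∩q⁻ (X₂ w) (image U) z∈
                      z∈V , a∈ = ∈image⁻ z∈U
                      x , x∈ , a∈W = to (X̃≡ (φ⁻-V w∈) (ψ⁻ z)) (x∈p∩q⁺ (ψ⁻-X w∈ z∈X , a∈))
                  in x , x∈ , ∈image⁺ z∈V a∈W)
          (λ (x , x∈ , z∈) →
             let z∈V , a∈W = ∈image⁻ z∈
                 a∈X , a∈U = x∈p∩q⁻ (X₁ (φ⁻ w)) U (from (X̃≡ (φ⁻-V w∈) (ψ⁻ z)) (x , x∈ , a∈W))
             in x∈p∩q⁺ (subst₂ (λ a b → a ∈ X₂ b) (ψψ⁻ z∈V) (φφ⁻ w∈) (ψ-X (φ⁻-V w∈) a∈X) , ∈image⁺ z∈V a∈U))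
      ; between  = λ x∈ y∈ x≢y z∈ w∈ → trans (same x∈ y∈ z∈ w∈)
          (between x∈ y∈ x≢y (proj₂ (∈image⁻ z∈)) (proj₂ (∈image⁻ w∈)))
      ; within   = λ x∈ z∈ w∈ → trans (same x∈ x∈ z∈ w∈)
          (within x∈ (proj₂ (∈image⁻ z∈)) (proj₂ (∈image⁻ w∈)))
      }
    where
    open IsInflation inf renaming (U to W)
    W⊆U : ∀ {x} → x ∈ V K → W x ⊆ U
    W⊆U x∈ a∈ = p∩q⊆q (V H₁) U (from (union _) (_ , x∈ , a∈))
    occupied : ∀ {w} → w ∈ V G₂ → Nonempty (X₂ w ∩ image U)
    occupied {w} w∈ with ∈-trace⁻ T₁ U tr (φ⁻-V w∈)
    ... | x , x∈ with x∈p∩q⁻ (X₁ (φ⁻ w)) U x∈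
    ...   | x∈X , x∈U = ψ x , x∈p∩q⁺
      (subst (λ b → ψ x ∈ X₂ b) (φφ⁻ w∈) (ψ-X (φ⁻-V w∈) x∈X) , ψ∈image (X⊆V₁ (φ⁻-V w∈) x∈X) x∈U)
    same : ∀ {x y} → x ∈ V K → y ∈ V K → ∀ {z w} → z ∈ image (W x) → w ∈ image (W y) →
           μ (H₂ [ image U ]) z w ≡ μ (H₁ [ U ]) (ψ⁻ z) (ψ⁻ w)
    same x∈ y∈ z∈ w∈ with ∈image⁻ z∈ | ∈image⁻ w∈
    ... | z∈V , a∈ | w∈V , b∈ = trans
      (mask-inside (image U) (μ H₂) (∈image⁺ z∈V (W⊆U x∈ a∈)) (∈image⁺ w∈V (W⊆U y∈ b∈)))
      (trans (sym (ψ⁻-μ z∈V w∈V)) (sym (mask-inside U (μ H₁) (W⊆U x∈ a∈) (W⊆U y∈ b∈))))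

  in-image : ∀ {U w z a b} → w ∈ V G₂ → z ∈ X₂ w →
    f₁ (ψ⁻ z) * ∣ X₁ (φ⁻ w) ∩ U ∣ ≡ a → b ≡ a → f₂ z * ∣ X₂ w ∩ image U ∣ ≡ b
  in-image w∈ z∈ e e′ = trans (cong₂ _*_ (ψ⁻-f (X⊆V₂ w∈ z∈)) (∣X∩image∣ _ w∈)) (trans e (sym e′))

  out-image : ∀ {U w z} → w ∈ V G₂ → z ∈ X₂ w → z ∉ image U → ψ⁻ z ∉ U
  out-image w∈ z∈ z∉ a∈ = z∉ (∈image⁺ (X⊆V₂ w∈ z∈) a∈)

  mConfiguration : Nonseparable G₁ → IsMConfiguration T₁ → IsMConfiguration T₂
  mConfiguration ns M = record
    { uniform = uniform₂
    ; isBlock = nonseparable⇒isBlock (nonseparable-≅ G₁≅G₂ ns)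
    ; U       = image U
    ; inflate = quotientInflates-image graphCover-reindex inflate
    ; f-in    = λ v∈ x∈ x∈U → in-image v∈ x∈
        (f-in (φ⁻-V v∈) (ψ⁻-X v∈ x∈) (proj₂ (∈image⁻ x∈U))) (deg-φ⁻ v∈)
    ; f-out   = λ v∈ x∈ x∉U → trans (ψ⁻-f (X⊆V₂ v∈ x∈))
        (f-out (φ⁻-V v∈) (ψ⁻-X v∈ x∈) (out-image v∈ x∈ x∉U))
    }
    where open IsMConfiguration M

  kConfiguration : IsKConfiguration T₁ → IsKConfiguration T₂
  kConfiguration C = record
    { uniform  = uniform₂
    ; t≥1      = t≥1
    ; k≥1      = k≥1
    ; tK≅G     = ≅-trans tK≅G G₁≅G₂
    ; p≥1      = p≥1
    ; kᵢ       = kᵢ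
    ; kᵢ≥1     = kᵢ≥1
    ; sum≡     = sum≡
    ; U        = image ∘ U
    ; disjoint = λ i≢j x∈ x∈′ → disjoint i≢j (proj₂ (∈image⁻ x∈)) (proj₂ (∈image⁻ x∈′))
    ; inflate  = λ i → quotientInflates-image graphCover-reindex (inflate i)
    ; f-in     = λ v∈ x∈ i x∈U → in-image v∈ x∈
        (f-in (φ⁻-V v∈) (ψ⁻-X v∈ x∈) i (proj₂ (∈image⁻ x∈U))) refl
    ; f-out    = λ v∈ x∈ x∉U → trans (ψ⁻-f (X⊆V₂ v∈ x∈))
        (f-out (φ⁻-V v∈) (ψ⁻-X v∈ x∈) λ i → out-image v∈ x∈ (x∉U i))
    }
    where open IsKConfiguration C

  oddCConfiguration : IsOddCConfiguration T₁ → IsOddCConfiguration T₂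
  oddCConfiguration C = record
    { uniform  = uniform₂
    ; t≥1      = t≥1
    ; k≥3      = k≥3
    ; odd      = odd
    ; tC≅G     = ≅-trans tC≅G G₁≅G₂
    ; U        = image ∘ U
    ; disjoint = λ i≢j x∈ x∈′ → disjoint i≢j (proj₂ (∈image⁻ x∈)) (proj₂ (∈image⁻ x∈′))
    ; inflate  = λ i → quotientInflates-image graphCover-reindex (inflate i)
    ; f-in     = λ v∈ x∈ i x∈U → in-image v∈ x∈
        (f-in (φ⁻-V v∈) (ψ⁻-X v∈ x∈) i (proj₂ (∈image⁻ x∈U))) refl
    ; f-out    = λ v∈ x∈ x∉U → trans (ψ⁻-f (X⊆V₂ v∈ x∈))
        (f-out (φ⁻-V v∈) (ψ⁻-X v∈ x∈) λ i → out-image v∈ x∈ (x∉U i))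
    }
    where open IsOddCConfiguration C

  evenCConfiguration : IsEvenCConfiguration T₁ → IsEvenCConfiguration T₂
  evenCConfiguration C = record
    { uniform = uniform₂
    ; t≥1     = t≥1
    ; k≥4     = k≥4
    ; even    = even
    ; tC≅G    = ≅-trans tC≅G G₁≅G₂
    ; U       = image U
    ; inflate = quotientInflates-image (doubleCover-reindex tC≅G) inflate
    ; f-in    = λ v∈ x∈ x∈U → in-image v∈ x∈
        (f-in (φ⁻-V v∈) (ψ⁻-X v∈ x∈) (proj₂ (∈image⁻ x∈U))) refl
    ; f-out   = λ v∈ x∈ x∉U → trans (ψ⁻-f (X⊆V₂ v∈ x∈))
        (f-out (φ⁻-V v∈) (ψ⁻-X v∈ x∈) (out-image v∈ x∈ x∉U))
    }
    where open IsEvenCConfiguration C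

  blockConfiguration : IsBlockConfiguration T₁ → IsBlockConfiguration T₂
  blockConfiguration (inj₁ M)               =
    inj₁ (mConfiguration (_IsBlockOf_.nonsep (proj₁ (IsMConfiguration.isBlock M))) M)
  blockConfiguration (inj₂ (inj₁ K))        = inj₂ (inj₁ (kConfiguration K))
  blockConfiguration (inj₂ (inj₂ (inj₁ C))) = inj₂ (inj₂ (inj₁ (oddCConfiguration C)))
  blockConfiguration (inj₂ (inj₂ (inj₂ C))) = inj₂ (inj₂ (inj₂ (evenCConfiguration C)))

-- Propagation of f along the edges of a block

∈⇒∣∣>0 : ∀ {x} {S : Subset n} → x ∈ S → 0 < ∣ S ∣
∈⇒∣∣>0 {x = x} {S} x∈ = subst (_≤ ∣ S ∣) (∣⁅x⁆∣≡1 x)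
  (p⊆q⇒∣p∣≤∣q∣ λ y∈ → subst (_∈ S) (sym (x∈⁅y⁆⇒x≡y x y∈)) x∈)

∣∣>0⇒nonempty : (S : Subset n) → 0 < ∣ S ∣ → Nonempty S
∣∣>0⇒nonempty {n} S p with nonempty? S
... | yes ne = ne
... | no ¬ne = ⊥-elim (<-irrefl (sym (trans (cong ∣_∣ (Empty-unique ¬ne)) (∣⊥∣≡0 n))) p)

module _ {G : Graph n} {X : Fin n → Subset m} {H : Graph m} (cover : IsCover G X H) where
  open IsCover cover

  -- Each of the μ(u,v) matchings contains at most one edge from y to `X v`; summing first over the
  -- vertices of `X v` bounds every matching by 1.
  neighbours-≤ : ∀ {u v y} → u ∈ V G → v ∈ V G → u ≢ v → y ∈ X u →
                 sum (λ x → when (x ∈? X v) (μ H y x)) ≤ μ G u v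
  neighbours-≤ {u} {v} {y} u∈ v∈ u≢v y∈ with matchings u∈ v∈ u≢v
  ... | M , isMatching , μ≡ = begin
    sum (λ x → when (x ∈? X v) (μ H y x))  ≡⟨ sum-cong-≗ (λ x → expand x (x ∈? X v)) ⟩
    sum (λ x → sum (λ j → when′ j x))      ≡⟨ ∑-comm (λ x j → when′ j x) ⟩
    sum (λ j → sum (λ x → when′ j x))      ≤⟨ sum-≤ _ _ one ⟩
    sum {μ G u v} (λ _ → 1)                ≡⟨ sum-one (μ G u v) ⟩
    μ G u v                                ∎
    where
    open ≤-Reasoning
    when′ : Fin (μ G u v) → Fin _ → ℕ
    when′ j x = if does (x ∈? X v) ∧ M j y x then 1 else 0
    expand : ∀ x (d : Dec (x ∈ X v)) → when d (μ H y x) ≡ sum (λ j → if does d ∧ M j y x then 1 else 0)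
    expand x (yes x∈) = μ≡ y∈ x∈
    expand x (no _)   = sym (sum-zero {μ G u v} _ λ _ → refl)
    ∧-true : ∀ {x b} (d : Dec (x ∈ X v)) → does d ∧ b ≡ true → x ∈ X v × b ≡ true
    ∧-true (yes x∈) e = x∈ , e
    one : ∀ j → sum (when′ j) ≤ 1
    one j = sum-atMostOne _ λ {x} {x′} p q →
      let x∈ , e = ∧-true (x ∈? X v) p
          x′∈ , e′ = ∧-true (x′ ∈? X v) q
      in proj₁ (isMatching j) y∈ x∈ x′∈ e e′

  -- μ G u v matchings give y at most μ G u v edges to X v, all of which W already uses up.
  saturated : ∀ {u v y W q} → u ∈ V G → v ∈ V G → u ≢ v → y ∈ X u → W ⊆ X v →
              (∀ {w} → w ∈ W → μ H y w ≡ q) → q * ∣ W ∣ ≡ μ G u v →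
              ∀ {x} → x ∈ X v → 0 < μ H y x → x ∈ W
  saturated {u} {v} {y} {W} {q} u∈ v∈ u≢v y∈ W⊆ μ≡q total {x} x∈ pos with x ∈? W
  ... | yes x∈W = x∈W
  ... | no x∉W  = ⊥-elim (1+n≰n (begin
    suc (μ G u v)                                      ≡⟨ cong suc total ⟨
    suc (q * ∣ W ∣)                                    ≡⟨ cong suc (*-comm q ∣ W ∣) ⟩
    suc (∣ W ∣ * q)                                    ≡⟨ +-comm 1 _ ⟩
    ∣ W ∣ * q + 1                                      ≡⟨ cong₂ _+_ (sum-const-on W q) single ⟨
    sum (λ z → when (z ∈? W) q) + sum (λ z → when (z ≟ᶠ x) 1)
      ≡⟨ ∑-distrib-+ (λ z → when (z ∈? W) q) _ ⟨
    sum (λ z → when (z ∈? W) q + when (z ≟ᶠ x) 1)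
      ≤⟨ sum-≤ _ _ (λ z → below z (z ∈? W) (z ≟ᶠ x)) ⟩
    sum (λ z → when (z ∈? X v) (μ H y z))              ≤⟨ neighbours-≤ u∈ v∈ u≢v y∈ ⟩
    μ G u v                                            ∎))
    where
    open ≤-Reasoning
    single : sum (λ z → when (z ≟ᶠ x) 1) ≡ 1
    single = trans (sum-single _ x λ z → when-no (z ≟ᶠ x)) (when-yes (x ≟ᶠ x) refl)
    below : ∀ z (d : Dec (z ∈ W)) (e : Dec (z ≡ x)) → when d q + when e 1 ≤ when (z ∈? X v) (μ H y z)
    below z (yes z∈) (yes refl) = ⊥-elim (x∉W z∈)
    below z (yes z∈) (no _)     = ≤-reflexive (trans (+-identityʳ q)
      (trans (sym (μ≡q z∈)) (sym (when-yes (z ∈? X v) (W⊆ z∈)))))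
    below z (no _) (yes refl)   = ≤-trans pos (≤-reflexive (sym (when-yes (z ∈? X v) x∈)))
    below z (no _) (no _)       = z≤n

-- Supports that exhaust the edges between neighbouring fibres

module _ (T : Tuple n m) where
  open Tuple T

  -- What an inflated G-cover and an inflated double G-cover have in common. A vertex of `U` over v
  -- sends all its μ(v,u) possible edges into `U` over u. They go to one inflation class `W`, with
  -- constant multiplicity; `W` is all of the support over u for a G-cover but only half of it for a
  -- double cover, hence the existential.
  record Spread (U : Subset m) : Set where
    field
      card-≡ : ∀ {u v} → u ∈ V G → v ∈ V G → ∣ X u ∩ U ∣ ≡ ∣ X v ∩ U ∣
      star   : ∀ {u v x} → Adjacent G v u → x ∈ X v → x ∈ U →
               ∃[ W ] ∃[ q ] (W ⊆ X u × W ⊆ U × (∀ {w} → w ∈ W → μ H x w ≡ q) × q * ∣ W ∣ ≡ μ G v u)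

  module _ (cover : IsCover G X H) {U : Subset m} (spread : Spread U) where
    open Spread spread

    spread-forth : ∀ {u v x} → Adjacent G u v → x ∈ X v → x ∈ U → ∃[ y ] (y ∈ X u × y ∈ U × 0 < μ H x y)
    spread-forth {u} {v} {x} adj x∈ x∈U with star (adjacent-sym G adj) x∈ x∈U
    ... | W , q , W⊆X , W⊆U , μ≡q , total = pick (n≢0⇒n>0 q≢0) (∣∣>0⇒nonempty W (n≢0⇒n>0 W≢0))
      where
      positive : 0 < q * ∣ W ∣
      positive = subst (0 <_) (sym total) (adjacent-sym G adj)
      q≢0 : q ≢ 0
      q≢0 e = <-irrefl (sym (cong (_* ∣ W ∣) e)) positive
      W≢0 : ∣ W ∣ ≢ 0
      W≢0 e = <-irrefl (sym (trans (cong (q *_) e) (*-zeroʳ q))) positive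
      pick : 0 < q → Nonempty W → ∃[ y ] (y ∈ X u × y ∈ U × 0 < μ H x y)
      pick q>0 (w , w∈) = w , W⊆X w∈ , W⊆U w∈ , subst (0 <_) (sym (μ≡q w∈)) q>0

    -- The edges from y into `X v` are already used up by a subset of `U`, so the neighbour x must
    -- belong to that subset. Thus membership in `U` can be read off from the edges.
    spread-back : ∀ {u v x y} → Adjacent G u v → x ∈ X v → y ∈ X u → y ∈ U → 0 < μ H x y → x ∈ U
    spread-back {x = x} {y} adj x∈ y∈ y∈U pos with star adj y∈ y∈U
    ... | W , q , W⊆X , W⊆U , μ≡q , total =
      W⊆U (saturated cover (μ-supp G _ _ adj) (μ-supp₂ G adj) (adjacent⇒≢ G adj) y∈ W⊆X μ≡q total x∈
        (subst (0 <_) (μ-sym H x y) pos))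

  module _ {m′} {Y : Fin n → Subset m′} {K : Graph m′} {s U}
           (inf : IsInflation s G Y K (λ v → X v ∩ U) (H [ U ])) where
    open IsInflation inf renaming (U to W)

    class⊆U : ∀ {a} → a ∈ V K → W a ⊆ U
    class⊆U a∈ z∈ = p∩q⊆q (V H) U (from (union _) (_ , a∈ , z∈))

    class⊆X : ∀ {a v} → v ∈ V G → a ∈ Y v → W a ⊆ X v
    class⊆X v∈ a∈ z∈ = p∩q⊆p _ U (from (X̃≡ v∈ _) (_ , a∈ , z∈))

    class-μ : ∀ {a b} → a ∈ V K → b ∈ V K → a ≢ b → ∀ {z w} → z ∈ W a → w ∈ W b →
              μ H z w ≡ quotient (s∣μ a b)
    class-μ a∈ b∈ a≢b z∈ w∈ = trans
      (sym (mask-inside U (μ H) (class⊆U a∈ z∈) (class⊆U b∈ w∈))) (between a∈ b∈ a≢b z∈ w∈)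

    class-total : ∀ {a b} → b ∈ V K → quotient (s∣μ a b) * ∣ W b ∣ ≡ μ K a b
    class-total {a} {b} b∈ = trans (cong (quotient (s∣μ a b) *_) (∣U∣≡s b∈)) (sym (_∣_.equality (s∣μ a b)))

  -- `W` is the class replacing `x u`: its s vertices are joined to z with multiplicity μ(v,u)/s
  -- each, which adds up to μ(v,u).
  graphCover-spread : ∀ {U} → QuotientInflates (IsGraphCover G) U → Spread U
  graphCover-spread {U} (_ , _ , m′ , Y , K , gc , s , inf) = record
    { card-≡ = λ u∈ v∈ → trans (size u∈) (sym (size v∈))
    ; star   = λ {u} {v} {z} adj z∈ z∈U →
        let u∈ = μ-supp₂ G adj
            v∈ = μ-supp G _ _ adj
            v≢u = adjacent⇒≢ G adj
            a , a∈ , z∈W = to (X̃≡ v∈ z) (x∈p∩q⁺ (z∈ , z∈U))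
        in W (x u) , quotient (s∣μ (x v) (x u)) , class⊆X inf u∈ (xY u∈) , class⊆U inf (xV u∈) ,
           class-μ inf (xV v∈) (xV u∈) (x-apart v∈ u∈ v≢u)
             (subst (λ b → z ∈ W b) (only v∈ a∈) z∈W) ,
           trans (class-total inf (xV u∈)) (μ≡ v∈ u∈ v≢u)
    }
    where
    open IsInflation inf using (X̃≡; s∣μ; ∣U∣≡s) renaming (U to W)
    open IsGraphCover gc
    xY : ∀ {v} → v ∈ V G → x v ∈ Y v
    xY {v} v∈ = subst (x v ∈_) (sym (X≡ v∈)) (x∈⁅x⁆ (x v))
    xV : ∀ {v} → v ∈ V G → x v ∈ V K
    xV v∈ = from (IsCover.union cover _) (_ , v∈ , xY v∈)
    only : ∀ {v a} → v ∈ V G → a ∈ Y v → a ≡ x v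
    only {v} {a} v∈ a∈ = x∈⁅y⁆⇒x≡y (x v) (subst (a ∈_) (X≡ v∈) a∈)
    x-apart : ∀ {u v} → u ∈ V G → v ∈ V G → u ≢ v → x u ≢ x v
    x-apart u∈ v∈ u≢v e = IsCover.disjoint cover u∈ v∈ u≢v (xY u∈) (subst (_∈ Y _) (sym e) (xY v∈))
    size : ∀ {v} → v ∈ V G → ∣ X v ∩ U ∣ ≡ s
    size {v} v∈ = trans (cong ∣_∣ (⊆-antisym
      (λ z∈ → let a , a∈ , z∈W = to (X̃≡ v∈ _) z∈ in subst (λ b → _ ∈ W b) (only v∈ a∈) z∈W)
      (λ z∈ → from (X̃≡ v∈ _) (x v , xY v∈ , z∈)))) (∣U∣≡s (xV v∈))

-- The cycle of length 2k winding twice around the cycle of length k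

-- The covering projection: the two positions above i are i on the lower sheet and k + i on the
-- upper one.
Over : ∀ {k} → Fin (k + k) → Fin k → Set
Over {k} a i = a ≡ i ↑ˡ k ⊎ a ≡ k ↑ʳ i

module _ {k : ℕ} {i j : Fin k} where
  private
    low : (i : Fin k) → toℕ (i ↑ˡ k) ≡ toℕ i
    low i = toℕ-↑ˡ i k
    high : (i : Fin k) → toℕ (k ↑ʳ i) ≡ k + toℕ i
    high i = toℕ-↑ʳ k i

    low-low : toℕ j ≡ suc (toℕ i) → Next (i ↑ˡ k) (j ↑ˡ k)
    low-low e = inj₁ (trans (low j) (trans e (cong suc (sym (low i)))))
    high-high : toℕ j ≡ suc (toℕ i) → Next (k ↑ʳ i) (k ↑ʳ j)
    high-high e = inj₁ (trans (high j) (trans (cong (k +_) e) (trans (+-suc k _) (cong suc (sym (high i))))))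
    low-high : suc (toℕ i) ≡ k × toℕ j ≡ 0 → Next (i ↑ˡ k) (k ↑ʳ j)
    low-high (e , e₀) = inj₁ (trans (high j) (trans (cong (k +_) e₀) (trans (+-identityʳ k)
      (trans (sym e) (cong suc (sym (low i)))))))
    high-low : suc (toℕ i) ≡ k × toℕ j ≡ 0 → Next (k ↑ʳ i) (j ↑ˡ k)
    high-low (e , e₀) = inj₂ (trans (cong suc (high i)) (trans (sym (+-suc k _)) (cong (k +_) e)) , trans (low j) e₀)

  -- A step within the range keeps the sheet, while the closing step from k - 1 to 0 changes it; so
  -- every edge of the short cycle lifts from either endpoint above it.
  next-over : ∀ {a} → Next i j → Over a i → ∃[ b ] (Over b j × Next a b)
  next-over (inj₁ e) (inj₁ refl) = _ , inj₁ refl , low-low e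
  next-over (inj₁ e) (inj₂ refl) = _ , inj₂ refl , high-high e
  next-over (inj₂ e) (inj₁ refl) = _ , inj₂ refl , low-high e
  next-over (inj₂ e) (inj₂ refl) = _ , inj₁ refl , high-low e

  previous-over : ∀ {b} → Next i j → Over b j → ∃[ a ] (Over a i × Next a b)
  previous-over (inj₁ e) (inj₁ refl) = _ , inj₁ refl , low-low e
  previous-over (inj₁ e) (inj₂ refl) = _ , inj₂ refl , high-high e
  previous-over (inj₂ e) (inj₁ refl) = _ , inj₂ refl , high-low e
  previous-over (inj₂ e) (inj₂ refl) = _ , inj₁ refl , low-high e

consecutive-irrefl : ∀ {k} → 3 ≤ k → {i : Fin (k + k)} → ¬ (Next i i ⊎ Next i i)
consecutive-irrefl {k} k≥3 {i} c = <-irrefl refl (subst (0 <_) (μ-loop C i) (≤-reflexive (sym (cycleμ-adjacent c))))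
  where
  C : Graph (k + k)
  C = cycle (k + k) (≤-trans k≥3 (m≤m+n k k))

consecutive-over : ∀ {k} {i j : Fin k} {a} → Next i j ⊎ Next j i → Over a i →
                   ∃[ b ] (Over b j × (Next a b ⊎ Next b a))
consecutive-over (inj₁ p) o with next-over p o
... | b , o′ , q = b , o′ , inj₁ q
consecutive-over (inj₂ p) o with previous-over p o
... | b , o′ , q = b , o′ , inj₂ q

module _ (T : Tuple n m) where
  open Tuple T

  -- If z lies in the class of `x a` with `a` over i, the edge ij lifts to some `b` over j, and the
  -- class of `x b` alone receives t edges from z, which is the whole of μ(v i, v j). Each fibre of
  -- the support consists of two classes, one per sheet.
  doubleCover-spread : ∀ {t k k≥3} (tC≅G : t · cycle k k≥3 ≅ G) {U} →
                       QuotientInflates (IsDoubleCover t k k≥3 G tC≅G) U → Spread T U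
  doubleCover-spread {t} {k} {k≥3} tC≅G {U} (_ , _ , m′ , Y , K , dc , s , inf) = record
    { card-≡ = λ u∈ v∈ → trans (size u∈) (sym (size v∈))
    ; star   = λ adj z∈ z∈U → star adj (surjective (μ-supp₂ G adj)) (surjective (μ-supp G _ _ adj)) z∈ z∈U
    }
    where
    open IsInflation inf using (X̃≡; s∣μ; ∣U∣≡s; disjoint) renaming (U to W)
    open IsDoubleCover dc
    open _≅_ tC≅G using (surjective; to-V; to-μ) renaming (to to v)
    xY : ∀ {a i} → Over a i → x a ∈ Y (v i)
    xY {a} {i} o = subst (x a ∈_) (sym (X≡ i)) (x∈p∪q⁺ (side o))
      where
      side : Over a i → x a ∈ ⁅ x (i ↑ˡ k) ⁆ ⊎ x a ∈ ⁅ x (k ↑ʳ i) ⁆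
      side (inj₁ refl) = inj₁ (x∈⁅x⁆ _)
      side (inj₂ refl) = inj₂ (x∈⁅x⁆ _)
    xV : ∀ {a i} → Over a i → x a ∈ V K
    xV o = from (IsCover.union cover _) (_ , to-V ∈⊤ , xY o)
    over : ∀ {i b} → b ∈ Y (v i) → ∃[ a ] (Over a i × b ≡ x a)
    over {i} {b} b∈ with x∈p∪q⁻ ⁅ x (i ↑ˡ k) ⁆ _ (subst (b ∈_) (X≡ i) b∈)
    ... | inj₁ p = _ , inj₁ refl , x∈⁅y⁆⇒x≡y _ p
    ... | inj₂ p = _ , inj₂ refl , x∈⁅y⁆⇒x≡y _ p
    class : ∀ {i z} → z ∈ X (v i) ∩ U → ∃[ a ] (Over a i × z ∈ W (x a))
    class {i} z∈ with to (X̃≡ (to-V ∈⊤) _) z∈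
    ... | b , b∈ , z∈W with over b∈
    ...   | a , o , refl = a , o , z∈W
    low≢high : ∀ i → i ↑ˡ k ≢ k ↑ʳ i
    low≢high i e = <-irrefl (trans (sym (toℕ-↑ˡ i k)) (trans (cong toℕ e) (toℕ-↑ʳ k i)))
      (<-≤-trans (toℕ<n i) (m≤m+n k (toℕ i)))
    size : ∀ {w} → w ∈ V G → ∣ X w ∩ U ∣ ≡ s + s
    size w∈ with surjective w∈
    ... | i , _ , refl = trans (cong ∣_∣ (⊆-antisym ⊆₁ ⊆₂)) (trans
        (card-∪ (W (x (i ↑ˡ k))) (W (x (k ↑ʳ i)))
          (disjoint (xV {i = i} (inj₁ refl)) (xV {i = i} (inj₂ refl)) (low≢high i ∘ injective)))
        (cong₂ _+_ (∣U∣≡s (xV {i = i} (inj₁ refl))) (∣U∣≡s (xV {i = i} (inj₂ refl)))))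
      where
      ⊆₁ : X (v i) ∩ U ⊆ W (x (i ↑ˡ k)) ∪ W (x (k ↑ʳ i))
      ⊆₁ z∈ with class z∈
      ... | _ , inj₁ refl , z∈W = x∈p∪q⁺ (inj₁ z∈W)
      ... | _ , inj₂ refl , z∈W = x∈p∪q⁺ (inj₂ z∈W)
      ⊆₂ : W (x (i ↑ˡ k)) ∪ W (x (k ↑ʳ i)) ⊆ X (v i) ∩ U
      ⊆₂ z∈ with x∈p∪q⁻ (W (x (i ↑ˡ k))) _ z∈
      ... | inj₁ p = from (X̃≡ (to-V ∈⊤) _) (_ , xY (inj₁ refl) , p)
      ... | inj₂ p = from (X̃≡ (to-V ∈⊤) _) (_ , xY (inj₂ refl) , p)
    t*-positive : ∀ {i j} → 0 < t * cycleμ {k} i j → 0 < cycleμ i j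
    t*-positive {i} {j} p with cycleμ i j
    ... | zero  = ⊥-elim (<-irrefl (sym (*-zeroʳ t)) p)
    ... | suc _ = s≤s z≤n
    star : ∀ {u w z} → Adjacent G w u → ∃[ j ] (j ∈ _ × v j ≡ u) → ∃[ i ] (i ∈ _ × v i ≡ w) →
           z ∈ X w → z ∈ U →
           ∃[ S ] ∃[ q ] (S ⊆ X u × S ⊆ U × (∀ {y} → y ∈ S → μ H z y ≡ q) × q * ∣ S ∣ ≡ μ G w u)
    star {z = z} adj (j , _ , refl) (i , _ , refl) z∈ z∈U with class (x∈p∩q⁺ (z∈ , z∈U))
    ... | a , o , z∈W with cycleμ-positive (t*-positive {i} {j} (subst (0 <_) (to-μ ∈⊤ ∈⊤) adj))
    ...   | ij with consecutive-over ij o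
    ...     | b , o′ , c = W (x b) , quotient (s∣μ (x a) (x b)) ,
      class⊆X T inf (to-V ∈⊤) (xY o′) , class⊆U T inf (xV o′) ,
      class-μ T inf (xV o) (xV o′) xa≢xb z∈W ,
      trans (class-total T inf (xV o′)) (trans (μ≡ a b) (trans (cong (t *_) (cycleμ-adjacent c))
        (sym (trans (to-μ ∈⊤ ∈⊤) (cong (t *_) (cycleμ-adjacent ij))))))
      where
      xa≢xb : x a ≢ x b
      xa≢xb e with injective e
      ... | refl = consecutive-irrefl k≥3 c

  -- The values of f on X u determine those on X v for every edge uv, and f = 0 if there is no edge.
  record Propagates : Set where
    field
      isolated : (∀ {u v} → u ∈ V G → v ∈ V G → u ≡ v) → ∀ {v x} → v ∈ V G → x ∈ X v → f x ≡ 0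
      vanish   : ∀ {u v x} → Adjacent G u v → x ∈ X v →
                 (∀ {y} → y ∈ X u → 0 < μ H x y → f y ≡ 0) → f x ≡ 0
      transfer : ∀ {u v x y} → Adjacent G u v → x ∈ X v → y ∈ X u → 0 < μ H x y → 0 < f y →
                 f x * deg G u ≡ f y * deg G v

  -- a i v is the total weight that f places on X v ∩ U i.
  module _ (cover : IsCover G X H) {p} (U : Fin p → Subset m) (a : Fin p → Fin n → ℕ)
    (spread : ∀ i → Spread T (U i))
    (a-positive : ∀ {i u v} → Adjacent G u v → 0 < a i u)
    (a-balanced : ∀ {i u v} → Adjacent G u v → a i v * deg G u ≡ a i u * deg G v)
    (f-in  : ∀ {v x} → v ∈ V G → x ∈ X v → ∀ i → x ∈ U i → f x * ∣ X v ∩ U i ∣ ≡ a i v)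
    (f-out : ∀ {v x} → v ∈ V G → x ∈ X v → (∀ i → x ∉ U i) → f x ≡ 0)
    (isolated : (∀ {u v} → u ∈ V G → v ∈ V G → u ≡ v) → ∀ {v x} → v ∈ V G → x ∈ X v → f x ≡ 0) where

    -- Neighbouring support vertices x and y lie in the same `U i`, which has equally many elements
    -- c over u and over v. So c f(x) d(u) and c f(y) d(v) are `a i v` d(u) and `a i u` d(v), which
    -- are equal by balance, and c is positive because x itself is counted.
    weighted-propagates : Propagates
    weighted-propagates = record { isolated = isolated ; vanish = vanish ; transfer = transfer }
      where
      vanish : ∀ {u v x} → Adjacent G u v → x ∈ X v → (∀ {y} → y ∈ X u → 0 < μ H x y → f y ≡ 0) → f x ≡ 0
      vanish {u} {v} {x} adj x∈ none = f-out (μ-supp₂ G adj) x∈ λ i x∈U →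
        let y , y∈ , y∈U , pos = spread-forth T cover (spread i) adj x∈ x∈U
        in <-irrefl (trans (cong (_* ∣ X u ∩ U i ∣) (sym (none y∈ pos))) (f-in (μ-supp G _ _ adj) y∈ i y∈U))
             (a-positive adj)
      transfer : ∀ {u v x y} → Adjacent G u v → x ∈ X v → y ∈ X u → 0 < μ H x y → 0 < f y →
                 f x * deg G u ≡ f y * deg G v
      transfer {u} {v} {x} {y} adj x∈ y∈ pos fy>0 with any? (λ i → y ∈? U i)
      ... | no ∉         = ⊥-elim (<-irrefl (sym (f-out (μ-supp G _ _ adj) y∈ λ i y∈U → ∉ (i , y∈U))) fy>0)
      ... | yes (i , y∈U) = *-cancelˡ-≡ _ _ c {{>-nonZero (∈⇒∣∣>0 (x∈p∩q⁺ (x∈ , x∈U)))}} (begin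
        c * (f x * deg G u)   ≡⟨ *-assoc c (f x) _ ⟨
        c * f x * deg G u     ≡⟨ cong (_* deg G u) (trans (*-comm c (f x)) (f-in (μ-supp₂ G adj) x∈ i x∈U)) ⟩
        a i v * deg G u       ≡⟨ a-balanced adj ⟩
        a i u * deg G v       ≡⟨ cong (_* deg G v) (trans (*-comm c (f y)) (trans (cong (f y *_) c≡) (f-in (μ-supp G _ _ adj) y∈ i y∈U))) ⟨
        c * f y * deg G v     ≡⟨ *-assoc c (f y) _ ⟩
        c * (f y * deg G v)   ∎)
        where
        open ≡-Reasoning
        c : ℕ
        c = ∣ X v ∩ U i ∣
        c≡ : c ≡ ∣ X u ∩ U i ∣
        c≡ = Spread.card-≡ (spread i) (μ-supp₂ G adj) (μ-supp G _ _ adj)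
        x∈U : x ∈ U i
        x∈U = spread-back T cover (spread i) adj x∈ y∈ y∈U pos

  several-vertices : ∀ {k} {K : Graph k} → (∀ i → i ∈ V K) → 2 ≤ k → K ≅ G →
                     ¬ (∀ {u v} → u ∈ V G → v ∈ V G → u ≡ v)
  several-vertices {suc (suc k)} full _ iso all≡ =
    0≢1+n (cong toℕ (injective (full zero) (full (suc zero)) (all≡ (to-V (full zero)) (to-V (full (suc zero))))))
    where open _≅_ iso
  several-vertices {suc zero} _ (s≤s ())

  regular : ∀ {k} {K : Graph k} → K ≅ G → (∀ i j → deg K i ≡ deg K j) →
            ∀ {u v} → u ∈ V G → v ∈ V G → deg G u ≡ deg G v
  regular iso reg u∈ v∈ with _≅_.surjective iso u∈ | _≅_.surjective iso v∈
  ... | i , i∈ , refl | j , j∈ , refl = trans (deg-≅ iso i∈) (trans (reg i j) (sym (deg-≅ iso j∈)))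

  constant-balanced : (∀ {u v} → u ∈ V G → v ∈ V G → deg G u ≡ deg G v) →
                      ∀ {u v} c → Adjacent G u v → c * deg G u ≡ c * deg G v
  constant-balanced reg c adj = cong (c *_) (reg (μ-supp G _ _ adj) (μ-supp₂ G adj))

  -- With weight d(v) over v the balance condition is commutativity of multiplication. On a single
  -- vertex the degree is 0, which forces f = 0.
  m-propagates : IsMConfiguration T → Propagates
  m-propagates M = weighted-propagates (proj₁ uniform) {1} (λ _ → U) (λ _ → deg G)
    (λ _ → graphCover-spread T inflate)
    (λ {_} {u} {v} adj → <-≤-trans adj (term≤sum (μ G u) v))
    (λ {_} {u} {v} _ → *-comm (deg G v) (deg G u))
    (λ v∈ x∈ _ x∈U → f-in v∈ x∈ x∈U) (λ v∈ x∈ x∉ → f-out v∈ x∈ (x∉ zero)) isolated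
    where
    open IsMConfiguration M
    isolated : (∀ {u v} → u ∈ V G → v ∈ V G → u ≡ v) → ∀ {v x} → v ∈ V G → x ∈ X v → f x ≡ 0
    isolated all≡ {v} {x} v∈ x∈ with x ∈? U
    ... | no x∉   = f-out v∈ x∈ x∉
    ... | yes x∈U with m*n≡0⇒m≡0∨n≡0 (f x) (trans (f-in v∈ x∈ x∈U) (sum-zero (μ G v) λ w →
      n≤0⇒n≡0 (support-≤ λ adj → ⊥-elim (adjacent⇒≢ G adj (all≡ v∈ (μ-supp₂ G adj))))))
    ...   | inj₁ e = e
    ...   | inj₂ e = ⊥-elim (<-irrefl (sym e) (∈⇒∣∣>0 (x∈p∩q⁺ (x∈ , x∈U))))

  -- Since p and all n_i are at least 1, n = 1 + n_1 + ... + n_p is at least 2, so the one-vertex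
  -- case is void. Balance is regularity of tK_n.
  k-propagates : IsKConfiguration T → Propagates
  k-propagates C = weighted-propagates (proj₁ uniform) U (λ i _ → t * kᵢ i)
    (λ i → graphCover-spread T (inflate i)) (λ {i} _ → 0<* t≥1 (kᵢ≥1 i))
    (λ {i} → constant-balanced (regular tK≅G (complete-regular t)) (t * kᵢ i)) f-in f-out
    (λ all≡ → ⊥-elim (several-vertices (λ _ → ∈⊤) (k≥2 p≥1 kᵢ kᵢ≥1 sum≡) tK≅G all≡))
    where
    open IsKConfiguration C
    k≥2 : ∀ {p k} → 1 ≤ p → (kᵢ : Fin p → ℕ) → (∀ i → 1 ≤ kᵢ i) → sum kᵢ + 1 ≡ k → 2 ≤ k
    k≥2 {suc p} _ kᵢ kᵢ≥1 refl = +-monoˡ-≤ 1 (≤-trans (kᵢ≥1 zero) (term≤sum kᵢ zero))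

  oddC-propagates : IsOddCConfiguration T → Propagates
  oddC-propagates C = weighted-propagates (proj₁ uniform) U (λ _ _ → t)
    (λ i → graphCover-spread T (inflate i)) (λ _ → t≥1)
    (constant-balanced (regular tC≅G (cycle-regular t k≥3)) t) f-in f-out
    (λ all≡ → ⊥-elim (several-vertices (λ _ → ∈⊤) (≤-trans (n≤1+n 2) k≥3) tC≅G all≡))
    where open IsOddCConfiguration C

  evenC-propagates : IsEvenCConfiguration T → Propagates
  evenC-propagates C = weighted-propagates (proj₁ uniform) {1} (λ _ → U) (λ _ _ → 2 * t)
    (λ _ → doubleCover-spread tC≅G inflate) (λ _ → 0<* {2} (s≤s z≤n) t≥1)
    (constant-balanced (regular tC≅G (cycle-regular t k≥3)) (2 * t))
    (λ v∈ x∈ _ x∈U → f-in v∈ x∈ x∈U) (λ v∈ x∈ x∉ → f-out v∈ x∈ (x∉ zero))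
    (λ all≡ → ⊥-elim (several-vertices (λ _ → ∈⊤) (≤-trans (n≤1+n 2) k≥3) tC≅G all≡))
    where open IsEvenCConfiguration C

  propagates : IsBlockConfiguration T → Propagates
  propagates (inj₁ M)               = m-propagates M
  propagates (inj₂ (inj₁ K))        = k-propagates K
  propagates (inj₂ (inj₂ (inj₁ C))) = oddC-propagates C
  propagates (inj₂ (inj₂ (inj₂ C))) = evenC-propagates C

-- Trees of nonseparable pieces

-- Having at least two elements, phrased as it is used: some element avoids any prescribed cut
-- vertex.
Many : Subset n → Set
Many S = ∀ w → ∃[ a ] (a ∈ S × a ≢ w)

-- The index is the set of vertices covered so far, so that both halves of a `node` stay inside the
-- same graph G. Both halves having two vertices keeps a piece from being swallowed by a piece on
-- the other side.
data Decomp (G : Graph n) : Subset n → Set where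
  leaf : ∀ {S} → S ⊆ V G → Nonseparable (G [ S ]) → Decomp G S
  node : ∀ {S₁ S₂} → Decomp G S₁ → Decomp G S₂ → Many S₁ → Many S₂ →
         ∀ v → v ∈ S₁ → v ∈ S₂ → (∀ {w} → w ∈ S₁ → w ∈ S₂ → w ≡ v) →
         (∀ {a b} → a ∈ S₁ → b ∈ S₂ → a ≢ v → b ≢ v → μ G a b ≡ 0) →
         Decomp G (S₁ ∪ S₂)

⊈-witness : {A B : Subset n} → ¬ (A ⊆ B) → ∃[ a ] (a ∈ A × a ∉ B)
⊈-witness {A = A} {B} A⊈B with any? (λ a → (a ∈? A) ×-dec ¬? (a ∈? B))
... | yes w = w
... | no ¬w = ⊥-elim (A⊈B λ {a} a∈ → decidable-stable (a ∈? B) λ a∉ → ¬w (a , a∈ , a∉))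

module _ {G : Graph n} where

  pieces : ∀ {S} → Decomp G S → ℕ
  pieces (leaf _ _)                 = 1
  pieces (node d₁ d₂ _ _ _ _ _ _ _) = pieces d₁ + pieces d₂

  piece   : ∀ {S} (d : Decomp G S) → Fin (pieces d) → Subset n
  -- Separate from `piece`, so that the index equations involve the two subtrees only and not the
  -- data at the cut vertex.
  pieceOf : ∀ {S₁ S₂} (d₁ : Decomp G S₁) (d₂ : Decomp G S₂) → Fin (pieces d₁ + pieces d₂) → Subset n

  piece (leaf {S} _ _)              _ = S
  piece (node d₁ d₂ _ _ _ _ _ _ _) i = pieceOf d₁ d₂ i

  pieceOf d₁ d₂ i = [ piece d₁ , piece d₂ ]′ (splitAt (pieces d₁) i)

  decomp-nonempty : ∀ {S} → Decomp G S → Nonempty S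
  decomp-nonempty (leaf {S} S⊆ (((v , v∈) , _) , _)) = v , subst (v ∈_) (Enumerate.V-induced G S⊆) v∈
  decomp-nonempty (node _ _ _ _ v v∈ _ _ _) = v , x∈p∪q⁺ (inj₁ v∈)

  module _ {S₁ S₂} (d₁ : Decomp G S₁) (d₂ : Decomp G S₂) where

    piece-ˡ : ∀ i → pieceOf d₁ d₂ (i ↑ˡ pieces d₂) ≡ piece d₁ i
    piece-ˡ i = cong [ piece d₁ , piece d₂ ]′ (splitAt-↑ˡ (pieces d₁) i (pieces d₂))

    piece-ʳ : ∀ i → pieceOf d₁ d₂ (pieces d₁ ↑ʳ i) ≡ piece d₂ i
    piece-ʳ i = cong [ piece d₁ , piece d₂ ]′ (splitAt-↑ʳ (pieces d₁) (pieces d₂) i)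

  decomp⊆V : ∀ {S} → Decomp G S → S ⊆ V G
  decomp⊆V (leaf S⊆ _) = S⊆
  decomp⊆V (node {S₁} {S₂} d₁ d₂ _ _ _ _ _ _ _) w∈ with x∈p∪q⁻ S₁ S₂ w∈
  ... | inj₁ w∈₁ = decomp⊆V d₁ w∈₁
  ... | inj₂ w∈₂ = decomp⊆V d₂ w∈₂

  piece⊆ : ∀ {S} (d : Decomp G S) i → piece d i ⊆ S
  piece⊆ (leaf _ _) _ w∈ = w∈
  piece⊆ d@(node d₁ d₂ _ _ _ _ _ _ _) = ↑-elim (pieces d₁)
    (λ i w∈ → x∈p∪q⁺ (inj₁ (piece⊆ d₁ i (subst (_ ∈_) (piece-ˡ d₁ d₂ i) w∈))))
    (λ i w∈ → x∈p∪q⁺ (inj₂ (piece⊆ d₂ i (subst (_ ∈_) (piece-ʳ d₁ d₂ i) w∈))))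

  piece-nonseparable : ∀ {S} (d : Decomp G S) i → Nonseparable (G [ piece d i ])
  piece-nonseparable (leaf _ ns) _ = ns
  piece-nonseparable (node d₁ d₂ _ _ _ _ _ _ _) = ↑-elim (pieces d₁)
    (λ i → subst (λ A → Nonseparable (G [ A ])) (sym (piece-ˡ d₁ d₂ i)) (piece-nonseparable d₁ i))
    (λ i → subst (λ A → Nonseparable (G [ A ])) (sym (piece-ʳ d₁ d₂ i)) (piece-nonseparable d₂ i))

  piece-many : ∀ {S} (d : Decomp G S) → Many S → ∀ i → Many (piece d i)
  piece-many (leaf _ _) many _ = many
  piece-many (node d₁ d₂ many₁ many₂ _ _ _ _ _) _ = ↑-elim (pieces d₁)
    (λ i → subst Many (sym (piece-ˡ d₁ d₂ i)) (piece-many d₁ many₁ i))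
    (λ i → subst Many (sym (piece-ʳ d₁ d₂ i)) (piece-many d₂ many₂ i))

  -- Pieces from different sides can share at most the cut vertex, while every piece has a further
  -- vertex.
  piece-antichain : ∀ {S} (d : Decomp G S) i j → piece d i ⊆ piece d j → i ≡ j
  piece-antichain (leaf _ _) zero zero _ = refl
  piece-antichain (node {S₁} {S₂} d₁ d₂ many₁ many₂ v _ _ meet _) = ↑-elim (pieces d₁)
    (λ i → ↑-elim (pieces d₁)
      (λ j ⊆ → cong (_↑ˡ pieces d₂) (piece-antichain d₁ i j λ {w} w∈ →
        subst (w ∈_) (piece-ˡ d₁ d₂ j) (⊆ (subst (w ∈_) (sym (piece-ˡ d₁ d₂ i)) w∈))))
      (λ j ⊆ → let a , a∈ , a≢v = piece-many d₁ many₁ i v in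
        ⊥-elim (a≢v (meet (piece⊆ d₁ i a∈) (piece⊆ d₂ j
          (subst (a ∈_) (piece-ʳ d₁ d₂ j) (⊆ (subst (a ∈_) (sym (piece-ˡ d₁ d₂ i)) a∈))))))))
    (λ i → ↑-elim (pieces d₁)
      (λ j ⊆ → let a , a∈ , a≢v = piece-many d₂ many₂ i v in
        ⊥-elim (a≢v (meet (piece⊆ d₁ j
          (subst (a ∈_) (piece-ˡ d₁ d₂ j) (⊆ (subst (a ∈_) (sym (piece-ʳ d₁ d₂ i)) a∈)))) (piece⊆ d₂ i a∈))))
      (λ j ⊆ → cong (pieces d₁ ↑ʳ_) (piece-antichain d₂ i j λ {w} w∈ →
        subst (w ∈_) (piece-ʳ d₁ d₂ j) (⊆ (subst (w ∈_) (sym (piece-ʳ d₁ d₂ i)) w∈)))))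

  module _ {S₁ S₂ : Subset n} {v : Fin n} (v∈₁ : v ∈ S₁) (v∈₂ : v ∈ S₂)
           (no-edge : ∀ {a b} → a ∈ S₁ → b ∈ S₂ → a ≢ v → b ≢ v → μ G a b ≡ 0)
           {K : Graph n} (K⊑G : K ⊑ G) (K⊆ : V K ⊆ S₁ ∪ S₂) where

    -- A walk that avoids v cannot change sides. `L` stands for K itself when v is absent from it,
    -- and for K with v deleted otherwise.
    confined : (L : Graph n) → (∀ {a b} → Adjacent L a b → a ≢ v × b ≢ v × Adjacent K a b) →
               ∀ {a b} → Walk L a b → a ∈ S₁ → b ∈ S₁
    confined L avoid ε a∈ = a∈
    confined L avoid (_◅_ {i = a} {j = b} adj walk) a∈ with avoid adj
    ... | a≢v , b≢v , adjK = confined L avoid walk (stay (x∈p∪q⁻ S₁ S₂ (K⊆ (μ-supp₂ K adjK))))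
      where
      stay : b ∈ S₁ ⊎ b ∈ S₂ → b ∈ S₁
      stay (inj₁ b∈) = b∈
      stay (inj₂ b∈) = ⊥-elim (<-irrefl (sym (no-edge a∈ b∈ a≢v b≢v)) (<-≤-trans adjK (proj₂ K⊑G a b)))

    -- Otherwise K has a vertex a missing from `S₂` and a vertex b missing from `S₁`. If v is not in
    -- K, then K is disconnected; if it is, then v separates a from b.
    nonseparable-side : Nonseparable K → V K ⊆ S₁ ⊎ V K ⊆ S₂
    nonseparable-side ((_ , conn) , nosep) with V K ⊆? S₁ | V K ⊆? S₂
    ... | yes ⊆₁ | _      = inj₁ ⊆₁
    ... | _      | yes ⊆₂ = inj₂ ⊆₂
    ... | no ⊈₁  | no ⊈₂  with ⊈-witness ⊈₁ | ⊈-witness ⊈₂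
    ...   | b , b∈ , b∉₁ | a , a∈ , a∉₂ = ⊥-elim (by (v ∈? V K))
      where
      a∈₁ : a ∈ S₁
      a∈₁ with x∈p∪q⁻ S₁ S₂ (K⊆ a∈)
      ... | inj₁ p = p
      ... | inj₂ p = ⊥-elim (a∉₂ p)
      by : Dec (v ∈ V K) → Empty
      by (no v∉)  = b∉₁ (confined K (λ adj → (λ { refl → v∉ (μ-supp K _ _ adj) }) ,
        (λ { refl → v∉ (μ-supp₂ K adj) }) , adj) (conn a b a∈ b∈) a∈₁)
      by (yes v∈) with a ≟ᶠ v | b ≟ᶠ v
      ... | no a≢v | no b≢v = nosep v (v∈ , a , b , ∈∖⁺ K a∈ a≢v , ∈∖⁺ K b∈ b≢v , λ walk →
            b∉₁ (confined (K ∖ v) (adjacent∖⁻ K) walk a∈₁))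
      -- The cut vertex lies on both sides, so it is neither a nor b.
      ... | yes refl | _ = a∉₂ v∈₂
      ... | no _ | yes refl = b∉₁ v∈₁

  nonseparable⊆piece : ∀ {S} (d : Decomp G S) {K : Graph n} → K ⊑ G → Nonseparable K → V K ⊆ S →
                       ∃[ i ] (V K ⊆ piece d i)
  nonseparable⊆piece (leaf _ _) _ _ K⊆ = zero , K⊆
  nonseparable⊆piece (node d₁ d₂ _ _ v v∈₁ v∈₂ _ no-edge) {K} K⊑G ns K⊆
    with nonseparable-side v∈₁ v∈₂ no-edge {K} K⊑G K⊆ ns
  ... | inj₁ ⊆₁ with nonseparable⊆piece d₁ {K} K⊑G ns ⊆₁
  ...   | i , ⊆ = i ↑ˡ pieces d₂ , λ {w} w∈ → subst (w ∈_) (sym (piece-ˡ d₁ d₂ i)) (⊆ w∈)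
  nonseparable⊆piece (node d₁ d₂ _ _ v v∈₁ v∈₂ _ no-edge) {K} K⊑G ns K⊆
      | inj₂ ⊆₂ with nonseparable⊆piece d₂ {K} K⊑G ns ⊆₂
  ...   | i , ⊆ = pieces d₁ ↑ʳ i , λ {w} w∈ → subst (w ∈_) (sym (piece-ʳ d₁ d₂ i)) (⊆ w∈)

  module _ {S} (d : Decomp G S) (V⊆S : V G ⊆ S) where
    open Enumerate G

    -- A larger nonseparable set would lie in some piece j, which then contains piece i; the
    -- antichain property gives i = j.
    piece-isBlock : ∀ i → (G [ piece d i ]) IsBlockOf G
    piece-isBlock i = candidate⇒block (decomp⊆V d ∘ piece⊆ d i , piece-nonseparable d i ,
      λ (A , (A⊆ , i⊆A) , ns , A⊈) →
        let j , A⊆j = nonseparable⊆piece d {G [ A ]} (induced⊑ G A) ns (V⊆S ∘ p∩q⊆p _ A)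
            A⊆ⱼ = λ {w} (w∈ : w ∈ A) → A⊆j (subst (w ∈_) (sym (V-induced A⊆)) w∈)
        in A⊈ λ {w} w∈ → subst (λ l → w ∈ piece d l) (sym (piece-antichain d i j λ w∈ → A⊆ⱼ (i⊆A w∈))) (A⊆ⱼ w∈))

    block≡piece : ∀ {B} → B IsBlockOf G → ∃[ i ] (V B ≡ piece d i)
    block≡piece {B} isB with nonseparable⊆piece d {B} sub nonsep (V⊆S ∘ proj₁ sub)
      where open _IsBlockOf_ isB
    ... | i , B⊆i = i , ⊆-antisym B⊆i λ {w} w∈ → decidable-stable (w ∈? V B) λ w∉ →
      proj₂ (proj₂ (block⇒candidate B isB))
        (piece d i , (decomp⊆V d ∘ piece⊆ d i , B⊆i) , piece-nonseparable d i , λ ⊆ → w∉ (⊆ w∈))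

-- Uniqueness along the tree

AgreeOn : (Fin n → Subset m) → Subset n → (g g′ : Fin m → ℕ) → Set
AgreeOn X A g g′ = ∀ {v x} → v ∈ A → x ∈ X v → g x ≡ g′ x

Rigid : (Fin n → Subset m) → Subset n → (g g′ : Fin m → ℕ) → Set
Rigid X A g g′ = ∀ {r} → r ∈ A → (∀ {v x} → v ∈ A → v ≢ r → x ∈ X v → g x ≡ g′ x) → AgreeOn X A g g′

module _ {G : Graph n} (X : Fin n → Subset m) where

  total : ∀ {S} (d : Decomp G S) → (Fin (pieces d) → Fin m → ℕ) → Fin n → Fin m → ℕ
  total d F v x = sum (λ i → when (v ∈? piece d i) (F i x))

  total-outside : ∀ {S} (d : Decomp G S) F {v x} → v ∉ S → total d F v x ≡ 0
  total-outside d F v∉ = sum-zero _ λ i → when-no (_ ∈? piece d i) (v∉ ∘ piece⊆ d i)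

  total-cong : ∀ {S} (d : Decomp G S) {F F′} → (∀ i → AgreeOn X (piece d i) (F i) (F′ i)) →
               ∀ {v x} → x ∈ X v → total d F v x ≡ total d F′ v x
  total-cong d agree {v} x∈ = sum-cong-≗ λ i →
    when-cong (v ∈? piece d i) (v ∈? piece d i) (λ v∈ → v∈) (λ v∈ → v∈) λ v∈ → agree i v∈ x∈

  module _ {S₁ S₂} (d₁ : Decomp G S₁) (d₂ : Decomp G S₂) where

    total-node : ∀ F w x → sum (λ i → when (w ∈? pieceOf d₁ d₂ i) (F i x)) ≡
                 total d₁ (F ∘ (_↑ˡ pieces d₂)) w x + total d₂ (F ∘ (pieces d₁ ↑ʳ_)) w x
    total-node F w x = trans (sum-split (pieces d₁) (pieces d₂) _) (cong₂ _+_
      (sum-cong-≗ λ i → cong (λ A → when (w ∈? A) (F (i ↑ˡ pieces d₂) x)) (piece-ˡ d₁ d₂ i))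
      (sum-cong-≗ λ i → cong (λ A → when (w ∈? A) (F (pieces d₁ ↑ʳ i) x)) (piece-ʳ d₁ d₂ i)))

  -- At the cut vertex the known total mixes both sides, so the side without r can be compared only
  -- away from that vertex. Once it agrees, its contribution cancels everywhere, and the other side
  -- inherits the hypothesis with the original root r.
  totals-determine : ∀ {S} (d : Decomp G S) (F F′ : Fin (pieces d) → Fin m → ℕ) →
    (∀ i → Rigid X (piece d i) (F i) (F′ i)) →
    ∀ {r} → r ∈ S → (∀ {v x} → v ∈ S → v ≢ r → x ∈ X v → total d F v x ≡ total d F′ v x) →
    ∀ i → AgreeOn X (piece d i) (F i) (F′ i)
  totals-determine (leaf {S} _ _) F F′ rigid r∈ eq zero =
    rigid zero r∈ λ {v} v∈ v≢r x∈ → trans (sym (single F v∈)) (trans (eq v∈ v≢r x∈) (single F′ v∈))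
    where
    single : ∀ (F : Fin 1 → Fin m → ℕ) {v x} → v ∈ S → when (v ∈? S) (F zero x) + 0 ≡ F zero x
    single F {v} v∈ = trans (+-identityʳ _) (when-yes (v ∈? S) v∈)
  totals-determine d@(node {S₁} {S₂} d₁ d₂ _ _ v v∈₁ v∈₂ meet _) F F′ rigid {r} r∈ eq =
    ↑-elim (pieces d₁)
      (λ i → subst (λ A → AgreeOn X A (F₁ i) (F₁′ i)) (sym (piece-ˡ d₁ d₂ i)) (proj₁ both i))
      (λ i → subst (λ A → AgreeOn X A (F₂ i) (F₂′ i)) (sym (piece-ʳ d₁ d₂ i)) (proj₂ both i))
    where
    F₁ F₁′ : Fin (pieces d₁) → Fin m → ℕ
    F₁  i = F (i ↑ˡ pieces d₂)
    F₁′ i = F′ (i ↑ˡ pieces d₂)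
    F₂ F₂′ : Fin (pieces d₂) → Fin m → ℕ
    F₂  i = F (pieces d₁ ↑ʳ i)
    F₂′ i = F′ (pieces d₁ ↑ʳ i)
    rigid₁ : ∀ i → Rigid X (piece d₁ i) (F₁ i) (F₁′ i)
    rigid₁ i = subst (λ A → Rigid X A (F₁ i) (F₁′ i)) (piece-ˡ d₁ d₂ i) (rigid (i ↑ˡ pieces d₂))
    rigid₂ : ∀ i → Rigid X (piece d₂ i) (F₂ i) (F₂′ i)
    rigid₂ i = subst (λ A → Rigid X A (F₂ i) (F₂′ i)) (piece-ʳ d₁ d₂ i) (rigid (pieces d₁ ↑ʳ i))
    Agree₁ Agree₂ : Set
    Agree₁ = ∀ i → AgreeOn X (piece d₁ i) (F₁ i) (F₁′ i)
    Agree₂ = ∀ i → AgreeOn X (piece d₂ i) (F₂ i) (F₂′ i)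
    eq-sum : ∀ {w x} → w ∈ S₁ ∪ S₂ → w ≢ r → x ∈ X w →
             total d₁ F₁ w x + total d₂ F₂ w x ≡ total d₁ F₁′ w x + total d₂ F₂′ w x
    eq-sum {w} {x} w∈ w≢r x∈ =
      trans (sym (total-node d₁ d₂ F w x)) (trans (eq w∈ w≢r x∈) (total-node d₁ d₂ F′ w x))
    eq₁ : ∀ {w x} → w ∈ S₁ → w ≢ r → x ∈ X w → total d₂ F₂ w x ≡ total d₂ F₂′ w x →
          total d₁ F₁ w x ≡ total d₁ F₁′ w x
    eq₁ {w} {x} w∈ w≢r x∈ e = +-cancelʳ-≡ (total d₂ F₂ w x) _ _
      (trans (eq-sum (x∈p∪q⁺ (inj₁ w∈)) w≢r x∈) (cong (total d₁ F₁′ w x +_) (sym e)))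
    eq₂ : ∀ {w x} → w ∈ S₂ → w ≢ r → x ∈ X w → total d₁ F₁ w x ≡ total d₁ F₁′ w x →
          total d₂ F₂ w x ≡ total d₂ F₂′ w x
    eq₂ {w} {x} w∈ w≢r x∈ e = +-cancelˡ-≡ (total d₁ F₁ w x) _ _
      (trans (eq-sum (x∈p∪q⁺ (inj₂ w∈)) w≢r x∈) (cong (_+ total d₂ F₂′ w x) (sym e)))
    outside₁ : ∀ {w x} → w ∈ S₂ → w ≢ v → total d₁ F₁ w x ≡ total d₁ F₁′ w x
    outside₁ w∈ w≢v = trans (total-outside d₁ F₁ w∉) (sym (total-outside d₁ F₁′ w∉))
      where w∉ = λ w∈₁ → w≢v (meet w∈₁ w∈)
    outside₂ : ∀ {w x} → w ∈ S₁ → w ≢ v → total d₂ F₂ w x ≡ total d₂ F₂′ w x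
    outside₂ w∈ w≢v = trans (total-outside d₂ F₂ w∉) (sym (total-outside d₂ F₂′ w∉))
      where w∉ = λ w∈₂ → w≢v (meet w∈ w∈₂)
    -- The side without r is settled first, with the cut vertex v as its root.
    both : Agree₁ × Agree₂
    both with x∈p∪q⁻ S₁ S₂ r∈
    ... | inj₁ r∈₁ = totals-determine d₁ F₁ F₁′ rigid₁ r∈₁
            (λ w∈ w≢r x∈ → eq₁ w∈ w≢r x∈ (total-cong d₂ agree₂ x∈)) , agree₂
      where
      agree₂ : Agree₂
      agree₂ = totals-determine d₂ F₂ F₂′ rigid₂ v∈₂ λ w∈ w≢v x∈ →
        eq₂ w∈ (λ { refl → w≢v (meet r∈₁ w∈) }) x∈ (outside₁ w∈ w≢v)
    ... | inj₂ r∈₂ = agree₁ , totals-determine d₂ F₂ F₂′ rigid₂ r∈₂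
            (λ w∈ w≢r x∈ → eq₂ w∈ w≢r x∈ (total-cong d₁ agree₁ x∈))
      where
      agree₁ : Agree₁
      agree₁ = totals-determine d₁ F₁ F₁′ rigid₁ v∈₁ λ w∈ w≢v x∈ →
        eq₁ w∈ (λ { refl → w≢v (meet w∈ r∈₂) }) x∈ (outside₂ w∈ w≢v)

neighbour : (B : Graph n) → ∀ {r a} → Walk B r a → a ≢ r → ∃[ u ] Adjacent B r u
neighbour B ε         a≢r = ⊥-elim (a≢r refl)
neighbour B (adj ◅ _) _   = _ , adj

module _ (T : Tuple n m) {B : Graph n} {g g′ : Fin m → ℕ} (conn : Connected B)
         (prop : Propagates (restrict T B g)) (prop′ : Propagates (restrict T B g′)) where
  open Tuple T using (X)

  -- A single neighbour u of r suffices. As u differs from r, both functions have the same support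
  -- over u; hence the same alternative, vanishing or transfer, applies to both of them, even when
  -- they come from configurations of different kinds.
  propagates⇒rigid : Rigid X (V B) g g′
  propagates⇒rigid {r} r∈ off {v} {x} v∈ x∈ with v ≟ᶠ r
  ... | no v≢r = off v∈ v≢r x∈
  ... | yes refl with any? (λ a → (a ∈? V B) ×-dec ¬? (a ≟ᶠ r))
  ...   | no none = trans (Propagates.isolated prop all≡ v∈ x∈) (sym (Propagates.isolated prop′ all≡ v∈ x∈))
    where
    ≡r : ∀ {a} → a ∈ V B → a ≡ r
    ≡r {a} a∈ = decidable-stable (a ≟ᶠ r) λ a≢r → none (a , a∈ , a≢r)
    all≡ : ∀ {a b} → a ∈ V B → b ∈ V B → a ≡ b
    all≡ a∈ b∈ = trans (≡r a∈) (sym (≡r b∈))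
  ...   | yes (a , a∈ , a≢r) with neighbour B (proj₂ conn r a r∈ a∈) a≢r
  ...     | u , ru = along (any? λ y → (y ∈? X u) ×-dec (0 <? μ H x y) ×-dec (0 <? g y))
    where
    H = coverGraph T B
    ur : Adjacent B u r
    ur = adjacent-sym B ru
    g≡ : ∀ {y} → y ∈ X u → g y ≡ g′ y
    g≡ = off (μ-supp B _ _ ur) (adjacent⇒≢ B ur)
    along : Dec (∃[ y ] (y ∈ X u × 0 < μ H x y × 0 < g y)) → g x ≡ g′ x
    along (yes (y , y∈ , pos , gy>0)) = *-cancelʳ-≡ (g x) (g′ x) (deg B u)
      {{>-nonZero (<-≤-trans ur (term≤sum (μ B u) r))}}
      (trans (Propagates.transfer prop ur x∈ y∈ pos gy>0)
        (trans (cong (_* deg B r) (g≡ y∈))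
          (sym (Propagates.transfer prop′ ur x∈ y∈ pos (subst (0 <_) (g≡ y∈) gy>0)))))
    along (no none) = trans (Propagates.vanish prop ur x∈ zero-g)
      (sym (Propagates.vanish prop′ ur x∈ λ y∈ pos → trans (sym (g≡ y∈)) (zero-g y∈ pos)))
      where
      zero-g : ∀ {y} → y ∈ X u → 0 < μ H x y → g y ≡ 0
      zero-g {y} y∈ pos = n≤0⇒n≡0 (support-≤ λ gy>0 → ⊥-elim (none (y , y∈ , pos , gy>0)))

-- Embeddings of configurations

Induced : Graph n → Graph n → Set
Induced B G = ∀ {u v} → u ∈ V B → v ∈ V B → μ B u v ≡ μ G u v

∈⋃⁺ : ∀ {S : Subset n} {X : Fin n → Subset m} {v x} → v ∈ S → x ∈ X v → x ∈ ⋃[ S ] X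
∈⋃⁺ {S = S} {X} v∈ x∈ = ∈-tabulate⁺ (λ x → any? λ v → (v ∈? S) ×-dec (x ∈? X v)) (_ , v∈ , x∈)

∈⋃⁻ : ∀ {S : Subset n} {X : Fin n → Subset m} {x} → x ∈ ⋃[ S ] X → ∃[ v ] (v ∈ S × x ∈ X v)
∈⋃⁻ {S = S} {X} = ∈-tabulate⁻ (λ x → any? λ v → (v ∈? S) ×-dec (x ∈? X v))

restrict-uniform : (T : Tuple n m) → Tuple.IsUniformConfiguration T →
  ∀ {B} g → V B ⊆ V (Tuple.G T) → Induced B (Tuple.G T) → Tuple.IsUniformConfiguration (restrict T B g)
restrict-uniform T (cover , r , r≥1 , ∣X∣) {B} g B⊆ ind = record
  { disjoint    = λ u∈ v∈ → disjoint (B⊆ u∈) (B⊆ v∈)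
  ; union       = λ x → mk⇔ (λ x∈ → ∈⋃⁻ (p∩q⊆q (V H) (⋃[ V B ] X) x∈))
      (λ (v , v∈ , x∈) → x∈p∩q⁺ (from (union x) (v , B⊆ v∈ , x∈) , ∈⋃⁺ {X = X} v∈ x∈))
  ; independent = λ v∈ x∈ y∈ → trans (unmask v∈ v∈ x∈ y∈) (independent (B⊆ v∈) x∈ y∈)
  ; matchings   = λ {u} {v} u∈ v∈ u≢v →
      let M , isMatching , μ≡ = matchings (B⊆ u∈) (B⊆ v∈) u≢v
      in subst (λ k → UnionOfMatchings k (coverGraph T B) (X u) (X v)) (sym (ind u∈ v∈))
           (M , isMatching , λ x∈ y∈ → trans (unmask u∈ v∈ x∈ y∈) (μ≡ x∈ y∈))
  } , r , r≥1 , λ v∈ → ∣X∣ (B⊆ v∈)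
  where
  open Tuple T
  open IsCover cover
  unmask : ∀ {u v} → u ∈ V B → v ∈ V B → ∀ {x y} → x ∈ X u → y ∈ X v → μ (coverGraph T B) x y ≡ μ H x y
  unmask u∈ v∈ x∈ y∈ = mask-inside (⋃[ V B ] X) (μ H) (∈⋃⁺ {X = X} u∈ x∈) (∈⋃⁺ {X = X} v∈ y∈)

constructible-uniform : {T : Tuple n m} → Constructible T → Tuple.IsUniformConfiguration T
constructible-uniform (mConf M)      = IsMConfiguration.uniform M
constructible-uniform (kConf K)      = IsKConfiguration.uniform K
constructible-uniform (oddConf C)    = IsOddCConfiguration.uniform C
constructible-uniform (evenConf C)   = IsEvenCConfiguration.uniform C
constructible-uniform (glue _ _ u _) = u

blockConfiguration-nonseparable : {T : Tuple n m} → IsBlockConfiguration T → Nonseparable (Tuple.G T)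
blockConfiguration-nonseparable (inj₁ M) = _IsBlockOf_.nonsep (proj₁ (IsMConfiguration.isBlock M))
blockConfiguration-nonseparable (inj₂ (inj₁ K)) =
  nonseparable-≅ tK≅G (complete-nonseparable t≥1 (fromℕ< k≥1))
  where open IsKConfiguration K
blockConfiguration-nonseparable (inj₂ (inj₂ (inj₁ C))) = nonseparable-≅ tC≅G (cycle-nonseparable t≥1 k≥3)
  where open IsOddCConfiguration C
blockConfiguration-nonseparable (inj₂ (inj₂ (inj₂ C))) = nonseparable-≅ tC≅G (cycle-nonseparable t≥1 k≥3)
  where open IsEvenCConfiguration C

-- Purely about graphs and fibres: at an identified vertex the values of f add up, so f of the whole
-- does not restrict to f of a part. Fibres are matched completely, which `ψ⁻-X` records.
record Embedding (T₁ : Tuple n₁ m₁) (T : Tuple n m) : Set where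
  open Tuple T₁ using () renaming (G to G₁; X to X₁; H to H₁)
  open Tuple T using (G; X; H)
  field
    φ   : Fin n₁ → Fin n
    ψ   : Fin m₁ → Fin m
    φ-V : ∀ {v} → v ∈ V G₁ → φ v ∈ V G
    φ-injective : ∀ {u v} → u ∈ V G₁ → v ∈ V G₁ → φ u ≡ φ v → u ≡ v
    ψ-injective : ∀ {x y} → x ∈ V H₁ → y ∈ V H₁ → ψ x ≡ ψ y → x ≡ y
    φ-μ  : ∀ {u v} → u ∈ V G₁ → v ∈ V G₁ → μ G (φ u) (φ v) ≡ μ G₁ u v
    ψ-μ  : ∀ {x y} → x ∈ V H₁ → y ∈ V H₁ → μ H (ψ x) (ψ y) ≡ μ H₁ x y
    ψ-X  : ∀ {v x} → v ∈ V G₁ → x ∈ X₁ v → ψ x ∈ X (φ v)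
    ψ⁻-X : ∀ {v z} → v ∈ V G₁ → z ∈ X (φ v) → ∃[ x ] (x ∈ X₁ v × ψ x ≡ z)

  ψ-V : IsCover G₁ X₁ H₁ → IsCover G X H → ∀ {x} → x ∈ V H₁ → ψ x ∈ V H
  ψ-V c₁ c x∈ with to (IsCover.union c₁ _) x∈
  ... | v , v∈ , x∈X = from (IsCover.union c _) (φ v , φ-V v∈ , ψ-X v∈ x∈X)

id-embedding : (T : Tuple n m) → Embedding T T
id-embedding T = record
  { φ = id ; ψ = id ; φ-V = id ; φ-injective = λ _ _ e → e ; ψ-injective = λ _ _ e → e
  ; φ-μ = λ _ _ → refl ; ψ-μ = λ _ _ → refl ; ψ-X = λ _ x∈ → x∈ ; ψ⁻-X = λ _ z∈ → _ , z∈ , refl }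

∘-embedding : {T₁ : Tuple n₁ m₁} {T₂ : Tuple n₂ m₂} {T : Tuple n m} →
  Tuple.IsUniformConfiguration T₁ → Tuple.IsUniformConfiguration T₂ →
  Embedding T₂ T → Embedding T₁ T₂ → Embedding T₁ T
∘-embedding {T₁ = T₁} {T₂} {T} (c₁ , _) (c₂ , _) E D = record
  { φ = E.φ ∘ D.φ
  ; ψ = E.ψ ∘ D.ψ
  ; φ-V = E.φ-V ∘ D.φ-V
  ; φ-injective = λ u∈ v∈ e → D.φ-injective u∈ v∈ (E.φ-injective (D.φ-V u∈) (D.φ-V v∈) e)
  ; ψ-injective = λ x∈ y∈ e → D.ψ-injective x∈ y∈ (E.ψ-injective (D.ψ-V c₁ c₂ x∈) (D.ψ-V c₁ c₂ y∈) e)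
  ; φ-μ = λ u∈ v∈ → trans (E.φ-μ (D.φ-V u∈) (D.φ-V v∈)) (D.φ-μ u∈ v∈)
  ; ψ-μ = λ x∈ y∈ → trans (E.ψ-μ (D.ψ-V c₁ c₂ x∈) (D.ψ-V c₁ c₂ y∈)) (D.ψ-μ x∈ y∈)
  ; ψ-X = λ v∈ x∈ → E.ψ-X (D.φ-V v∈) (D.ψ-X v∈ x∈)
  ; ψ⁻-X = λ v∈ z∈ →
      let y , y∈ , ψy≡ = E.ψ⁻-X (D.φ-V v∈) z∈
          x , x∈ , ψx≡ = D.ψ⁻-X v∈ y∈
      in x , x∈ , trans (cong E.ψ ψx≡) ψy≡
  }
  where
  module E = Embedding E
  module D = Embedding D

module _ {T₁ : Tuple n₁ m₁} {T₂ : Tuple n₂ m₂} {T : Tuple n m} (gl : IsGluing T₁ T₂ T) where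
  open IsGluing gl
  private
    module A = IsAmalgam glueG
    module B = IsAmalgam glueH

  gluing-embedding₁ : Embedding T₁ T
  gluing-embedding₁ = record
    { φ = A.ι₁ ; ψ = B.ι₁ ; φ-V = λ v∈ → from (A.vertices _) (inj₁ (_ , v∈ , refl))
    ; φ-injective = A.ι₁-inj ; ψ-injective = B.ι₁-inj ; φ-μ = A.μ₁ ; ψ-μ = B.μ₁
    ; ψ-X = λ v∈ x∈ → from (glueX₁ v∈ _) (_ , x∈ , refl) ; ψ⁻-X = λ v∈ → to (glueX₁ v∈ _) }

  gluing-embedding₂ : Embedding T₂ T
  gluing-embedding₂ = record
    { φ = A.ι₂ ; ψ = B.ι₂ ; φ-V = λ v∈ → from (A.vertices _) (inj₂ (_ , v∈ , refl))
    ; φ-injective = A.ι₂-inj ; ψ-injective = B.ι₂-inj ; φ-μ = A.μ₂ ; ψ-μ = B.μ₂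
    ; ψ-X = λ v∈ x∈ → from (glueX₂ v∈ _) (_ , x∈ , refl) ; ψ⁻-X = λ v∈ → to (glueX₂ v∈ _) }

-- The inverse must be total on the ambient set; off the image of A it takes the value `default`.
inverse-on : (A : Subset n₁) (φ : Fin n₁ → Fin n) → Fin n₁ →
  (∀ {u v} → u ∈ A → v ∈ A → φ u ≡ φ v → u ≡ v) →
  Σ[ φ⁻ ∈ (Fin n → Fin n₁) ] (∀ {v} → v ∈ A → φ⁻ (φ v) ≡ v)
inverse-on {n₁} {n} A φ default inj = (λ w → pick w (preimage? w)) , λ {v} v∈ → pick-φ v∈ (preimage? (φ v))
  where
  Preimage : Fin n → Set
  Preimage w = ∃[ v ] (v ∈ A × φ v ≡ w)
  preimage? : ∀ w → Dec (Preimage w)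
  preimage? w = any? λ v → (v ∈? A) ×-dec (φ v ≟ᶠ w)
  pick : ∀ w → Dec (Preimage w) → Fin n₁
  pick w (yes (v , _)) = v
  pick w (no _)        = default
  pick-φ : ∀ {v} → v ∈ A → (d : Dec (Preimage (φ v))) → pick (φ v) d ≡ v
  pick-φ v∈ (yes (u , u∈ , e)) = inj u∈ v∈ e
  pick-φ v∈ (no ¬p)            = ⊥-elim (¬p (_ , v∈ , refl))

-- Decomposition of a constructible configuration

record Trivial (T : Tuple n m) : Set where
  open Tuple T
  field
    all≡ : ∀ {u v} → u ∈ V G → v ∈ V G → u ≡ v
    f≡0  : ∀ {v x} → v ∈ V G → x ∈ X v → f x ≡ 0

module _ {T : Tuple n₁ m₁} {T* : Tuple n m} (e : Embedding T T*) where
  open Tuple T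
  open Tuple T* using () renaming (G to G*)
  open Embedding e

  -- `conf` admits every graph with the right vertices and multiplicities instead of fixing the
  -- induced subgraph, because an enumerated block agrees with that subgraph only pointwise.
  record Decomposition : Set where
    field
      S        : Subset n
      ∈S⁻      : ∀ {w} → w ∈ S → ∃[ v ] (v ∈ V G × φ v ≡ w)
      ∈S⁺      : ∀ {v} → v ∈ V G → φ v ∈ S
      decomp   : Decomp G* S
      g        : Fin (pieces decomp) → Fin m → ℕ
      conf     : ∀ i B → V B ≡ piece decomp i → Induced B G* → IsBlockConfiguration (restrict T* B (g i))
      f≡total  : ∀ {v x} → v ∈ V G → x ∈ X v → f x ≡ total (Tuple.X T*) decomp g (φ v) (ψ x)
      -- A single vertex is a block of itself, but no longer one after T is glued to something larger.
      nontrivial : Many S ⊎ Trivial T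

  module _ (uniform : Tuple.IsUniformConfiguration T) (uniform* : Tuple.IsUniformConfiguration T*)
           (C : IsBlockConfiguration T) where
    private
      cover = proj₁ uniform
      cover* = proj₁ uniform*
      ns : Nonseparable G
      ns = blockConfiguration-nonseparable C
      v₀ : Fin n₁
      v₀ = proj₁ (proj₁ (proj₁ ns))
      v₀∈ : v₀ ∈ V G
      v₀∈ = proj₂ (proj₁ (proj₁ ns))
      -- Fibres have size r, at least 1; an element of one supplies the default value for the
      -- inverse of `ψ`.
      x₀ : Nonempty (X v₀)
      x₀ = ∣∣>0⇒nonempty (X v₀) (≤-trans (proj₁ (proj₂ (proj₂ uniform))) (≤-reflexive (sym (proj₂ (proj₂ (proj₂ uniform)) v₀∈))))
      φ-inverse = inverse-on (V G) φ v₀ φ-injective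
      ψ-inverse = inverse-on (V H) ψ (proj₁ x₀) ψ-injective
      φ⁻ = proj₁ φ-inverse
      φ⁻φ = proj₂ φ-inverse
      ψ⁻ = proj₁ ψ-inverse
      ψ⁻ψ = proj₂ ψ-inverse
      X⊆V : ∀ {v x} → v ∈ V G → x ∈ X v → x ∈ V H
      X⊆V v∈ x∈ = ∈X⇒∈V cover v∈ x∈
      g : Fin m → ℕ
      g = f ∘ ψ⁻
      image? : ∀ w → Dec (∃[ v ] (v ∈ V G × φ v ≡ w))
      image? w = any? λ v → (v ∈? V G) ×-dec (φ v ≟ᶠ w)
      S : Subset n
      S = tabulate λ w → does (image? w)
      ∈S⁺ : ∀ {v} → v ∈ V G → φ v ∈ S
      ∈S⁺ v∈ = ∈-tabulate⁺ image? (_ , v∈ , refl)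
      ∈S⁻ : ∀ {w} → w ∈ S → ∃[ v ] (v ∈ V G × φ v ≡ w)
      ∈S⁻ = ∈-tabulate⁻ image?
      S⊆ : S ⊆ V G*
      S⊆ w∈ with ∈S⁻ w∈
      ... | v , v∈ , refl = φ-V v∈

    module _ {B : Graph n} (VB≡S : V B ≡ S) (ind : Induced B G*) where
      private
        ∈B⁺ : ∀ {v} → v ∈ V G → φ v ∈ V B
        ∈B⁺ v∈ = subst (_ ∈_) (sym VB≡S) (∈S⁺ v∈)
        ∈B⁻ : ∀ {w} → w ∈ V B → ∃[ v ] (v ∈ V G × φ v ≡ w)
        ∈B⁻ w∈ = ∈S⁻ (subst (_ ∈_) VB≡S w∈)
        Hᴮ = coverGraph T* B
        ∈H⁺ : ∀ {x} → x ∈ V H → ψ x ∈ V Hᴮ × ψ x ∈ ⋃[ V B ] Tuple.X T*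
        ∈H⁺ x∈ with to (IsCover.union cover _) x∈
        ... | v , v∈ , x∈X = x∈p∩q⁺ (ψ-V cover cover* x∈ , ∈⋃) , ∈⋃
          where ∈⋃ = ∈⋃⁺ {X = Tuple.X T*} (∈B⁺ v∈) (ψ-X v∈ x∈X)
        ∈H⁻ : ∀ {z} → z ∈ V Hᴮ → ∃[ x ] (x ∈ V H × ψ x ≡ z)
        ∈H⁻ z∈ with ∈⋃⁻ {S = V B} {Tuple.X T*} (p∩q⊆q (V (Tuple.H T*)) _ z∈)
        ... | w , w∈ , z∈X with ∈B⁻ w∈
        ...   | v , v∈ , refl with ψ⁻-X v∈ z∈X
        ...     | x , x∈ , refl = x , X⊆V v∈ x∈ , refl

      leaf-iso : Iso T (restrict T* B g)
      leaf-iso = record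
        { φ = φ ; φ⁻ = φ⁻ ; ψ = ψ ; ψ⁻ = ψ⁻
        ; φ-V  = ∈B⁺
        ; φ⁻-V = λ w∈ → let v , v∈ , φv≡w = ∈B⁻ w∈ in subst (_∈ V G) (trans (sym (φ⁻φ v∈)) (cong φ⁻ φv≡w)) v∈
        ; φφ⁻  = λ w∈ → let v , v∈ , φv≡w = ∈B⁻ w∈ in trans (cong φ (trans (cong φ⁻ (sym φv≡w)) (φ⁻φ v∈))) φv≡w
        ; φ⁻φ  = φ⁻φ
        ; ψ-V  = proj₁ ∘ ∈H⁺
        ; ψ⁻-V = λ z∈ → let x , x∈ , ψx≡z = ∈H⁻ z∈ in subst (_∈ V H) (trans (sym (ψ⁻ψ x∈)) (cong ψ⁻ ψx≡z)) x∈
        ; ψψ⁻  = λ z∈ → let x , x∈ , ψx≡z = ∈H⁻ z∈ in trans (cong ψ (trans (cong ψ⁻ (sym ψx≡z)) (ψ⁻ψ x∈))) ψx≡z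
        ; ψ⁻ψ  = ψ⁻ψ
        ; φ-μ  = λ u∈ v∈ → trans (ind (∈B⁺ u∈) (∈B⁺ v∈)) (φ-μ u∈ v∈)
        ; ψ-μ  = λ x∈ y∈ → trans (mask-inside _ (μ (Tuple.H T*)) (proj₂ (∈H⁺ x∈)) (proj₂ (∈H⁺ y∈))) (ψ-μ x∈ y∈)
        ; ψ-X  = ψ-X
        ; ψ⁻-X = back
        ; ψ-f  = λ x∈ → cong f (ψ⁻ψ x∈)
        }
        where
        back : ∀ {w z} → w ∈ V B → z ∈ Tuple.X T* w → ψ⁻ z ∈ X (φ⁻ w)
        back w∈ z∈ with ∈B⁻ w∈
        ... | v , v∈ , refl with ψ⁻-X v∈ z∈
        ...   | x , x∈ , refl = subst₂ (λ a b → a ∈ X b) (sym (ψ⁻ψ (X⊆V v∈ x∈))) (sym (φ⁻φ v∈)) x∈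

      leaf-configuration : IsBlockConfiguration (restrict T* B g)
      leaf-configuration = Transport.blockConfiguration leaf-iso uniform
        (restrict-uniform T* uniform* g (S⊆ ∘ subst (_ ∈_) VB≡S) ind) C

      leaf-nonseparable : Nonseparable B
      leaf-nonseparable = blockConfiguration-nonseparable leaf-configuration

    leaf-decomposition : Decomposition
    leaf-decomposition = record
      { S       = S
      ; ∈S⁻     = ∈S⁻
      ; ∈S⁺     = ∈S⁺
      -- The induced subgraph is the graph of the transported configuration, from which its
      -- nonseparability is read off.
      ; decomp  = leaf S⊆ (leaf-nonseparable {G* [ S ]} V≡S
          λ u∈ v∈ → mask-inside S (μ G*) (p∩q⊆q (V G*) S u∈) (p∩q⊆q (V G*) S v∈))
      ; g       = λ _ → g
      ; conf    = λ _ B → leaf-configuration {B}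
      ; f≡total = λ v∈ x∈ → sym (trans (+-identityʳ _) (trans (when-yes (_ ∈? S) (∈S⁺ v∈)) (cong f (ψ⁻ψ (X⊆V v∈ x∈)))))
      ; nontrivial = many (any? λ v → (v ∈? V G) ×-dec ¬? (v ≟ᶠ v₀))
      }
      where
      V≡S : V (G* [ S ]) ≡ S
      V≡S = Enumerate.V-induced G* S⊆
      many : Dec (∃[ v ] (v ∈ V G × v ≢ v₀)) →
             Many S ⊎ Trivial T
      many (no none) = inj₂ record { all≡ = all≡ ; f≡0 = Propagates.isolated (propagates T C) all≡ }
        where
        ≡v₀ : ∀ {v} → v ∈ V G → v ≡ v₀
        ≡v₀ {v} v∈ = decidable-stable (v ≟ᶠ v₀) λ v≢ → none (v , v∈ , v≢)
        all≡ : ∀ {u v} → u ∈ V G → v ∈ V G → u ≡ v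
        all≡ u∈ v∈ = trans (≡v₀ u∈) (sym (≡v₀ v∈))
      many (yes (v , v∈ , v≢v₀)) = inj₁ λ w → other w (φ v₀ ≟ᶠ w)
        where
        other : ∀ w → Dec (φ v₀ ≡ w) → ∃[ a ] (a ∈ S × a ≢ w)
        other w (no ≢w)    = φ v₀ , ∈S⁺ v₀∈ , ≢w
        other w (yes refl) = φ v , ∈S⁺ v∈ , v≢v₀ ∘ φ-injective v∈ v₀∈

module _ {T′ : Tuple n₁ m₁} {T : Tuple n₂ m₂} {T* : Tuple n m}
         (uniform′ : Tuple.IsUniformConfiguration T′) (uniform : Tuple.IsUniformConfiguration T)
         (e : Embedding T T*) (E : Embedding T′ T) where
  open Tuple T
  open Tuple T′ using () renaming (G to G′; X to X′; f to f′)
  open Embedding E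

  -- If the embedded part already covers T and carries the same values of f, its decomposition
  -- serves for T. This happens when the other part of a gluing is trivial.
  extend-decomposition : (∀ {v} → v ∈ V G → ∃[ b ] (b ∈ V G′ × φ b ≡ v)) →
    (∀ {b y} → b ∈ V G′ → y ∈ X′ b → f (ψ y) ≡ f′ y) →
    Decomposition (∘-embedding uniform′ uniform e E) → Decomposition e
  extend-decomposition onto f≡ D = record
    { S       = S
    ; ∈S⁻     = λ w∈ → let b , b∈ , eq = ∈S⁻ w∈ in φ b , φ-V b∈ , eq
    ; ∈S⁺     = λ v∈ → let b , b∈ , eq = onto v∈ in subst (λ u → Embedding.φ e u ∈ S) eq (∈S⁺ b∈)
    ; decomp  = decomp
    ; g       = g
    ; conf    = conf
    ; f≡total = f≡total′
    ; nontrivial = [ inj₁ , inj₂ ∘ trivial ]′ nontrivial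
    }
    where
    open Decomposition D
    f≡total′ : ∀ {v x} → v ∈ V G → x ∈ X v →
               f x ≡ total (Tuple.X T*) decomp g (Embedding.φ e v) (Embedding.ψ e x)
    f≡total′ v∈ x∈ with onto v∈
    ... | b , b∈ , refl with ψ⁻-X b∈ x∈
    ...   | y , y∈ , refl = trans (f≡ b∈ y∈) (f≡total b∈ y∈)
    trivial : Trivial T′ → Trivial T
    trivial t = record { all≡ = all≡ ; f≡0 = f≡0 }
      where
      all≡ : ∀ {u v} → u ∈ V G → v ∈ V G → u ≡ v
      all≡ u∈ v∈ with onto u∈ | onto v∈
      ... | a , a∈ , refl | b , b∈ , refl = cong φ (Trivial.all≡ t a∈ b∈)
      f≡0 : ∀ {v x} → v ∈ V G → x ∈ X v → f x ≡ 0
      f≡0 v∈ x∈ with onto v∈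
      ... | b , b∈ , refl with ψ⁻-X b∈ x∈
      ...   | y , y∈ , refl = trans (f≡ b∈ y∈) (Trivial.f≡0 t b∈ y∈)

-- Decomposing a gluing

module _ {T₁ : Tuple n₁ m₁} {T₂ : Tuple n₂ m₂} {T : Tuple n m} (gl : IsGluing T₁ T₂ T)
         (uniform₁ : Tuple.IsUniformConfiguration T₁) (uniform₂ : Tuple.IsUniformConfiguration T₂)
         (uniform : Tuple.IsUniformConfiguration T)
         {n* m*} {T* : Tuple n* m*} (e : Embedding T T*) where
  open IsGluing gl
  open Tuple T
  open Tuple T₁ using () renaming (G to G₁; X to X₁; H to H₁; f to f₁)
  open Tuple T₂ using () renaming (G to G₂; X to X₂; H to H₂; f to f₂)
  open Tuple T* using () renaming (G to G*; X to X*)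
  open Embedding e
  private
    module A = IsAmalgam glueG
    module B = IsAmalgam glueH

    e₁ : Embedding T₁ T*
    e₁ = ∘-embedding uniform₁ uniform e (gluing-embedding₁ gl)
    e₂ : Embedding T₂ T*
    e₂ = ∘-embedding uniform₂ uniform e (gluing-embedding₂ gl)

    v₁≡v₂ : A.ι₁ v₁ ≡ A.ι₂ v₂
    v₁≡v₂ = from (A.identify v₁∈ v₂∈) (refl , refl)

    X⊆V₁ : ∀ {v x} → v ∈ V G₁ → x ∈ X₁ v → x ∈ V H₁
    X⊆V₁ v∈ x∈ = ∈X⇒∈V (proj₁ uniform₁) v∈ x∈

    X⊆V₂ : ∀ {v x} → v ∈ V G₂ → x ∈ X₂ v → x ∈ V H₂
    X⊆V₂ v∈ x∈ = ∈X⇒∈V (proj₁ uniform₂) v∈ x∈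

    ψ₁≡ψ₂ : ∀ {x} → x ∈ X₁ v₁ → B.ι₁ x ≡ B.ι₂ (π x)
    ψ₁≡ψ₂ x∈ = from (B.identify (X⊆V₁ v₁∈ x∈) (X⊆V₂ v₂∈ (π-into x∈))) (x∈ , refl)

    f₁-off′ : ∀ {v y} → v ∈ V G₁ → v ≢ v₁ → y ∈ X₁ v → f (B.ι₁ y) ≡ f₁ y
    f₁-off′ v∈ v≢ y∈ = f₁-off (X⊆V₁ v∈ y∈) (IsCover.disjoint (proj₁ uniform₁) v∈ v₁∈ v≢ y∈)

    f₂-off′ : ∀ {v y} → v ∈ V G₂ → v ≢ v₂ → y ∈ X₂ v → f (B.ι₂ y) ≡ f₂ y
    f₂-off′ v∈ v≢ y∈ = f₂-off (X⊆V₂ v∈ y∈) (IsCover.disjoint (proj₁ uniform₂) v∈ v₂∈ v≢ y∈)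

  -- `T₁` is just the vertex `v₁` with value 0, so T is a renaming of `T₂`.
  absorb₁ : Trivial T₁ → Decomposition e₂ → Decomposition e
  absorb₁ t = extend-decomposition uniform₂ uniform e (gluing-embedding₂ gl) onto f≡
    where
    open Trivial t
    onto : ∀ {v} → v ∈ V G → ∃[ b ] (b ∈ V G₂ × A.ι₂ b ≡ v)
    onto v∈ with to (A.vertices _) v∈
    ... | inj₁ (a , a∈ , refl) = v₂ , v₂∈ , trans (sym v₁≡v₂) (cong A.ι₁ (all≡ v₁∈ a∈))
    ... | inj₂ w               = w
    f≡ : ∀ {b y} → b ∈ V G₂ → y ∈ X₂ b → f (B.ι₂ y) ≡ f₂ y
    f≡ {b} b∈ y∈ with b ≟ᶠ v₂
    ... | no b≢v₂  = f₂-off′ b∈ b≢v₂ y∈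
    ... | yes refl with π-surj y∈
    ...   | x , x∈ , refl = trans (cong f (sym (ψ₁≡ψ₂ x∈))) (trans (f-at x∈) (cong (_+ f₂ (π x)) (f≡0 v₁∈ x∈)))

  absorb₂ : Trivial T₂ → Decomposition e₁ → Decomposition e
  absorb₂ t = extend-decomposition uniform₁ uniform e (gluing-embedding₁ gl) onto f≡
    where
    open Trivial t
    onto : ∀ {v} → v ∈ V G → ∃[ a ] (a ∈ V G₁ × A.ι₁ a ≡ v)
    onto v∈ with to (A.vertices _) v∈
    ... | inj₁ w               = w
    ... | inj₂ (b , b∈ , refl) = v₁ , v₁∈ , trans v₁≡v₂ (cong A.ι₂ (all≡ v₂∈ b∈))
    f≡ : ∀ {a y} → a ∈ V G₁ → y ∈ X₁ a → f (B.ι₁ y) ≡ f₁ y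
    f≡ {a} a∈ y∈ with a ≟ᶠ v₁
    ... | no a≢v₁  = f₁-off′ a∈ a≢v₁ y∈
    ... | yes refl = trans (f-at y∈) (trans (cong (f₁ _ +_) (f≡0 v₂∈ (π-into y∈))) (+-identityʳ _))

  module _ (D₁ : Decomposition e₁) (D₂ : Decomposition e₂)
           (many₁ : Many (Decomposition.S D₁)) (many₂ : Many (Decomposition.S D₂)) where
    private
      module D₁ = Decomposition D₁
      module D₂ = Decomposition D₂
      d₁ = D₁.decomp
      d₂ = D₂.decomp
      v* = φ (A.ι₁ v₁)

      v*∈₂ : v* ∈ D₂.S
      v*∈₂ = subst (λ w → φ w ∈ D₂.S) (sym v₁≡v₂) (D₂.∈S⁺ v₂∈)

      φ-V₁ : ∀ {a} → a ∈ V G₁ → A.ι₁ a ∈ V G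
      φ-V₁ a∈ = from (A.vertices _) (inj₁ (_ , a∈ , refl))
      φ-V₂ : ∀ {b} → b ∈ V G₂ → A.ι₂ b ∈ V G
      φ-V₂ b∈ = from (A.vertices _) (inj₂ (_ , b∈ , refl))

      meet : ∀ {w} → w ∈ D₁.S → w ∈ D₂.S → w ≡ v*
      meet w∈₁ w∈₂ with D₁.∈S⁻ w∈₁ | D₂.∈S⁻ w∈₂
      ... | a , a∈ , refl | b , b∈ , eq with to (A.identify a∈ b∈) (φ-injective (φ-V₁ a∈) (φ-V₂ b∈) (sym eq))
      ...   | refl , _ = refl

      no-edge : ∀ {w z} → w ∈ D₁.S → z ∈ D₂.S → w ≢ v* → z ≢ v* → μ G* w z ≡ 0
      no-edge w∈ z∈ w≢ z≢ with D₁.∈S⁻ w∈ | D₂.∈S⁻ z∈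
      ... | a , a∈ , refl | b , b∈ , refl = trans (φ-μ (φ-V₁ a∈) (φ-V₂ b∈)) (A.μ₁₂ a∈ b∈
        (λ { _ _ (refl , _) → w≢ refl }) (λ { _ _ (_ , refl) → z≢ (cong φ (sym v₁≡v₂)) }))

      d : Decomp G* (D₁.S ∪ D₂.S)
      d = node d₁ d₂ many₁ many₂ v* (D₁.∈S⁺ v₁∈) v*∈₂ meet no-edge

      g : Fin (pieces d₁ + pieces d₂) → Fin m* → ℕ
      g i = [ D₁.g , D₂.g ]′ (splitAt (pieces d₁) i)

      total-g : ∀ w x → total X* d g w x ≡ total X* d₁ D₁.g w x + total X* d₂ D₂.g w x
      total-g w x = trans (total-node X* d₁ d₂ g w x) (cong₂ _+_
        (sum-cong-≗ λ i → cong (λ h → when (w ∈? piece d₁ i) (h x)) (g-ˡ i))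
        (sum-cong-≗ λ i → cong (λ h → when (w ∈? piece d₂ i) (h x)) (g-ʳ i)))
        where
        g-ˡ : ∀ i → g (i ↑ˡ pieces d₂) ≡ D₁.g i
        g-ˡ i = cong [ D₁.g , D₂.g ]′ (splitAt-↑ˡ (pieces d₁) i (pieces d₂))
        g-ʳ : ∀ i → g (pieces d₁ ↑ʳ i) ≡ D₂.g i
        g-ʳ i = cong [ D₁.g , D₂.g ]′ (splitAt-↑ʳ (pieces d₁) (pieces d₂) i)

      total-g₁ : ∀ {w x} → w ∉ D₂.S → total X* d g w x ≡ total X* d₁ D₁.g w x
      total-g₁ {w} {x} w∉ = trans (total-g w x) (trans
        (cong (total X* d₁ D₁.g w x +_) (total-outside X* d₂ D₂.g w∉)) (+-identityʳ _))

      total-g₂ : ∀ {w x} → w ∉ D₁.S → total X* d g w x ≡ total X* d₂ D₂.g w x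
      total-g₂ {w} {x} w∉ = trans (total-g w x)
        (cong (_+ total X* d₂ D₂.g w x) (total-outside X* d₁ D₁.g w∉))

      conf : ∀ i B → V B ≡ piece d i → Induced B G* → IsBlockConfiguration (restrict T* B (g i))
      conf i B with splitAt (pieces d₁) i
      ... | inj₁ j = D₁.conf j B
      ... | inj₂ j = D₂.conf j B

      -- `v*` is the only vertex where both trees contribute, and there the definition of gluing
      -- adds `f₁` and `f₂` as well.
      shared : ∀ {x} → x ∈ X₁ v₁ → f (B.ι₁ x) ≡ total X* d g v* (ψ (B.ι₁ x))
      shared {x} x∈ = begin
        f (B.ι₁ x)                                     ≡⟨ f-at x∈ ⟩
        f₁ x + f₂ (π x)                                ≡⟨ cong₂ _+_ (D₁.f≡total v₁∈ x∈) (D₂.f≡total v₂∈ (π-into x∈)) ⟩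
        total X* d₁ D₁.g v* (ψ (B.ι₁ x)) + total X* d₂ D₂.g (φ (A.ι₂ v₂)) (ψ (B.ι₂ (π x)))
          ≡⟨ cong (total X* d₁ D₁.g v* (ψ (B.ι₁ x)) +_)
               (cong₂ (λ w z → total X* d₂ D₂.g (φ w) (ψ z)) v₁≡v₂ (ψ₁≡ψ₂ x∈)) ⟨
        total X* d₁ D₁.g v* (ψ (B.ι₁ x)) + total X* d₂ D₂.g v* (ψ (B.ι₁ x))
          ≡⟨ total-g v* (ψ (B.ι₁ x)) ⟨
        total X* d g v* (ψ (B.ι₁ x))                   ∎
        where open ≡-Reasoning

      f≡total₁ : ∀ {a y} → a ∈ V G₁ → y ∈ X₁ a → f (B.ι₁ y) ≡ total X* d g (φ (A.ι₁ a)) (ψ (B.ι₁ y))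
      f≡total₁ {a} {y} a∈ y∈ with a ≟ᶠ v₁
      ... | yes refl = shared y∈
      ... | no a≢v₁  = trans (f₁-off′ a∈ a≢v₁ y∈) (trans (D₁.f≡total a∈ y∈) (sym (total-g₁ ∉₂)))
        where
        ∉₂ : φ (A.ι₁ a) ∉ D₂.S
        ∉₂ ∈₂ = a≢v₁ (A.ι₁-inj a∈ v₁∈ (φ-injective (φ-V₁ a∈) (φ-V₁ v₁∈) (meet (D₁.∈S⁺ a∈) ∈₂)))

      f≡total₂ : ∀ {b y} → b ∈ V G₂ → y ∈ X₂ b → f (B.ι₂ y) ≡ total X* d g (φ (A.ι₂ b)) (ψ (B.ι₂ y))
      f≡total₂ {b} {y} b∈ y∈ with b ≟ᶠ v₂
      ... | yes refl with π-surj y∈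
      ...   | x , x∈ , refl =
        subst₂ (λ w z → f z ≡ total X* d g (φ w) (ψ z)) v₁≡v₂ (ψ₁≡ψ₂ x∈) (shared x∈)
      f≡total₂ {b} {y} b∈ y∈ | no b≢v₂ = trans (f₂-off′ b∈ b≢v₂ y∈) (trans (D₂.f≡total b∈ y∈) (sym (total-g₂ ∉₁)))
        where
        ∉₁ : φ (A.ι₂ b) ∉ D₁.S
        ∉₁ ∈₁ = b≢v₂ (A.ι₂-inj b∈ v₂∈ (trans (φ-injective (φ-V₂ b∈) (φ-V₁ v₁∈) (meet ∈₁ (D₂.∈S⁺ b∈))) v₁≡v₂))

    node-decomposition : Decomposition e
    node-decomposition = record
      { S       = D₁.S ∪ D₂.S
      ; ∈S⁻     = ∈S⁻
      ; ∈S⁺     = ∈S⁺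
      ; decomp  = d
      ; g       = g
      ; conf    = conf
      ; f≡total = f≡total
      ; nontrivial = inj₁ λ w → let a , a∈ , a≢w = many₁ w in a , x∈p∪q⁺ (inj₁ a∈) , a≢w
      }
      where
      ∈S⁻ : ∀ {w} → w ∈ D₁.S ∪ D₂.S → ∃[ v ] (v ∈ V G × φ v ≡ w)
      ∈S⁻ w∈ with x∈p∪q⁻ D₁.S D₂.S w∈
      ... | inj₁ w∈₁ = let a , a∈ , eq = D₁.∈S⁻ w∈₁ in _ , φ-V₁ a∈ , eq
      ... | inj₂ w∈₂ = let b , b∈ , eq = D₂.∈S⁻ w∈₂ in _ , φ-V₂ b∈ , eq
      ∈S⁺ : ∀ {v} → v ∈ V G → φ v ∈ D₁.S ∪ D₂.S
      ∈S⁺ v∈ with to (A.vertices _) v∈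
      ... | inj₁ (a , a∈ , refl) = x∈p∪q⁺ (inj₁ (D₁.∈S⁺ a∈))
      ... | inj₂ (b , b∈ , refl) = x∈p∪q⁺ (inj₂ (D₂.∈S⁺ b∈))
      f≡total : ∀ {v x} → v ∈ V G → x ∈ X v → f x ≡ total X* d g (φ v) (ψ x)
      f≡total v∈ x∈ with to (A.vertices _) v∈
      ... | inj₁ (a , a∈ , refl) with to (glueX₁ a∈ _) x∈
      ...   | y , y∈ , refl = f≡total₁ a∈ y∈
      f≡total v∈ x∈ | inj₂ (b , b∈ , refl) with to (glueX₂ b∈ _) x∈
      ...   | y , y∈ , refl = f≡total₂ b∈ y∈

  glue-decomposition : Decomposition e₁ → Decomposition e₂ → Decomposition e
  glue-decomposition D₁ D₂ with Decomposition.nontrivial D₁ | Decomposition.nontrivial D₂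
  ... | inj₂ t     | _          = absorb₁ t D₂
  ... | inj₁ _     | inj₂ t     = absorb₂ t D₁
  ... | inj₁ many₁ | inj₁ many₂ = node-decomposition D₁ D₂ many₁ many₂

-- Generalised over embeddings because a part of a part sits in `T*` only through the composite of
-- the gluing maps.
decompose : {T : Tuple n₁ m₁} {T* : Tuple n m} → Tuple.IsUniformConfiguration T* →
            Constructible T → (e : Embedding T T*) → Decomposition e
decompose u* c@(mConf M)    e = leaf-decomposition e (constructible-uniform c) u* (inj₁ M)
decompose u* c@(kConf K)    e = leaf-decomposition e (constructible-uniform c) u* (inj₂ (inj₁ K))
decompose u* c@(oddConf C)  e = leaf-decomposition e (constructible-uniform c) u* (inj₂ (inj₂ (inj₁ C)))
decompose u* c@(evenConf C) e = leaf-decomposition e (constructible-uniform c) u* (inj₂ (inj₂ (inj₂ C)))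
decompose u* (glue c₁ c₂ u gl) e = glue-decomposition gl u₁ u₂ u e
  (decompose u* c₁ (∘-embedding u₁ u e (gluing-embedding₁ gl)))
  (decompose u* c₂ (∘-embedding u₂ u e (gluing-embedding₂ gl)))
  where
  u₁ = constructible-uniform c₁
  u₂ = constructible-uniform c₂

-- From pieces to the enumerated blocks

-- By maximality a block contains all edges of G between its vertices.
block-induced : {B G : Graph n} → B IsBlockOf G → Induced B G
block-induced {B = B} {G} isB {u} {v} u∈ v∈ =
  trans (proj₂ (Enumerate.block≈ G B isB) u v) (mask-inside (V B) (μ G) u∈ v∈)

-- The enumeration is abstract, so it is compared with the pieces through its properties alone: `τ`
-- sends a block to the piece with the same vertices, and `σ` is its inverse.
module Blocks (T : Tuple n m) (c : Constructible T) where
  open Tuple T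
  open BlockEnumeration (blocks G)
  open Decomposition (decompose (constructible-uniform c) c (id-embedding T)) public

  V⊆S : V G ⊆ S
  V⊆S = ∈S⁺

  τ-exists : ∀ i → ∃[ j ] (V (block i) ≡ piece decomp j)
  τ-exists i = block≡piece decomp V⊆S {block i} (isBlock i)

  τ : Fin size → Fin (pieces decomp)
  τ i = proj₁ (τ-exists i)

  V≡piece : ∀ i → V (block i) ≡ piece decomp (τ i)
  V≡piece i = proj₂ (τ-exists i)

  block-determined : ∀ {i j} → V (block i) ≡ V (block j) → i ≡ j
  block-determined {i} {j} V≡ = distinct i j (V≡ , λ u v →
    trans (proj₂ (Enumerate.block≈ G (block i) (isBlock i)) u v)
      (trans (cong (λ A → mask A (μ G) u v) V≡)
        (sym (proj₂ (Enumerate.block≈ G (block j) (isBlock j)) u v))))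

  σ-exists : ∀ j → ∃[ i ] (τ i ≡ j)
  σ-exists j with complete _ (piece-isBlock decomp V⊆S j)
  ... | i , V≡ , _ = i , piece-antichain decomp (τ i) j (λ {w} w∈ →
    subst (w ∈_) (trans (sym (V≡piece i)) (trans (sym V≡) V-piece)) w∈)
    where
    V-piece : V (G [ piece decomp j ]) ≡ piece decomp j
    V-piece = Enumerate.V-induced G (decomp⊆V decomp ∘ piece⊆ decomp j)

  σ : Fin (pieces decomp) → Fin size
  σ j = proj₁ (σ-exists j)

  τσ : ∀ j → τ (σ j) ≡ j
  τσ j = proj₂ (σ-exists j)

  τ-injective : ∀ {i j} → τ i ≡ τ j → i ≡ j
  τ-injective {i} {j} eq = block-determined (trans (V≡piece i) (trans (cong (piece decomp) eq) (sym (V≡piece j))))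

  blockSum : (Fin size → Fin m → ℕ) → Fin n → Fin m → ℕ
  blockSum F v x = sum (λ i → if does (v ∈? V (block i)) then F i x else 0)

  total≡blockSum : ∀ F v x → total X decomp F v x ≡ blockSum (F ∘ τ) v x
  total≡blockSum F v x = sym (sum-reindex ⊤ ⊤ _ _ τ (λ _ → ∈⊤) (λ _ _ → τ-injective)
    (λ {j} _ → σ j , ∈⊤ , τσ j)
    (λ {i} _ → cong (λ A → when (v ∈? A) (F (τ i) x)) (sym (V≡piece i)))
    (λ ∉ → ⊥-elim (∉ ∈⊤)) (λ ∉ → ⊥-elim (∉ ∈⊤)))

  confs : ∀ i → IsBlockConfiguration (restrict T (block i) (g (τ i)))
  confs i = conf (τ i) (block i) (V≡piece i) (block-induced {B = block i} {G} (isBlock i))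

  -- The competing family is moved to the pieces along `σ`, where the uniqueness along the tree
  -- applies.
  unique : ∀ F′ → (∀ i → IsBlockConfiguration (restrict T (block i) (F′ i))) →
    (∀ {v x} → v ∈ V G → x ∈ X v → f x ≡ blockSum F′ v x) →
    ∀ i {v x} → v ∈ V (block i) → x ∈ X v → g (τ i) x ≡ F′ i x
  unique F′ confs′ f≡ i {v} {x} v∈ x∈ = trans
    -- The sums agree at every vertex here, so any vertex can serve as root.
    (totals-determine X decomp g (F′ ∘ σ) rigid (proj₂ (decomp-nonempty decomp))
      (λ {w} {y} w∈ _ y∈ → trans (sym (f≡total (S⊆V w∈) y∈)) (trans (f≡ (S⊆V w∈) y∈)
        (sym (trans (total≡blockSum (F′ ∘ σ) w y)
          (sum-cong-≗ λ l → cong (λ h → when (w ∈? V (block l)) (F′ h y)) (τ-injective (τσ (τ l))))))))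
      (τ i) (subst (v ∈_) (V≡piece i) v∈) x∈)
    (cong (λ h → F′ h x) (τ-injective (τσ (τ i))))
    where
    S⊆V : S ⊆ V G
    S⊆V = decomp⊆V decomp
    rigid : ∀ j → Rigid X (piece decomp j) (g j) (F′ (σ j))
    rigid j = subst (λ h → Rigid X (piece decomp h) (g h) (F′ (σ j))) (τσ j)
      (subst (λ A → Rigid X A (g (τ (σ j))) (F′ (σ j))) (V≡piece (σ j))
        (propagates⇒rigid T {block (σ j)} (proj₁ (_IsBlockOf_.nonsep (isBlock (σ j))))
          (propagates _ (confs (σ j))) (propagates _ (confs′ (σ j)))))

proposition9 : ∀ {n m} (T : Tuple n m) → Constructible T →
  let open Tuple T
      open BlockEnumeration (blocks G)
  in ∃! {A = Fin size → Fin m → ℕ}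
       (λ F F′ → ∀ i x → x ∈ V (coverGraph T (block i)) → F i x ≡ F′ i x)
       (λ F →
         (∀ i → let Tᴮ = restrict T (block i) (F i)
                in IsMConfiguration Tᴮ ⊎ IsKConfiguration Tᴮ ⊎ IsCConfiguration Tᴮ) ×
         (∀ {v x} → v ∈ V G → x ∈ X v →
           f x ≡ sum (λ i → if does (v ∈? V (block i)) then F i x else 0)))
proposition9 T c =
  g ∘ τ , (confs , λ {v} {x} v∈ x∈ → trans (f≡total v∈ x∈) (total≡blockSum g v x)) ,
  λ {F′} (confs′ , f≡) i x x∈ →
    let v , v∈ , x∈X = ∈⋃⁻ {S = V (block i)} {X} (p∩q⊆q (V H) _ x∈) in unique F′ confs′ f≡ i v∈ x∈X
  where
  open Tuple T using (G; X; H)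
  open BlockEnumeration (blocks G) using (block)
  open Blocks T c
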